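{- Let $(G,\sigma)$ be a flow-admissible signed graph. If $(G,\sigma)$ contains no long barbells, then $(G,\sigma)$ admits a nowhere-zero $6$-flow.
   Context: A signed graph $(G,\sigma)$ is a graph $G$ together with a signature $\sigma:E(G)\to\{ -1,+1\}$; edges with $\sigma(e)=-1$ are negative, the others positive. A circuit (connected $2$-regular subgraph) is balanced if it contains an even number of negative edges and unbalanced otherwise. A long barbell is the union of two vertex-disjoint unbalanced circuits together with a path that meets the two circuits only at its two ends; $(G,\sigma)$ contains no long barbells if no subgraph of it is a long barbell. Each edge $e=uv$ consists of two half-edges $h_e^u$ (incident with $u$) and $h_e^v$ (incident with $v$); $H(v)$ denotes the set of half-edges incident with $v$. An orientation is a map $\tau$ from the set of half-edges to $\{ -1,+1\}$ with $\tau(h_e^u)\tau(h_e^v)=-\sigma(e)$ for every edge $e=uv$. For $f:E(G)\to\mathbb{R}$, the boundary is $\partial(\tau,f)(v)=\sum_{h\in H(v)}\tau(h)f(e_h)$, where $e_h$ is the edge containing $h$; $(\tau,f)$ is a flow if $\partial(\tau,f)(v)=0$ for all $v$. A nowhere-zero $k$-flow ($k\ge2$ an integer) is a flow with $f(e)\in\mathbb{Z}$ and $1\le|f(e)|\le k-1$ for all edges $e$. $(G,\sigma)$ is flow-admissible if it admits a nowhere-zero $k$-flow for some integer $k$. -}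

module Defs where

open import Data.Nat using (ℕ; zero; suc; _+_; _≤_; _%_; _∸_)
open import Data.Integer as ℤ using (ℤ; +_; -_; ∣_∣)
open import Data.Fin using (Fin; zero; suc; inject₁; fromℕ; _≟_)
open import Data.Bool using (Bool; true; false; not; if_then_else_; _∧_)
open import Data.Product using (Σ; ∃; _×_; _,_)
open import Data.Sum using (_⊎_)
open import Data.Empty using (⊥)
open import Relation.Nullary using (does)
open import Relation.Binary.PropositionalEquality using (_≡_)
open import Function.Definitions using (Injective)

sumℤ : (n : ℕ) → (Fin n → ℤ) → ℤ
sumℤ zero    f = + 0
sumℤ (suc n) f = f zero ℤ.+ sumℤ n (λ i → f (suc i))

sumℕ : (n : ℕ) → (Fin n → ℕ) → ℕ
sumℕ zero    f = 0
sumℕ (suc n) f = f zero + sumℕ n (λ i → f (suc i))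

-- A finite graph (loops and parallel edges allowed).
-- Edge e has two half-edges (e , false) and (e , true); end e b is the vertex
-- incident with the half-edge (e , b).
record Graph : Set where
  field
    nV  : ℕ
    nE  : ℕ
    end : Fin nE → Bool → Fin nV
open Graph public

data Sign : Set where
  pos neg : Sign

sgn : Sign → ℤ
sgn pos = + 1
sgn neg = - (+ 1)

isNeg : Sign → Bool
isNeg pos = false
isNeg neg = true

Signature : Graph → Set
Signature G = Fin (nE G) → Sign

IsOrientation : (G : Graph) → Signature G → (Fin (nE G) → Bool → ℤ) → Set
IsOrientation G σ τ =
  (∀ e b → τ e b ≡ + 1 ⊎ τ e b ≡ - (+ 1)) ×
  (∀ e → τ e false ℤ.* τ e true ≡ - sgn (σ e))

boundary : (G : Graph) → (Fin (nE G) → Bool → ℤ) → (Fin (nE G) → ℤ) → Fin (nV G) → ℤ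
boundary G τ f v = sumℤ (nE G) (λ e →
  (if does (end G e false ≟ v) then τ e false ℤ.* f e else + 0) ℤ.+
  (if does (end G e true  ≟ v) then τ e true  ℤ.* f e else + 0))

IsFlow : (G : Graph) → (Fin (nE G) → Bool → ℤ) → (Fin (nE G) → ℤ) → Set
IsFlow G τ f = ∀ v → boundary G τ f v ≡ + 0

HasNZFlow : (G : Graph) → Signature G → ℕ → Set
HasNZFlow G σ k =
  Σ (Fin (nE G) → Bool → ℤ) λ τ → Σ (Fin (nE G) → ℤ) λ f →
    IsOrientation G σ τ × IsFlow G τ f ×
    (∀ e → 1 ≤ ∣ f e ∣ × ∣ f e ∣ ≤ k ∸ 1)

FlowAdmissible : (G : Graph) → Signature G → Set
FlowAdmissible G σ = ∃ λ k → 2 ≤ k × HasNZFlow G σ k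

-- Subgraphs given by an edge set S; its vertices are the ends of its edges.
EdgeSet : Graph → Set
EdgeSet G = Fin (nE G) → Bool

InV : (G : Graph) → EdgeSet G → Fin (nV G) → Set
InV G S v = ∃ λ e → S e ≡ true × ∃ λ b → end G e b ≡ v

-- degree of v in S (a loop contributes 2)
deg : (G : Graph) → EdgeSet G → Fin (nV G) → ℕ
deg G S v = sumℕ (nE G) (λ e → if S e then
  ((if does (end G e false ≟ v) then 1 else 0) + (if does (end G e true ≟ v) then 1 else 0))
  else 0)

data WalkIn (G : Graph) (S : EdgeSet G) : Fin (nV G) → Fin (nV G) → Set where
  nil  : ∀ {v} → WalkIn G S v v
  cons : ∀ {u w v} (e : Fin (nE G)) (b : Bool) → S e ≡ true →
         end G e b ≡ u → end G e (not b) ≡ w → WalkIn G S w v → WalkIn G S u v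

IsCircuit : (G : Graph) → EdgeSet G → Set
IsCircuit G S =
  (∃ λ e → S e ≡ true) ×
  (∀ v → InV G S v → deg G S v ≡ 2) ×
  (∀ u v → InV G S u → InV G S v → WalkIn G S u v)

negCount : (G : Graph) → Signature G → EdgeSet G → ℕ
negCount G σ S = sumℕ (nE G) (λ e → if S e ∧ isNeg (σ e) then 1 else 0)

Unbalanced : (G : Graph) → Signature G → EdgeSet G → Set
Unbalanced G σ S = negCount G σ S % 2 ≡ 1

IsPath : (G : Graph) (l : ℕ) → (Fin (suc l) → Fin (nV G)) → (Fin l → Fin (nE G)) → Set
IsPath G l p q =
  Injective _≡_ _≡_ p × Injective _≡_ _≡_ q ×
  (∀ i → ∃ λ b → end G (q i) b ≡ p (inject₁ i) × end G (q i) (not b) ≡ p (suc i))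

IsLongBarbell : (G : Graph) → Signature G → EdgeSet G → EdgeSet G →
                (l : ℕ) → (Fin (suc l) → Fin (nV G)) → (Fin l → Fin (nE G)) → Set
IsLongBarbell G σ C₁ C₂ l p q =
  IsCircuit G C₁ × Unbalanced G σ C₁ ×
  IsCircuit G C₂ × Unbalanced G σ C₂ ×
  (∀ v → InV G C₁ v → InV G C₂ v → ⊥) ×
  IsPath G l p q ×
  InV G C₁ (p zero) × InV G C₂ (p (fromℕ l)) ×
  (∀ i → InV G C₁ (p i) → i ≡ zero) ×
  (∀ i → InV G C₂ (p i) → i ≡ fromℕ l)

ContainsLongBarbell : (G : Graph) → Signature G → Set
ContainsLongBarbell G σ =
  Σ (EdgeSet G) λ C₁ → Σ (EdgeSet G) λ C₂ → Σ ℕ λ l →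
  Σ (Fin (suc l) → Fin (nV G)) λ p → Σ (Fin l → Fin (nE G)) λ q →
  IsLongBarbell G σ C₁ C₂ l p q

{-# OPTIONS --safe #-}
-- Fix a reference orientation; a flow is then an integer function f with ∂ f = 0, and a
-- nowhere-zero 6-flow is obtained in two steps.
--
-- (1) A flow F with no value divisible by 6.  A 2-edge-cut has a balanced side, since there
-- is no long barbell, hence it may be contracted; so let the graph be 3-edge-connected.
-- Take F = 3 h + 2 g, where h is odd on a union of closed trails and g, following Seymour,
-- is made nonzero modulo 3 off these trails: a connected subgraph is enlarged by adjoining
-- edge-disjoint trails together with at most two further edges, and the values on these
-- two edges are corrected by a multiple of one flow.  Everything disjoint from an unbalanced
-- part is balanced, so only the start needs care in an unbalanced graph.  Switch so that the
-- number of negative edges is minimal.  By admissibility there are two negative edges u₁v₁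
-- and u₂v₂, and by minimality the positive edges form a bridgeless subgraph.  In it there
-- are either edge-disjoint paths from u₁ to v₁ and from u₂ to v₂, giving two edge-disjoint
-- unbalanced closed trails that meet, or a closed trail through all four vertices, of which
-- u₁v₁ and u₂v₂ are unbalancing chords.
--
-- (2) Rounding F / 6 to an integral flow.  Among all roundings choose one minimizing the total
-- excess.  A unit of excess is a token that moves along edges by changing their rounding.
-- If the token visits every vertex with one sign only, then the visited vertices violate
-- conservation for F.  Otherwise the visited part is unbalanced.  By parity a second token
-- exists; either it meets the first one and cancels it, or it visits an unbalanced part
-- disjoint from the first one, which gives a long barbell.
--
-- Reachability arguments are classical and take place under double negation; the existence
-- of a flow with values in [-5, 5] is decidable, which removes the negations at the end.
module Submission where

open import Defs
open import Data.Nat as ℕ using (ℕ; zero; suc; s≤s; z≤n)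
import Data.Nat.Properties as ℕₚ
import Data.Nat.DivMod as ℕDM
open import Data.Integer as ℤ using (ℤ; +_; -[1+_]; _+_; _*_; -_; _-_; 0ℤ; 1ℤ; ∣_∣)
import Data.Integer.Properties as ℤₚ
import Data.Integer.DivMod as ℤDM
open import Data.Integer.Divisibility.Signed using (_∣_; divides; _∣?_; ∣m∣n⇒∣m+n; ∣m⇒∣m*n; ∣n⇒∣m*n; ∣m⇒∣-m; ∣m+n∣m⇒∣n)
open import Data.Integer.Tactic.RingSolver using (solve-∀)
open import Data.Fin as Fin using (Fin; zero; suc; toℕ; fromℕ; inject₁; _≟_)
import Data.Fin.Properties as Finₚ
open import Data.Bool using (Bool; true; false; not; if_then_else_; _∧_; _∨_; _xor_)
import Data.Bool.Properties as Boolₚ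
open import Data.Product using (Σ; ∃; ∃₂; _×_; _,_; proj₁; proj₂)
open import Data.Sum using (_⊎_; inj₁; inj₂; [_,_]′)
open import Data.Empty using (⊥; ⊥-elim)
open import Data.Unit using (⊤; tt)
open import Data.Maybe using (Maybe; just; nothing)
open import Data.Vec using (Vec; []; _∷_; lookup; tabulate)
open import Data.Vec.Properties using (lookup∘tabulate)
open import Relation.Nullary using (¬_; Dec; yes; no; does; contradiction)
open import Relation.Nullary.Decidable using (¬¬-excluded-middle; decidable-stable; from-no; map′; _×-dec_)
open import Relation.Binary.PropositionalEquality using (_≡_; _≢_; refl; sym; trans; cong; cong₂; subst; subst₂; module ≡-Reasoning)
open import Function using (_∘_; id; case_of_)
import Data.Nat.Tactic.RingSolver as NatSolver

-- In an ordinary graph every boundary sums to zero, and an integral flow without values divisible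
-- by 6 can always be reduced by multiples of 6 to values between -5 and 5. In a signed graph the
-- sum of a boundary is only known to be even, so the usual argument breaks down and units of excess
-- may be left over; hence the second step. The hypothesis is used in one form throughout: inside a
-- component, no vertex set is unbalanced together with its complement. This form passes to
-- contractions by taking preimages, whereas circuits and paths would have to be tracked; they are
-- constructed only once, to derive it. Balance is likewise expressed by a sign for each vertex, so
-- that it meets boundaries through double counting. The coefficients in `3 h + 2 g` make the value
-- indivisible by 6 as soon as `h` is odd or `g` is nonzero modulo 3. An unbalanced closed walk can
-- only produce boundary 2 at a vertex, not 1. Correcting flows are therefore built with doubled
-- values, which is harmless because 2 is invertible modulo 3.

_>>=_ : ∀ {ℓ ℓ′} {A : Set ℓ} {B : Set ℓ′} → ¬ ¬ A → (A → ¬ ¬ B) → ¬ ¬ B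
(x >>= f) k = x (λ a → f a k)

return : ∀ {ℓ} {A : Set ℓ} → A → ¬ ¬ A
return a k = k a

em : ∀ {ℓ} (A : Set ℓ) → ¬ ¬ Dec A
em A = ¬¬-excluded-middle

absurd¬¬ : ¬ ¬ ⊥ → ⊥
absurd¬¬ k = k id

¬¬-∀ : ∀ n {P : Fin n → Set} → (∀ i → ¬ ¬ P i) → ¬ ¬ (∀ i → P i)
¬¬-∀ zero    p = return λ ()
¬¬-∀ (suc n) p = do
  p₀ ← p zero
  ps ← ¬¬-∀ n (p ∘ suc)
  return λ { zero → p₀ ; (suc i) → ps i }

-- Reachability has to become a Boolean set, since cuts are complemented, counted and branched upon.
-- On a finite type this is available under double negation.
record SetOf {n : ℕ} (P : Fin n → Set) : Set where
  field
    mem   : Fin n → Bool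
    sound : ∀ i → mem i ≡ true → P i
    compl : ∀ i → P i → mem i ≡ true

setOf : ∀ {n} (P : Fin n → Set) → ¬ ¬ SetOf P
setOf {n} P = do
  d ← ¬¬-∀ n (λ i → em (P i))
  return record
    { mem   = λ i → does (d i)
    ; sound = λ i → snd (d i)
    ; compl = λ i → cmp (d i) }
  where
  snd : {A : Set} (d : Dec A) → does d ≡ true → A
  snd (yes a) _ = a
  cmp : {A : Set} (d : Dec A) → A → does d ≡ true
  cmp (yes _) _ = refl
  cmp (no ¬a) a = contradiction a ¬a

true≢false : ∀ {b} → b ≡ true → b ≡ false → ⊥
true≢false refl ()

¬true : ∀ {b} → ¬ (b ≡ true) → b ≡ false
¬true {false} _ = refl
¬true {true}  p = contradiction refl p

not-true : ∀ {b} → b ≡ false → not b ≡ true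
not-true refl = refl

not-true⁻ : ∀ {b} → not b ≡ true → b ≡ false
not-true⁻ {false} _ = refl

-- Finite sums and the descent principle

sum-cong : ∀ n {f g : Fin n → ℤ} → (∀ i → f i ≡ g i) → sumℤ n f ≡ sumℤ n g
sum-cong zero    h = refl
sum-cong (suc n) h = cong₂ _+_ (h zero) (sum-cong n (h ∘ suc))

sum-zero : ∀ n {f : Fin n → ℤ} → (∀ i → f i ≡ 0ℤ) → sumℤ n f ≡ 0ℤ
sum-zero zero    h = refl
sum-zero (suc n) h = cong₂ _+_ (h zero) (sum-zero n (h ∘ suc))

private
  interchange : ∀ (a b c d : ℤ) → (a + b) + (c + d) ≡ (a + c) + (b + d)
  interchange = solve-∀

sum-+ : ∀ n (f g : Fin n → ℤ) → sumℤ n (λ i → f i + g i) ≡ sumℤ n f + sumℤ n g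
sum-+ zero    f g = refl
sum-+ (suc n) f g = trans (cong (λ z → f zero + g zero + z) (sum-+ n (f ∘ suc) (g ∘ suc)))
                          (interchange (f zero) (g zero) _ _)

sum-* : ∀ n c (f : Fin n → ℤ) → sumℤ n (λ i → c * f i) ≡ c * sumℤ n f
sum-* zero    c f = sym (ℤₚ.*-zeroʳ c)
sum-* (suc n) c f = trans (cong (λ z → c * f zero + z) (sum-* n c (f ∘ suc)))
                          (sym (ℤₚ.*-distribˡ-+ c (f zero) _))

sum-swap : ∀ n m (f : Fin n → Fin m → ℤ) →
  sumℤ n (λ i → sumℤ m (f i)) ≡ sumℤ m (λ j → sumℤ n (λ i → f i j))
sum-swap zero    m f = sym (sum-zero m (λ _ → refl))
sum-swap (suc n) m f = trans (cong (λ z → sumℤ m (f zero) + z) (sum-swap n m (f ∘ suc)))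
                            (sym (sum-+ m (f zero) _))

δ : ∀ {n} → Fin n → Fin n → ℤ
δ i j = if does (i ≟ j) then 1ℤ else 0ℤ

δ-refl : ∀ {n} (i : Fin n) → δ i i ≡ 1ℤ
δ-refl i with i ≟ i
... | yes _ = refl
... | no p  = contradiction refl p

δ-≢ : ∀ {n} {i j : Fin n} → i ≢ j → δ i j ≡ 0ℤ
δ-≢ {i = i} {j} p with i ≟ j
... | yes q = contradiction q p
... | no _  = refl

sum-single : ∀ n (j : Fin n) (f : Fin n → ℤ) → (∀ i → i ≢ j → f i ≡ 0ℤ) → sumℤ n f ≡ f j
sum-single (suc n) zero f h =
  trans (cong (λ z → f zero + z) (sum-zero n (λ i → h (suc i) λ ()))) (ℤₚ.+-identityʳ _)
sum-single (suc n) (suc j) f h =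
  trans (cong₂ _+_ (h zero λ ()) (sum-single n j (f ∘ suc) (λ i p → h (suc i) (p ∘ Finₚ.suc-injective))))
        (ℤₚ.+-identityˡ _)

sum-δ : ∀ n (j : Fin n) (f : Fin n → ℤ) → sumℤ n (λ i → δ j i * f i) ≡ f j
sum-δ n j f = trans
  (sum-single n j _ (λ i p → cong (_* f i) (δ-≢ (p ∘ sym))))
  (trans (cong (_* f j) (δ-refl j)) (ℤₚ.*-identityˡ _))

sum-pair : ∀ n (j k : Fin n) → j ≢ k → (f : Fin n → ℤ) →
  (∀ i → i ≢ j → i ≢ k → f i ≡ 0ℤ) → sumℤ n f ≡ f j + f k
sum-pair n j k j≢k f h = begin
  sumℤ n f                                       ≡⟨ sum-cong n split ⟩
  sumℤ n (λ i → δ j i * f i + δ k i * f i)       ≡⟨ sum-+ n _ _ ⟩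
  sumℤ n (λ i → δ j i * f i) + sumℤ n (λ i → δ k i * f i) ≡⟨ cong₂ _+_ (sum-δ n j f) (sum-δ n k f) ⟩
  f j + f k ∎
  where
  open ≡-Reasoning
  split : ∀ i → f i ≡ δ j i * f i + δ k i * f i
  split i with j ≟ i | k ≟ i
  ... | yes refl | yes refl = contradiction refl j≢k
  ... | yes _    | no _     = sym (trans (ℤₚ.+-identityʳ _) (ℤₚ.*-identityˡ _))
  ... | no _     | yes _    = sym (trans (ℤₚ.+-identityˡ _) (ℤₚ.*-identityˡ _))
  ... | no p     | no q     = h i (p ∘ sym) (q ∘ sym)

sum-nonneg : ∀ n (f : Fin n → ℤ) → (∀ i → 0ℤ ℤ.≤ f i) → 0ℤ ℤ.≤ sumℤ n f
sum-nonneg zero    f h = ℤₚ.≤-refl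
sum-nonneg (suc n) f h = ℤₚ.+-mono-≤ (h zero) (sum-nonneg n (f ∘ suc) (h ∘ suc))

sum-pos : ∀ n (f : Fin n → ℤ) → (∀ i → 0ℤ ℤ.≤ f i) → ∀ j → 0ℤ ℤ.< f j → 0ℤ ℤ.< sumℤ n f
sum-pos (suc n) f h zero    p = ℤₚ.+-mono-<-≤ p (sum-nonneg n (f ∘ suc) (h ∘ suc))
sum-pos (suc n) f h (suc j) p = ℤₚ.+-mono-≤-< (h zero) (sum-pos n (f ∘ suc) (h ∘ suc) j p)

sum-nonpos : ∀ n (f : Fin n → ℤ) → (∀ i → f i ℤ.≤ 0ℤ) → sumℤ n f ℤ.≤ 0ℤ
sum-nonpos zero    f h = ℤₚ.≤-refl
sum-nonpos (suc n) f h = ℤₚ.+-mono-≤ (h zero) (sum-nonpos n (f ∘ suc) (h ∘ suc))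

sumℕ-mono : ∀ n {f g : Fin n → ℕ} → (∀ i → f i ℕ.≤ g i) → sumℕ n f ℕ.≤ sumℕ n g
sumℕ-mono zero    h = z≤n
sumℕ-mono (suc n) h = ℕₚ.+-mono-≤ (h zero) (sumℕ-mono n (h ∘ suc))

sumℕ-strict : ∀ n {f g : Fin n → ℕ} → (∀ i → f i ℕ.≤ g i) → ∀ j → f j ℕ.< g j → sumℕ n f ℕ.< sumℕ n g
sumℕ-strict (suc n) h zero    p = ℕₚ.+-mono-<-≤ p (sumℕ-mono n (h ∘ suc))
sumℕ-strict (suc n) h (suc j) p = ℕₚ.+-mono-≤-< (h zero) (sumℕ-strict n (h ∘ suc) j p)

sumℕ-cong : ∀ n {f g : Fin n → ℕ} → (∀ i → f i ≡ g i) → sumℕ n f ≡ sumℕ n g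
sumℕ-cong zero    h = refl
sumℕ-cong (suc n) h = cong₂ ℕ._+_ (h zero) (sumℕ-cong n (h ∘ suc))

sumℕ-+ : ∀ n (f g : Fin n → ℕ) → sumℕ n (λ i → f i ℕ.+ g i) ≡ sumℕ n f ℕ.+ sumℕ n g
sumℕ-+ zero    f g = refl
sumℕ-+ (suc n) f g = trans (cong ((f zero ℕ.+ g zero) ℕ.+_) (sumℕ-+ n (f ∘ suc) (g ∘ suc)))
                           (interchangeℕ (f zero) (g zero) _ _)
  where
  interchangeℕ : ∀ a b c d → (a ℕ.+ b) ℕ.+ (c ℕ.+ d) ≡ (a ℕ.+ c) ℕ.+ (b ℕ.+ d)
  interchangeℕ = NatSolver.solve-∀

sumℕ-zero : ∀ n {f : Fin n → ℕ} → (∀ i → f i ≡ 0) → sumℕ n f ≡ 0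
sumℕ-zero zero    h = refl
sumℕ-zero (suc n) h = cong₂ ℕ._+_ (h zero) (sumℕ-zero n (h ∘ suc))

δℕ : ∀ {n} → Fin n → Fin n → ℕ
δℕ i j = if does (i ≟ j) then 1 else 0

δℕ-refl : ∀ {n} (i : Fin n) → δℕ i i ≡ 1
δℕ-refl i with i ≟ i
... | yes _ = refl
... | no p  = contradiction refl p

δℕ-≢ : ∀ {n} {i j : Fin n} → i ≢ j → δℕ i j ≡ 0
δℕ-≢ {i = i} {j} p with i ≟ j
... | yes q = contradiction q p
... | no _  = refl

sumℕ-single : ∀ n (j : Fin n) (f : Fin n → ℕ) → (∀ i → i ≢ j → f i ≡ 0) → sumℕ n f ≡ f j
sumℕ-single (suc n) zero f h =
  trans (cong (f zero ℕ.+_) (sumℕ-zero n (λ i → h (suc i) λ ()))) (ℕₚ.+-identityʳ _)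
sumℕ-single (suc n) (suc j) f h =
  cong₂ ℕ._+_ (h zero λ ()) (sumℕ-single n j (f ∘ suc) (λ i p → h (suc i) (p ∘ Finₚ.suc-injective)))

sumℕ-δ : ∀ n (j : Fin n) → sumℕ n (δℕ j) ≡ 1
sumℕ-δ n j = trans (sumℕ-single n j (δℕ j) (λ i p → δℕ-≢ (p ∘ sym))) (δℕ-refl j)

≢0-stable : ∀ {k} → ¬ (k ≢ 0) → k ≡ 0
≢0-stable {k} = decidable-stable (k ℕₚ.≟ 0)

self-cancel : ∀ (x : ℤ) → x + - 1ℤ * x ≡ 0ℤ
self-cancel = solve-∀

single : ∀ {n} → Fin n → Fin n → Bool
single x v = does (x ≟ v)

single-refl : ∀ {n} (x : Fin n) → single x x ≡ true
single-refl x with x ≟ x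
... | yes _ = refl
... | no ne = contradiction refl ne

single-≢ : ∀ {n} {x v : Fin n} → x ≢ v → single x v ≡ false
single-≢ {x = x} {v} ne with x ≟ v
... | yes r = contradiction r ne
... | no _ = refl

single-≡ : ∀ {n} {x v : Fin n} → single x v ≡ true → x ≡ v
single-≡ {x = x} {v} h with x ≟ v
... | yes r = r

bit : Bool → ℕ
bit b = if b then 1 else 0

count : ∀ {n} → (Fin n → Bool) → ℕ
count {n} Y = sumℕ n (bit ∘ Y)

count-< : ∀ {n} (Y Z : Fin n → Bool) → (∀ i → Y i ≡ true → Z i ≡ true) →
  ∀ j → Y j ≡ false → Z j ≡ true → count Y ℕ.< count Z
count-< {n} Y Z sub j p q = sumℕ-strict n le j lt
  where
  le : ∀ i → bit (Y i) ℕ.≤ bit (Z i)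
  le i with Y i in eq
  ... | false = z≤n
  ... | true rewrite sub i eq = ℕₚ.≤-refl
  lt : bit (Y j) ℕ.< bit (Z j)
  lt rewrite p | q = ℕₚ.≤-refl

-- This replaces the choice of a minimal object; the measured type may live in any universe, as the
-- states of the growing argument require.
descent : ∀ {ℓ ℓ′} {X : Set ℓ} (μ : X → ℕ) {P : Set ℓ′} → (∀ x → ((y : X) → μ y ℕ.< μ x → ¬ ¬ P) → ¬ ¬ P) →
  X → ¬ ¬ P
descent {X = X} μ {P} step x₀ = go (suc (μ x₀)) x₀ ℕₚ.≤-refl
  where
  go : ∀ k (x : X) → μ x ℕ.< k → ¬ ¬ P
  go (suc k) x (s≤s lt) = step x (λ y y<x → go k y (ℕₚ.≤-trans y<x lt))

-- Signs and signed graphs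

_⊗_ : Sign → Sign → Sign
pos ⊗ t = t
neg ⊗ pos = neg
neg ⊗ neg = pos

opp : Sign → Sign
opp pos = neg
opp neg = pos

sgn-⊗ : ∀ s t → sgn (s ⊗ t) ≡ sgn s * sgn t
sgn-⊗ pos pos = refl
sgn-⊗ pos neg = refl
sgn-⊗ neg pos = refl
sgn-⊗ neg neg = refl

sgn-opp : ∀ s → sgn (opp s) ≡ - sgn s
sgn-opp pos = refl
sgn-opp neg = refl

sgn² : ∀ s → sgn s * sgn s ≡ 1ℤ
sgn² pos = refl
sgn² neg = refl

⊗-assoc : ∀ s t u → (s ⊗ t) ⊗ u ≡ s ⊗ (t ⊗ u)
⊗-assoc pos t   u   = refl
⊗-assoc neg pos u   = refl
⊗-assoc neg neg pos = refl
⊗-assoc neg neg neg = refl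

⊗-comm : ∀ s t → s ⊗ t ≡ t ⊗ s
⊗-comm pos pos = refl
⊗-comm pos neg = refl
⊗-comm neg pos = refl
⊗-comm neg neg = refl

⊗-self : ∀ s → s ⊗ s ≡ pos
⊗-self pos = refl
⊗-self neg = refl

⊗-identityʳ : ∀ s → s ⊗ pos ≡ s
⊗-identityʳ pos = refl
⊗-identityʳ neg = refl

IsUnit : ℤ → Set
IsUnit x = x ≡ 1ℤ ⊎ x ≡ - 1ℤ

sgn-unit : ∀ s → IsUnit (sgn s)
sgn-unit pos = inj₁ refl
sgn-unit neg = inj₂ refl

unit-* : ∀ {x y} → IsUnit x → IsUnit y → IsUnit (x * y)
unit-* (inj₁ refl) (inj₁ refl) = inj₁ refl
unit-* (inj₁ refl) (inj₂ refl) = inj₂ refl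
unit-* (inj₂ refl) (inj₁ refl) = inj₂ refl
unit-* (inj₂ refl) (inj₂ refl) = inj₁ refl

unit-neg : ∀ {x} → IsUnit x → IsUnit (- x)
unit-neg (inj₁ refl) = inj₂ refl
unit-neg (inj₂ refl) = inj₁ refl

-- The edge e is positive iff its two half-edges have opposite signs under the
-- reference orientation τ.
record SG (n m : ℕ) : Set where
  field
    head : Fin m → Bool → Fin n
    τ    : Fin m → Bool → Sign

module Core {n m : ℕ} (S : SG n m) where
  open SG S public

  t : Fin m → Bool → ℤ
  t e β = sgn (τ e β)

  σ : Fin m → Sign
  σ e = opp (τ e false ⊗ τ e true)

  -- The two half-edges are added, so a positive loop has a zero column and a negative loop
  -- contributes 2 or -2 at its vertex.
  inc : Fin m → Fin n → ℤ
  inc e v = δ (head e false) v * t e false + δ (head e true) v * t e true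

  ∂ : (Fin m → ℤ) → Fin n → ℤ
  ∂ f v = sumℤ m (λ e → inc e v * f e)

  Flow : (Fin m → ℤ) → Set
  Flow f = ∀ v → ∂ f v ≡ 0ℤ

  head-not-not : ∀ e β → head e (not (not β)) ≡ head e β
  head-not-not e β = cong (head e) (Boolₚ.not-involutive β)

  inc-β : ∀ e β v → inc e v ≡ δ (head e β) v * t e β + δ (head e (not β)) v * t e (not β)
  inc-β e false v = refl
  inc-β e true  v = ℤₚ.+-comm (δ (head e false) v * t e false) _

  σ-β : ∀ e β → sgn (σ e) ≡ - (t e β * t e (not β))
  σ-β e false = trans (sgn-opp (τ e false ⊗ τ e true)) (cong -_ (sgn-⊗ (τ e false) (τ e true)))
  σ-β e true  = trans (σ-β e false) (cong -_ (ℤₚ.*-comm (t e false) (t e true)))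

  ∂-cong : ∀ {f g} → (∀ e → f e ≡ g e) → ∀ v → ∂ f v ≡ ∂ g v
  ∂-cong h v = sum-cong m (λ e → cong (inc e v *_) (h e))

  private
    dist : ∀ (a c x y : ℤ) → a * (x + c * y) ≡ a * x + c * (a * y)
    dist = solve-∀

  ∂-lin : ∀ f c g v → ∂ (λ e → f e + c * g e) v ≡ ∂ f v + c * ∂ g v
  ∂-lin f c g v = trans (sum-cong m (λ e → dist (inc e v) c (f e) (g e)))
    (trans (sum-+ m _ _) (cong (λ z → ∂ f v + z) (sum-* m c _)))

  ∂-+ : ∀ f g v → ∂ (λ e → f e + g e) v ≡ ∂ f v + ∂ g v
  ∂-+ f g v = trans (∂-cong {g = λ e → f e + 1ℤ * g e} (λ e → cong (λ z → f e + z) (sym (ℤₚ.*-identityˡ (g e)))) v)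
    (trans (∂-lin f 1ℤ g v) (cong (λ z → ∂ f v + z) (ℤₚ.*-identityˡ _)))

  ∂-* : ∀ c g v → ∂ (λ e → c * g e) v ≡ c * ∂ g v
  ∂-* c g v = trans (sum-cong m (λ e → comm (inc e v) c (g e))) (sum-* m c _)
    where
    comm : ∀ (a c y : ℤ) → a * (c * y) ≡ c * (a * y)
    comm = solve-∀

  flow-difference : ∀ {f g} → (∀ v → ∂ f v ≡ ∂ g v) → Flow (λ e → f e + - 1ℤ * g e)
  flow-difference {f} {g} eq v = trans (∂-lin f (- 1ℤ) g v)
    (trans (cong (λ a → a + - 1ℤ * ∂ g v) (eq v)) (self-cancel (∂ g v)))

  ∂-difference : ∀ f g v {a b} → ∂ f v ≡ a → ∂ g v ≡ b → ∂ (λ e → f e + - 1ℤ * g e) v ≡ a + - 1ℤ * b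
  ∂-difference f g v p q = trans (∂-lin f (- 1ℤ) g v) (cong₂ (λ a b → a + - 1ℤ * b) p q)

  ∂-δ : ∀ e v → ∂ (δ e) v ≡ inc e v
  ∂-δ e v = trans (sum-cong m (λ e′ → ℤₚ.*-comm (inc e′ v) (δ e e′))) (sum-δ m e (λ e′ → inc e′ v))

  ∂-zero : ∀ v → ∂ (λ _ → 0ℤ) v ≡ 0ℤ
  ∂-zero v = sum-zero m (λ e → ℤₚ.*-zeroʳ (inc e v))

  -- The transpose of the incidence matrix. For weights ±1 it vanishes on `e` exactly when `σ e` is
  -- the product of the signs at the two ends.
  coef : (Fin n → ℤ) → Fin m → ℤ
  coef w e = w (head e false) * t e false + w (head e true) * t e true

  coef-β : ∀ w e β → coef w e ≡ w (head e β) * t e β + w (head e (not β)) * t e (not β)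
  coef-β w e false = refl
  coef-β w e true  = ℤₚ.+-comm (w (head e false) * t e false) _

  double-counting : ∀ (w : Fin n → ℤ) f → sumℤ n (λ v → w v * ∂ f v) ≡ sumℤ m (λ e → coef w e * f e)
  double-counting w f = begin
    sumℤ n (λ v → w v * ∂ f v)                          ≡⟨ sum-cong n (λ v → sym (sum-* m (w v) _)) ⟩
    sumℤ n (λ v → sumℤ m (λ e → w v * (inc e v * f e))) ≡⟨ sum-swap n m _ ⟩
    sumℤ m (λ e → sumℤ n (λ v → w v * (inc e v * f e))) ≡⟨ sum-cong m edge ⟩
    sumℤ m (λ e → coef w e * f e)                       ∎
    where
    open ≡-Reasoning
    expand : ∀ (w a p b q x : ℤ) → w * ((a * p + b * q) * x) ≡ (p * x) * (a * w) + (q * x) * (b * w)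
    expand = solve-∀
    collect : ∀ (p x u q v : ℤ) → (p * x) * u + (q * x) * v ≡ (u * p + v * q) * x
    collect = solve-∀
    half : ∀ e β → sumℤ n (λ v → (t e β * f e) * (δ (head e β) v * w v)) ≡ (t e β * f e) * w (head e β)
    half e β = trans (sum-* n (t e β * f e) (λ v → δ (head e β) v * w v))
                     (cong ((t e β * f e) *_) (sum-δ n (head e β) w))
    edge : ∀ e → sumℤ n (λ v → w v * (inc e v * f e)) ≡ coef w e * f e
    edge e = begin
      sumℤ n (λ v → w v * (inc e v * f e))
        ≡⟨ sum-cong n (λ v → expand (w v) (δ (head e false) v) (t e false) (δ (head e true) v) (t e true) (f e)) ⟩
      sumℤ n (λ v → (t e false * f e) * (δ (head e false) v * w v) + (t e true * f e) * (δ (head e true) v * w v))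
        ≡⟨ sum-+ n _ _ ⟩
      sumℤ n (λ v → (t e false * f e) * (δ (head e false) v * w v)) + sumℤ n
          (λ v → (t e true * f e) * (δ (head e true) v * w v))
        ≡⟨ cong₂ _+_ (half e false) (half e true) ⟩
      (t e false * f e) * w (head e false) + (t e true * f e) * w (head e true)
        ≡⟨ collect (t e false) (f e) _ (t e true) _ ⟩
      coef w e * f e ∎

  -- Balance, walks and their signed characteristic functions

  Inside : (Fin n → Bool) → Fin m → Set
  Inside Y e = ∀ β → Y (head e β) ≡ true

  Crossing : (Fin n → Bool) → Fin m → Set
  Crossing Y e = ∃ λ β → Y (head e β) ≡ true × Y (head e (not β)) ≡ false

  -- Harary's criterion taken as the definition: `s` switches every edge inside `Y` to a positive
  -- one.
  Bal : (Fin n → Bool) → Set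
  Bal Y = Σ (Fin n → Sign) λ s → ∀ e → Inside Y e → coef (sgn ∘ s) e ≡ 0ℤ

  data Walk (A : Fin m → Set) : Fin n → Fin n → Set where
    nil  : ∀ {x} → Walk A x x
    cons : ∀ {x y z} e β → A e → head e β ≡ x → head e (not β) ≡ y → Walk A y z → Walk A x z

  module _ {A : Fin m → Set} where

    infixr 5 _++_

    _++_ : ∀ {x y z} → Walk A x y → Walk A y z → Walk A x z
    nil ++ w = w
    cons e β a p q u ++ w = cons e β a p q (u ++ w)

    edge : ∀ {x y} e β → A e → head e β ≡ x → head e (not β) ≡ y → Walk A x y
    edge e β a p q = cons e β a p q nil

    back : ∀ {x y} e β → A e → head e β ≡ x → head e (not β) ≡ y → Walk A y x
    back e β a p q = cons e (not β) a q (trans (head-not-not e β) p) nil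

    rev : ∀ {x y} → Walk A x y → Walk A y x
    rev nil = nil
    rev (cons e β a p q w) = rev w ++ back e β a p q

    cnt : ∀ {x y} → Walk A x y → Fin m → ℕ
    cnt nil e′ = 0
    cnt (cons e β a p q w) e′ = δℕ e e′ ℕ.+ cnt w e′

    wsg : ∀ {x y} → Walk A x y → Sign
    wsg nil = pos
    wsg (cons e β a p q w) = σ e ⊗ wsg w

    -- One unit sent along the walk; behind a negative edge the orientation of the rest is reversed,
    -- whence the factor `sgn (σ e)`.
    χ : ∀ {x y} → Walk A x y → Fin m → ℤ
    χ nil e′ = 0ℤ
    χ (cons e β a p q w) e′ = t e β * δ e e′ + sgn (σ e) * χ w e′

    On : ∀ {x y} → Fin n → Walk A x y → Set
    On {x} v nil = x ≡ v
    On {x} v (cons e β a p q w) = x ≡ v ⊎ On v w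

    On? : ∀ {x y} v (w : Walk A x y) → Dec (On v w)
    On? {x} v nil = x ≟ v
    On? {x} v (cons e β a p q w) with x ≟ v | On? v w
    ... | yes r | _     = yes (inj₁ r)
    ... | no  r | yes o = yes (inj₂ o)
    ... | no  r | no  o = no [ r , o ]′

    on-start : ∀ {x y} (w : Walk A x y) → On x w
    on-start nil = refl
    on-start (cons e β a p q w) = inj₁ refl

    on-end : ∀ {x y} (w : Walk A x y) → On y w
    on-end nil = refl
    on-end (cons e β a p q w) = inj₂ (on-end w)

    cnt-++ : ∀ {x y z} (u : Walk A x y) (w : Walk A y z) e → cnt (u ++ w) e ≡ cnt u e ℕ.+ cnt w e
    cnt-++ nil w e = refl
    cnt-++ (cons e′ β a p q u) w e = trans (cong (δℕ e′ e ℕ.+_) (cnt-++ u w e)) (sym (ℕₚ.+-assoc (δℕ e′ e) _ _))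

    cnt-rev : ∀ {x y} (w : Walk A x y) e → cnt (rev w) e ≡ cnt w e
    cnt-rev nil e = refl
    cnt-rev (cons e′ β a p q w) e = trans (cnt-++ (rev w) _ e)
      (trans (cong₂ ℕ._+_ (cnt-rev w e) (ℕₚ.+-identityʳ (δℕ e′ e))) (ℕₚ.+-comm (cnt w e) _))

    wsg-++ : ∀ {x y z} (u : Walk A x y) (w : Walk A y z) → wsg (u ++ w) ≡ wsg u ⊗ wsg w
    wsg-++ nil w = refl
    wsg-++ (cons e β a p q u) w = trans (cong (σ e ⊗_) (wsg-++ u w)) (sym (⊗-assoc (σ e) _ _))

    wsg-rev : ∀ {x y} (w : Walk A x y) → wsg (rev w) ≡ wsg w
    wsg-rev nil = refl
    wsg-rev (cons e β a p q w) = trans (wsg-++ (rev w) _)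
      (trans (cong₂ _⊗_ (wsg-rev w) (⊗-identityʳ (σ e))) (⊗-comm (wsg w) (σ e)))

    -- Inner vertices cancel by `σ-β`. Hence a positive closed walk carries a flow, and a negative
    -- one has boundary 2 at its base vertex.
    ∂χ : ∀ {x y} (w : Walk A x y) v → ∂ (χ w) v ≡ δ x v - sgn (wsg w) * δ y v
    ∂χ {x} nil v = trans (∂-zero v) (self (δ x v))
      where
      self : ∀ (z : ℤ) → 0ℤ ≡ z - 1ℤ * z
      self = solve-∀
    ∂χ {x} {y} (cons e β a refl refl w) v = begin
      ∂ (χ (cons e β a refl refl w)) v
        ≡⟨ ∂-lin (λ e′ → t e β * δ e e′) (sgn (σ e)) (χ w) v ⟩
      ∂ (λ e′ → t e β * δ e e′) v + sgn (σ e) * ∂ (χ w) v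
        ≡⟨ cong₂ _+_ (trans (∂-* (t e β) (δ e) v) (cong (t e β *_) (trans (∂-δ e v) (inc-β e β v))))
                     (cong₂ _*_ (σ-β e β) (∂χ w v)) ⟩
      t e β * (X * t e β + W * t e (not β)) + - (t e β * t e (not β)) * (W - g * Y)
        ≡⟨ calc (t e β) (t e (not β)) X W g Y ⟩
      (t e β * t e β) * X - (- (t e β * t e (not β)) * g) * Y
        ≡⟨ cong₂ (λ a b → a * X - b * Y) (sgn² (τ e β))
             (trans (cong (_* g) (sym (σ-β e β))) (sym (sgn-⊗ (σ e) (wsg w)))) ⟩
      1ℤ * X - sgn (σ e ⊗ wsg w) * Y
        ≡⟨ cong (_- sgn (σ e ⊗ wsg w) * Y) (ℤₚ.*-identityˡ X) ⟩
      X - sgn (σ e ⊗ wsg w) * Y ∎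
      where
      open ≡-Reasoning
      X = δ (head e β) v
      W = δ (head e (not β)) v
      Y = δ y v
      g = sgn (wsg w)
      calc : ∀ (a b X W g Y : ℤ) →
        a * (X * a + W * b) + - (a * b) * (W - g * Y) ≡ (a * a) * X - (- (a * b) * g) * Y
      calc = solve-∀

    χ-zero : ∀ {x y} (w : Walk A x y) e → cnt w e ≡ 0 → χ w e ≡ 0ℤ
    χ-zero nil e h = refl
    χ-zero (cons e′ β a p q w) e h with e′ ≟ e
    χ-zero (cons e′ β a p q w) e () | yes _
    ... | no _ = trans (cong₂ _+_ (ℤₚ.*-zeroʳ (t e′ β)) (cong (sgn (σ e′) *_) (χ-zero w e h)))
                       (trans (ℤₚ.+-identityˡ _) (ℤₚ.*-zeroʳ (sgn (σ e′))))

    χ-unit : ∀ {x y} (w : Walk A x y) e → cnt w e ≡ 1 → IsUnit (χ w e)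
    χ-unit (cons e′ β a p q w) e h with e′ ≟ e
    ... | yes _ = subst IsUnit
      (sym (trans (cong₂ _+_ (ℤₚ.*-identityʳ (t e′ β))
              (trans (cong (sgn (σ e′) *_) (χ-zero w e (ℕₚ.suc-injective h))) (ℤₚ.*-zeroʳ (sgn (σ e′)))))
            (ℤₚ.+-identityʳ (t e′ β))))
      (sgn-unit (τ e′ β))
    ... | no _ = subst IsUnit
      (sym (trans (cong (_+ sgn (σ e′) * χ w e) (ℤₚ.*-zeroʳ (t e′ β))) (ℤₚ.+-identityˡ _)))
      (unit-* (sgn-unit (σ e′)) (χ-unit w e h))

    cnt⇒A : ∀ {x y} (w : Walk A x y) e → cnt w e ≢ 0 → A e
    cnt⇒A nil e h = contradiction refl h
    cnt⇒A (cons e′ β a p q w) e h with e′ ≟ e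
    ... | yes refl = a
    ... | no _     = cnt⇒A w e h

    cnt⇒On : ∀ {x y} (w : Walk A x y) e → cnt w e ≢ 0 → ∀ β → On (head e β) w
    cnt⇒On nil e h β = contradiction refl h
    cnt⇒On (cons e′ β′ a p q w) e h β with e′ ≟ e
    ... | no _     = inj₂ (cnt⇒On w e h β)
    ... | yes refl with β Boolₚ.≟ β′
    ...   | yes refl = inj₁ (sym p)
    ...   | no β≢ = inj₂ (subst (λ z → On z w) (trans (sym q) (cong (head e) (sym (Boolₚ.¬-not β≢)))) (on-start w))

    Simple : ∀ {x y} → Walk A x y → Set
    Simple nil = ⊤
    Simple {x} (cons e β a p q w) = ¬ On x w × Simple w

    simple⇒trail : ∀ {x y} (w : Walk A x y) → Simple w → ∀ e → cnt w e ℕ.≤ 1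
    simple⇒trail nil s e = z≤n
    simple⇒trail (cons e′ β a refl q w) (x∉w , s) e with e′ ≟ e
    ... | no _ = simple⇒trail w s e
    ... | yes refl with cnt w e ℕₚ.≟ 0
    ...   | yes z rewrite z = s≤s z≤n
    ...   | no nz = contradiction (cnt⇒On w e nz β) x∉w

    record Split {x y : Fin n} (w : Walk A x y) (v : Fin n) : Set where
      field
        pre   : Walk A x v
        suf   : Walk A v y
        cnt≡  : ∀ e → cnt w e ≡ cnt pre e ℕ.+ cnt suf e
        wsg≡  : wsg w ≡ wsg pre ⊗ wsg suf
        on⇒   : ∀ k → On k w → On k pre ⊎ On k suf
        on-pre : ∀ k → On k pre → On k w
        on-suf : ∀ k → On k suf → On k w
        simple-suf : Simple w → Simple suf
        simple-pre : Simple w → Simple pre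

    split : ∀ {x y} (w : Walk A x y) v → On v w → Split w v
    split nil v refl = record { pre = nil ; suf = nil ; cnt≡ = λ _ → refl ; wsg≡ = refl
      ; on⇒ = λ k → inj₁ ; on-pre = λ k → id ; on-suf = λ k → id ; simple-suf = id ; simple-pre = id }
    split {x} (cons e β a p q w) v o with x ≟ v
    ... | yes refl = record { pre = nil ; suf = cons e β a p q w ; cnt≡ = λ _ → refl ; wsg≡ = refl
      ; on⇒ = λ k → inj₂ ; on-pre = λ { k refl → inj₁ refl } ; on-suf = λ k →
          id ; simple-suf = id ; simple-pre = λ _ → tt }
    ... | no x≢v = record
      { pre = cons e β a p q R.pre ; suf = R.suf
      ; cnt≡ = λ e′ → trans (cong (δℕ e e′ ℕ.+_) (R.cnt≡ e′)) (sym (ℕₚ.+-assoc (δℕ e e′) _ _))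
      ; wsg≡ = trans (cong (σ e ⊗_) R.wsg≡) (sym (⊗-assoc (σ e) _ _))
      ; on⇒ = λ { k (inj₁ r) → inj₁ (inj₁ r) ; k (inj₂ r) → [ inj₁ ∘ inj₂ , inj₂ ]′ (R.on⇒ k r) }
      ; on-pre = λ { k (inj₁ r) → inj₁ r ; k (inj₂ r) → inj₂ (R.on-pre k r) }
      ; on-suf = λ k r → inj₂ (R.on-suf k r)
      ; simple-suf = λ s → R.simple-suf (proj₂ s)
      ; simple-pre = λ s → (λ o′ → proj₁ s (R.on-pre _ o′)) , R.simple-pre (proj₂ s) }
      where
      rest : On v w
      rest = [ (λ r → contradiction r x≢v) , id ]′ o
      module R = Split (split w v rest)

    erase-loops : ∀ {x y} (w : Walk A x y) → Σ (Walk A x y) λ u → Simple u × (∀ e → cnt u e ℕ.≤ cnt w e)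
    erase-loops nil = nil , tt , λ _ → z≤n
    erase-loops {x} (cons e β a p q w) with erase-loops w
    ... | u , s , le with On? x u
    ...   | no x∉u = cons e β a p q u , (x∉u , s) , λ e′ → ℕₚ.+-monoʳ-≤ (δℕ e e′) (le e′)
    ...   | yes o = suf , simple-suf s , λ e′ → ℕₚ.≤-trans (ℕₚ.m≤n+m (cnt suf e′) (cnt pre e′))
                     (ℕₚ.≤-trans (ℕₚ.≤-reflexive (sym (cnt≡ e′))) (ℕₚ.≤-trans (le e′) (ℕₚ.m≤n+m _ (δℕ e e′))))
      where open Split (split u x o)

    -- Stopping at the first vertex of `Y` leaves each used edge with an end outside `Y`; this is
    -- how a walk is made edge-disjoint from a structure whose vertices lie in `Y`.
    first-hit : (Y : Fin n → Bool) → ∀ {x y} (w : Walk A x y) → Y y ≡ true →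
      Σ (Fin n) λ k → Σ (Walk A x k) λ u → Y k ≡ true × (∀ e → cnt u e ℕ.≤ cnt w e) ×
        (∀ e → cnt u e ≢ 0 → ∃ λ β → Y (head e β) ≡ false)
    first-hit Y {x} w y∈ with Y x in eq
    first-hit Y {x} w y∈ | true = x , nil , eq , (λ _ → z≤n) , λ _ h → contradiction refl h
    first-hit Y {x} nil y∈ | false = ⊥-elim (true≢false y∈ eq)
    first-hit Y {x} (cons e β a p q w) y∈ | false with first-hit Y w y∈
    ... | k , u , k∈ , le , out = k , cons e β a p q u , k∈ , (λ e′ → ℕₚ.+-monoʳ-≤ (δℕ e e′) (le e′)) , out′
      where
      out′ : ∀ e′ → δℕ e e′ ℕ.+ cnt u e′ ≢ 0 → ∃ λ β → Y (head e′ β) ≡ false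
      out′ e′ h with e ≟ e′
      ... | yes refl = β , trans (cong Y p) eq
      ... | no _     = out e′ h

    balanced-sign : (s : Fin n → Sign) → (∀ e → A e → coef (sgn ∘ s) e ≡ 0ℤ) →
      ∀ {x y} (w : Walk A x y) → wsg w ≡ s x ⊗ s y
    balanced-sign s bal {x} nil = sym (⊗-self (s x))
    balanced-sign s bal {x} {y} (cons e β a refl refl w) =
      trans (cong (σ e ⊗_) (balanced-sign s bal w)) (step β)
      where
      go : ∀ (a b u v z : Sign) → sgn u * sgn a + sgn v * sgn b ≡ 0ℤ → opp (a ⊗ b) ⊗ (v ⊗ z) ≡ u ⊗ z
      go pos pos pos neg pos _ = refl
      go pos pos pos neg neg _ = refl
      go pos pos neg pos pos _ = refl
      go pos pos neg pos neg _ = refl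
      go pos neg pos pos _ _ = refl
      go pos neg neg neg pos _ = refl
      go pos neg neg neg neg _ = refl
      go neg pos pos pos _ _ = refl
      go neg pos neg neg pos _ = refl
      go neg pos neg neg neg _ = refl
      go neg neg pos neg pos _ = refl
      go neg neg pos neg neg _ = refl
      go neg neg neg pos pos _ = refl
      go neg neg neg pos neg _ = refl
      step : ∀ β → σ e ⊗ (s (head e (not β)) ⊗ s y) ≡ s (head e β) ⊗ s y
      step false = go (τ e false) (τ e true) (s (head e false)) (s (head e true)) (s y) (bal e a)
      step true = trans (cong (λ z → opp z ⊗ (s (head e false) ⊗ s y)) (⊗-comm (τ e false) (τ e true)))
        (go (τ e true) (τ e false) (s (head e true)) (s (head e false)) (s y)
          (trans (ℤₚ.+-comm (sgn (s (head e true)) * t e true) (sgn (s (head e false)) * t e false)) (bal e a)))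

  wmap : {A B : Fin m → Set} → (∀ e → A e → B e) → ∀ {x y} → Walk A x y → Walk B x y
  wmap f nil = nil
  wmap f (cons e β a p q w) = cons e β (f e a) p q (wmap f w)

  cnt-wmap : {A B : Fin m → Set} (f : ∀ e → A e → B e) → ∀ {x y} (w : Walk A x y) e → cnt (wmap f w) e ≡ cnt w e
  cnt-wmap f nil e = refl
  cnt-wmap f (cons e′ β a p q w) e = cong (δℕ e′ e ℕ.+_) (cnt-wmap f w e)

  -- A balancing `s` paired with `f` gives zero edge by edge, but `c * s x` vertex by vertex.
  unbalanced-by : (O : Fin n → Bool) (f : Fin m → ℤ) (x : Fin n) →
    (∀ e → f e ≢ 0ℤ → Inside O e) → O x ≡ true → (c : ℤ) → c ≢ 0ℤ →
    (∀ v → ∂ f v ≡ c * δ x v) → ¬ Bal O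
  unbalanced-by O f x supp x∈ c c≢0 eq (s , bal) = unit≢0 (sgn-unit (s x)) total
    where
    w = sgn ∘ s
    term : ∀ e → coef w e * f e ≡ 0ℤ
    term e with f e ℤₚ.≟ 0ℤ
    ... | yes z = trans (cong (coef w e *_) z) (ℤₚ.*-zeroʳ (coef w e))
    ... | no nz = cong (_* f e) (bal e (supp e nz))
    total : c * w x ≡ 0ℤ
    total = begin
      c * w x                              ≡⟨ cong (c *_) (sym (sum-δ n x w)) ⟩
      c * sumℤ n (λ v → δ x v * w v)       ≡⟨ sym (sum-* n c _) ⟩
      sumℤ n (λ v → c * (δ x v * w v))     ≡⟨ sum-cong n (λ v → trans (re c (δ x v) (w v))
          (cong (w v *_) (sym (eq v)))) ⟩
      sumℤ n (λ v → w v * ∂ f v)           ≡⟨ double-counting w f ⟩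
      sumℤ m (λ e → coef w e * f e)        ≡⟨ sum-zero m term ⟩
      0ℤ ∎
      where
      open ≡-Reasoning
      re : ∀ (c d w : ℤ) → c * (d * w) ≡ w * (c * d)
      re = solve-∀
    unit≢0 : IsUnit (w x) → c * w x ≡ 0ℤ → ⊥
    unit≢0 (inj₁ p) q = c≢0 (trans (sym (ℤₚ.*-identityʳ c)) (trans (cong (c *_) (sym p)) q))
    unit≢0 (inj₂ p) q = c≢0 (trans (neg₂ c) (cong -_ (trans (cong (c *_) (sym p)) q)))
      where
      neg₂ : ∀ (c : ℤ) → c ≡ - (c * - 1ℤ)
      neg₂ = solve-∀

-- Rounding a flow

norm : {n : ℕ} → (Fin n → ℤ) → ℕ
norm {n} h = sumℕ n (λ v → ∣ h v ∣)

norm-cong : {n : ℕ} {g h : Fin n → ℤ} → (∀ v → g v ≡ h v) → norm g ≡ norm h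
norm-cong {n} e = sumℕ-cong n (λ v → cong ∣_∣ (e v))

bump : {n : ℕ} → (Fin n → ℤ) → Fin n → ℤ → Fin n → ℤ
bump h v c u = h u + c * δ v u

private
  bump-off : {n : ℕ} (h : Fin n → ℤ) {v u : Fin n} (c : ℤ) → v ≢ u → bump h v c u ≡ h u
  bump-off h {v} {u} c p = trans (cong (λ z → h u + c * z) (δ-≢ p))
      (trans (cong (λ z → h u + z) (ℤₚ.*-zeroʳ c)) (ℤₚ.+-identityʳ (h u)))

  bump-at : {n : ℕ} (h : Fin n → ℤ) (v : Fin n) (c : ℤ) → bump h v c v ≡ h v + c
  bump-at h v c = trans (cong (λ z → h v + c * z) (δ-refl v)) (cong (λ z → h v + z) (ℤₚ.*-identityʳ c))

sumℕ-update : ∀ {n} (f g : Fin n → ℕ) v → (∀ u → v ≢ u → f u ≡ g u) → sumℕ n f ℕ.+ g v ≡ sumℕ n g ℕ.+ f v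
sumℕ-update {suc n} f g zero h = begin
  (f zero ℕ.+ sumℕ n (f ∘ suc)) ℕ.+ g zero ≡⟨ ℕₚ.+-comm _ (g zero) ⟩
  g zero ℕ.+ (f zero ℕ.+ sumℕ n (f ∘ suc)) ≡⟨ cong (g zero ℕ.+_) (ℕₚ.+-comm (f zero) _) ⟩
  g zero ℕ.+ (sumℕ n (f ∘ suc) ℕ.+ f zero) ≡⟨ sym (ℕₚ.+-assoc (g zero) _ _) ⟩
  (g zero ℕ.+ sumℕ n (f ∘ suc)) ℕ.+ f zero ≡⟨ cong (λ z → (g zero ℕ.+ z) ℕ.+ f zero)
      (sumℕ-cong n (λ i → h (suc i) λ ())) ⟩
  (g zero ℕ.+ sumℕ n (g ∘ suc)) ℕ.+ f zero ∎
  where open ≡-Reasoning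
sumℕ-update {suc n} f g (suc v) h = begin
  (f zero ℕ.+ sumℕ n (f ∘ suc)) ℕ.+ g (suc v) ≡⟨ ℕₚ.+-assoc (f zero) _ _ ⟩
  f zero ℕ.+ (sumℕ n (f ∘ suc) ℕ.+ g (suc v)) ≡⟨ cong₂ ℕ._+_ (h zero λ ())
      (sumℕ-update (f ∘ suc) (g ∘ suc) v (λ u p → h (suc u) (p ∘ Finₚ.suc-injective))) ⟩
  g zero ℕ.+ (sumℕ n (g ∘ suc) ℕ.+ f (suc v)) ≡⟨ sym (ℕₚ.+-assoc (g zero) _ _) ⟩
  (g zero ℕ.+ sumℕ n (g ∘ suc)) ℕ.+ f (suc v) ∎
  where open ≡-Reasoning

private
  abs-up : ∀ s x → 0ℤ ℤ.≤ sgn s * x → ∣ x + sgn s ∣ ≡ suc ∣ x ∣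
  abs-up pos (+ k)      _ = ℕₚ.+-comm k 1
  abs-up pos -[1+ k ]   p = ⊥-elim (ℤₚ.<⇒≱ (ℤ.-<+ {k ℕ.+ 0}) p)
  abs-up neg (+ zero)   _ = refl
  abs-up neg (+ suc k)  p = ⊥-elim (ℤₚ.<⇒≱ (ℤ.-<+ {k ℕ.+ 0}) p)
  abs-up neg -[1+ k ]   _ = cong (λ z → suc (suc z)) (ℕₚ.+-identityʳ k)

  abs-down : ∀ s x → sgn s * x ℤ.< 0ℤ → suc ∣ x + sgn s ∣ ≡ ∣ x ∣
  abs-down pos (+ k) p = ⊥-elim (ℤₚ.<⇒≱ p (subst (0ℤ ℤ.≤_) (sym (ℤₚ.*-identityˡ (+ k))) (ℤ.+≤+ z≤n)))
  abs-down pos -[1+ zero ]  p = refl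
  abs-down pos -[1+ suc k ] p = refl
  abs-down neg (+ zero)  (ℤ.+<+ ())
  abs-down neg (+ suc k) p = refl
  abs-down neg -[1+ k ]  (ℤ.+<+ ())

norm-bump : ∀ {n} (h : Fin n → ℤ) v c → norm (bump h v c) ℕ.+ ∣ h v ∣ ≡ norm h ℕ.+ ∣ h v + c ∣
norm-bump h v c = trans (sumℕ-update _ _ v (λ u p → cong ∣_∣ (bump-off h c p)))
    (cong (λ z → norm h ℕ.+ ∣ z ∣) (bump-at h v c))

norm-up : ∀ {n} (h : Fin n → ℤ) v s → 0ℤ ℤ.≤ sgn s * h v → norm (bump h v (sgn s)) ≡ suc (norm h)
norm-up h v s p = ℕₚ.+-cancelʳ-≡ ∣ h v ∣ _ _
  (trans (norm-bump h v (sgn s)) (trans (cong (norm h ℕ.+_) (abs-up s (h v) p)) (ℕₚ.+-suc (norm h) _)))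

norm-down : ∀ {n} (h : Fin n → ℤ) v s → sgn s * h v ℤ.< 0ℤ → suc (norm (bump h v (sgn s))) ≡ norm h
norm-down h v s p = ℕₚ.+-cancelʳ-≡ ∣ h v + sgn s ∣ _ _
  (trans (trans (sym (ℕₚ.+-suc (norm (bump h v (sgn s))) _))
                (cong (norm (bump h v (sgn s)) ℕ.+_) (abs-down s (h v) p)))
         (norm-bump h v (sgn s)))

-- The sign of the change that a flip makes to the rounded value.
step-sign : Bool → Sign
step-sign false = pos
step-sign true  = neg

flip : {m : ℕ} → (Fin m → Bool) → Fin m → Fin m → Bool
flip b e e′ = if does (e ≟ e′) then not (b e′) else b e′

module Rounding {n m : ℕ} (S : SG n m) (q : Fin m → ℤ) where
  open Core S

  Config : Set
  Config = Fin m → Bool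

  val : Config → Fin m → ℤ
  val b e = q e + + bit (b e)

  ex : Config → Fin n → ℤ
  ex b = ∂ (val b)

  private
    bit-flip : ∀ c → + bit (not c) ≡ + bit c + sgn (step-sign c) * 1ℤ
    bit-flip false = refl
    bit-flip true  = refl

  val-flip : ∀ b e e′ → val (flip b e) e′ ≡ val b e′ + sgn (step-sign (b e)) * δ e e′
  val-flip b e e′ with e ≟ e′
  ... | yes refl = trans (cong (λ z → q e + z) (bit-flip (b e)))
      (sym (ℤₚ.+-assoc (q e) (+ bit (b e)) (sgn (step-sign (b e)) * 1ℤ)))
  ... | no _     = sym (trans (cong (λ z → val b e′ + z) (ℤₚ.*-zeroʳ (sgn (step-sign (b e)))))
      (ℤₚ.+-identityʳ (val b e′)))

  ex-flip : ∀ b e v → ex (flip b e) v ≡ ex b v + sgn (step-sign (b e)) * inc e v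
  ex-flip b e v = trans (∂-cong (val-flip b e) v) (trans (∂-lin (val b) (sgn (step-sign (b e))) (δ e) v)
    (cong (λ z → ex b v + sgn (step-sign (b e)) * z) (∂-δ e v)))

  -- A token of sign s at v marks one unit of excess; flipping an edge passes it on.
  data Tok (A : Fin m → Set) (b₀ : Config) (v₀ : Fin n) (s₀ : Sign) : Config → Fin n → Sign → Set where
    start : Tok A b₀ v₀ s₀ b₀ v₀ s₀
    move  : ∀ {b v s} → Tok A b₀ v₀ s₀ b v s → ∀ e β → A e → head e β ≡ v →
            τ e β ⊗ step-sign (b e) ≡ opp s →
            Tok A b₀ v₀ s₀ (flip b e) (head e (not β)) (τ e (not β) ⊗ step-sign (b e))

  module _ {A : Fin m → Set} {b₀ : Config} {v₀ : Fin n} {s₀ : Sign} where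

    -- The flip removes the token's unit at one end and creates its new unit at the other, so the
    -- excess apart from the token never changes.
    tok-ex : ∀ {b v s} → Tok A b₀ v₀ s₀ b v s → ∀ u → ex b u ≡ ex b₀ u - sgn s₀ * δ v₀ u + sgn s * δ v u
    tok-ex start u = self (ex b₀ u) (sgn s₀ * δ v₀ u)
      where
      self : ∀ (x y : ℤ) → x ≡ x - y + y
      self = solve-∀
    tok-ex (move {b} {s = s} k e β a refl h) u = begin
      ex (flip b e) u
        ≡⟨ ex-flip b e u ⟩
      ex b u + D * inc e u
        ≡⟨ cong₂ (λ x y → x + D * y) (tok-ex k u) (inc-β e β u) ⟩
      (X + sgn s * U) + D * (U * t e β + W * t e (not β))
        ≡⟨ calc X (sgn s) U D (t e β) W (t e (not β)) ⟩
      (X + (t e (not β) * D) * W) + (sgn s + t e β * D) * U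
        ≡⟨ cong₂ (λ a b → (X + a * W) + b * U) (sym (sgn-⊗ (τ e (not β)) (step-sign (b e)))) cancel ⟩
      (X + sgn (τ e (not β) ⊗ step-sign (b e)) * W) + 0ℤ
        ≡⟨ ℤₚ.+-identityʳ _ ⟩
      X + sgn (τ e (not β) ⊗ step-sign (b e)) * W ∎
      where
      open ≡-Reasoning
      X = ex b₀ u - sgn s₀ * δ v₀ u
      D = sgn (step-sign (b e))
      U = δ (head e β) u
      W = δ (head e (not β)) u
      calc : ∀ (X s U D a W c : ℤ) → (X + s * U) + D * (U * a + W * c) ≡ (X + (c * D) * W) + (s + a * D) * U
      calc = solve-∀
      cancel : sgn s + t e β * D ≡ 0ℤ
      cancel = trans (cong (λ z → sgn s + z) (trans (sym (sgn-⊗ (τ e β) (step-sign (b e))))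
          (trans (cong sgn h) (sgn-opp s)))) (ℤₚ.+-inverseʳ (sgn s))

    tok-A : ∀ {b v s} → Tok A b₀ v₀ s₀ b v s → ∀ e → b e ≢ b₀ e → A e
    tok-A start e h = contradiction refl h
    tok-A (move k e₁ β a p h₁) e h with e₁ ≟ e
    ... | yes refl = a
    ... | no _     = tok-A k e h

  Typed : (A : Fin m → Set) → Config → Fin n → Sign → Fin n → Sign → Set
  Typed A b₀ v₀ s₀ v s = ∃ λ b → Tok A b₀ v₀ s₀ b v s

  Double : (A : Fin m → Set) → Config → Fin n → Sign → Set
  Double A b₀ v₀ s₀ = ∃ λ v → Typed A b₀ v₀ s₀ v pos × Typed A b₀ v₀ s₀ v neg

  private
    opp-opp : ∀ s → opp (opp s) ≡ s
    opp-opp pos = refl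
    opp-opp neg = refl

    Bool-≢ : ∀ {x y : Bool} → not x ≢ y → x ≡ y
    Bool-≢ {false} {false} h = refl
    Bool-≢ {false} {true}  h = contradiction refl h
    Bool-≢ {true}  {false} h = contradiction refl h
    Bool-≢ {true}  {true}  h = refl

  -- The last time e left its initial state, the token traversed e.
  history : ∀ {A b₀ v₀ s₀ b v s} → Tok A b₀ v₀ s₀ b v s → ∀ e → b e ≢ b₀ e → ∃ λ β →
    Typed A b₀ v₀ s₀ (head e β) (opp (τ e β ⊗ step-sign (b₀ e))) ×
    Typed A b₀ v₀ s₀ (head e (not β)) (τ e (not β) ⊗ step-sign (b₀ e))
  history start e h = contradiction refl h
  history {A} {b₀} {v₀} {s₀} (move {b} {v} {s} k e₁ β a p h₁) e h with e₁ ≟ e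
  ... | no _ = history k e h
  ... | yes refl = β ,
      (b , subst (λ z → Tok A b₀ v₀ s₀ b z (opp (τ e β ⊗ step-sign (b₀ e)))) (sym p)
        (subst (Tok A b₀ v₀ s₀ b v) s≡ k)) ,
      (_ , subst (λ c → Tok A b₀ v₀ s₀ (flip b e) (head e (not β)) (τ e (not β) ⊗ step-sign c)) same
          (move k e β a p h₁))
    where
    same : b e ≡ b₀ e
    same = Bool-≢ h
    s≡ : s ≡ opp (τ e β ⊗ step-sign (b₀ e))
    s≡ = trans (sym (opp-opp s)) (cong opp (trans (sym h₁) (cong (λ c → τ e β ⊗ step-sign c) same)))

  typed-double : ∀ {A b₀ v₀ s₀} v s → Typed A b₀ v₀ s₀ v s → Typed A b₀ v₀ s₀ v (opp s) → Double A b₀ v₀ s₀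
  typed-double v pos p q = v , p , q
  typed-double v neg p q = v , q , p

  -- Tokens reach different vertices in different configurations; this reduces all crossings to the
  -- initial one. If `e` has been changed on the way, it was traversed in its initial state: either
  -- in the present direction, so the far end was reached, or against it, so the near end was
  -- reached with both signs.
  forward : ∀ {A b₀ v₀ s₀} → ¬ Double A b₀ v₀ s₀ → ∀ {s} e β → A e →
    Typed A b₀ v₀ s₀ (head e β) s → τ e β ⊗ step-sign (b₀ e) ≡ opp s →
    Typed A b₀ v₀ s₀ (head e (not β)) (τ e (not β) ⊗ step-sign (b₀ e))
  forward {A} {b₀} {v₀} {s₀} nd {s} e β a (b , k) h with b e Boolₚ.≟ b₀ e
  ... | yes same = _ , subst (λ c → Tok A b₀ v₀ s₀ (flip b e) (head e (not β)) (τ e (not β) ⊗ step-sign c)) same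
        (move k e β a refl (trans (cong (λ c → τ e β ⊗ step-sign c) same) h))
  ... | no diff with history k e diff
  ...   | β′ , src , tgt with β′ Boolₚ.≟ β
  ...     | yes refl = tgt
  ...     | no β≢ = contradiction (typed-double (head e β) s (b , k) other) nd
    where
    flipped : not β′ ≡ β
    flipped = trans (cong not (Boolₚ.¬-not β≢)) (Boolₚ.not-involutive β)
    other : Typed A b₀ v₀ s₀ (head e β) (opp s)
    other = subst (Typed A b₀ v₀ s₀ (head e β)) h
      (subst (λ c → Typed A b₀ v₀ s₀ (head e c) (τ e c ⊗ step-sign (b₀ e))) flipped tgt)

  private
    wt : Maybe Sign → ℤ
    wt (just s) = sgn s
    wt nothing  = 0ℤ

    wt-cases : ∀ x p → 0ℤ ℤ.≤ wt x * sgn p ⊎ (∃ λ s → x ≡ just s × p ≡ opp s)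
    wt-cases (just pos) pos = inj₁ (ℤ.+≤+ z≤n)
    wt-cases (just pos) neg = inj₂ (pos , refl , refl)
    wt-cases (just neg) pos = inj₂ (neg , refl , refl)
    wt-cases (just neg) neg = inj₁ (ℤ.+≤+ z≤n)
    wt-cases nothing p = inj₁ (ℤₚ.≤-reflexive (sym (ℤₚ.*-zeroˡ (sgn p))))

    opposite : ∀ s r → sgn s * sgn (opp s) + sgn r * sgn r ≡ 0ℤ
    opposite pos pos = refl
    opposite pos neg = refl
    opposite neg pos = refl
    opposite neg neg = refl

    -- A negative summand occurs only at an end from which the token may cross; then the other end
    -- carries the crossed token and the two summands cancel.
    pair-sign : ∀ x y p r → (∀ s → x ≡ just s → p ≡ opp s → y ≡ just r) →
      (∀ s → y ≡ just s → r ≡ opp s → x ≡ just p) → 0ℤ ℤ.≤ wt x * sgn p + wt y * sgn r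
    pair-sign x y p r f g with wt-cases x p | wt-cases y r
    ... | inj₁ a | inj₁ b = ℤₚ.+-mono-≤ a b
    ... | inj₂ (s , refl , refl) | _ with f s refl refl
    ...   | refl = ℤₚ.≤-reflexive (sym (opposite s r))
    pair-sign x y p r f g | inj₁ _ | inj₂ (s , refl , refl) with g s refl refl
    ...   | refl = ℤₚ.≤-reflexive (sym (trans (ℤₚ.+-comm (sgn p * sgn p) (sgn s * sgn (opp s))) (opposite s p)))

  -- If no vertex carries tokens of both signs, then the reached vertices, weighted
  -- with the signs of their tokens, violate conservation for D.
  single-typed-⊥ : ∀ {A b₀ v₀ s₀} (D : Fin m → ℤ) → ¬ Double A b₀ v₀ s₀ →
    (∀ e → A e → ∃ λ k → D e ≡ - (sgn (step-sign (b₀ e)) * + k)) →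
    (∀ e → ¬ A e → D e ≡ 0ℤ) →
    (∀ v s → v₀ ≢ v → Typed A b₀ v₀ s₀ v s → 0ℤ ℤ.≤ sgn s * ∂ D v) →
    0ℤ ℤ.< sgn s₀ * ∂ D v₀ → ⊥
  single-typed-⊥ {A} {b₀} {v₀} {s₀} D nd sign off nonneg strict = (do
    dp ← ¬¬-∀ n (λ v → em (Typed A b₀ v₀ s₀ v pos))
    dn ← ¬¬-∀ n (λ v → em (Typed A b₀ v₀ s₀ v neg))
    dA ← ¬¬-∀ m (λ e → em (A e))
    return (body dp dn dA)) id
    where
    T = Typed A b₀ v₀ s₀
    body : (∀ v → Dec (T v pos)) → (∀ v → Dec (T v neg)) → (∀ e → Dec (A e)) → ⊥
    body dp dn dA = ℤₚ.<⇒≱ positive nonpositive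
      where
      ty : Fin n → Maybe Sign
      ty v with dp v | dn v
      ... | yes _ | _     = just pos
      ... | no _  | yes _ = just neg
      ... | no _  | no _  = nothing

      ty-compl : ∀ v s → T v s → ty v ≡ just s
      ty-compl v pos k with dp v
      ... | yes _ = refl
      ... | no ¬k = contradiction k ¬k
      ty-compl v neg k with dp v | dn v
      ... | yes p | _ = contradiction (v , p , k) nd
      ... | no _ | yes _ = refl
      ... | no _ | no ¬k = contradiction k ¬k

      ty-sound : ∀ v s → ty v ≡ just s → T v s
      ty-sound v s h with dp v | dn v
      ty-sound v pos refl | yes k | _ = k
      ty-sound v neg refl | no _ | yes k = k

      w = λ v → wt (ty v)

      at-start : 0ℤ ℤ.< w v₀ * ∂ D v₀
      at-start = subst (λ x → 0ℤ ℤ.< wt x * ∂ D v₀) (sym (ty-compl v₀ s₀ (b₀ , start))) strict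

      w-nonneg : ∀ v → 0ℤ ℤ.≤ w v * ∂ D v
      w-nonneg v with v₀ ≟ v
      ... | yes refl = ℤₚ.<⇒≤ at-start
      ... | no v₀≢v = go (ty v) refl
        where
        go : ∀ x → ty v ≡ x → 0ℤ ℤ.≤ wt x * ∂ D v
        go (just s) h = nonneg v s v₀≢v (ty-sound v s h)
        go nothing  h = ℤₚ.≤-reflexive (sym (ℤₚ.*-zeroˡ (∂ D v)))

      positive : 0ℤ ℤ.< sumℤ n (λ v → w v * ∂ D v)
      positive = sum-pos n _ w-nonneg v₀ at-start

      term : ∀ e → coef w e * D e ℤ.≤ 0ℤ
      term e with dA e
      ... | no ¬a = ℤₚ.≤-reflexive (trans (cong (coef w e *_) (off e ¬a)) (ℤₚ.*-zeroʳ (coef w e)))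
      ... | yes a with sign e a
      ...   | k , eq = subst (ℤ._≤ 0ℤ) (sym re) (ℤₚ.neg-mono-≤ bound)
        where
        d = step-sign (b₀ e)
        cl : ∀ β s → ty (head e β) ≡ just s → τ e β ⊗ d ≡ opp s → ty (head e (not β)) ≡ just (τ e (not β) ⊗ d)
        cl β s h h′ = ty-compl _ _ (forward nd e β a (ty-sound _ s h) h′)
        x = ty (head e false)
        y = ty (head e true)
        bound : 0ℤ ℤ.≤ (wt x * sgn (τ e false ⊗ d) + wt y * sgn (τ e true ⊗ d)) * + k
        bound = ℤₚ.*-monoʳ-≤-nonNeg (+ k) (pair-sign x y _ _ (cl false) (cl true))
        arr : ∀ (x a y b d k : ℤ) → (x * a + y * b) * - (d * k) ≡ - ((x * (a * d) + y * (b * d)) * k)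
        arr = solve-∀
        re : coef w e * D e ≡ - ((wt x * sgn (τ e false ⊗ d) + wt y * sgn (τ e true ⊗ d)) * + k)
        re = trans (cong (coef w e *_) eq) (trans (arr (wt x) (t e false) (wt y) (t e true) (sgn d) (+ k))
          (cong₂ (λ a b → - ((wt x * a + wt y * b) * + k)) (sym (sgn-⊗ (τ e false) d)) (sym (sgn-⊗ (τ e true) d))))

      nonpositive : sumℤ n (λ v → w v * ∂ D v) ℤ.≤ 0ℤ
      nonpositive = subst (ℤ._≤ 0ℤ) (sym (double-counting w D)) (sum-nonpos m _ term)

  -- The analogue of a blossom in matching theory: the token can be parked anywhere in `O`, with
  -- either sign, by changes inside `O`. `μ` is the excess with the token removed.
  record Blossom (b₁ : Config) (μ : Fin n → ℤ) : Set where
    field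
      O       : Fin n → Bool
      tip     : Fin n
      tip∈    : O tip ≡ true
      tip-sgn : Sign
      base    : ∀ u → ex b₁ u ≡ bump μ tip (sgn tip-sgn) u
      reroute : ∀ x → O x ≡ true → ∀ s → ∃ λ b → (∀ e → b e ≢ b₁ e → Inside O e) ×
                (∀ u → ex b u ≡ bump μ x (sgn s) u)

  -- Parking the token at `tip` with each sign gives two configurations whose difference lives
  -- inside `O` and has boundary 2 at `tip`.
  blossom-unbalanced : ∀ {b₁ μ} (B : Blossom b₁ μ) → ¬ Bal (Blossom.O B)
  blossom-unbalanced {b₁} {μ} B = unbalanced-by O f tip supp tip∈ (+ 2) (λ ()) eq
    where
    open Blossom B
    p = reroute tip tip∈ pos
    r = reroute tip tip∈ neg
    bp = proj₁ p
    bn = proj₁ r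
    f : Fin m → ℤ
    f e = val bp e + - 1ℤ * val bn e
    supp : ∀ e → f e ≢ 0ℤ → Inside O e
    supp e h with bp e Boolₚ.≟ b₁ e | bn e Boolₚ.≟ b₁ e
    ... | no d | _ = proj₁ (proj₂ p) e d
    ... | yes _ | no d = proj₁ (proj₂ r) e d
    ... | yes x | yes y = contradiction
      (trans (cong₂ (λ a c → (q e + + bit a) + - 1ℤ * (q e + + bit c)) x y) (self-cancel (val b₁ e))) h
    eq : ∀ v → ∂ f v ≡ + 2 * δ tip v
    eq v = trans (∂-difference (val bp) (val bn) v (proj₂ (proj₂ p) v) (proj₂ (proj₂ r) v)) (calc (μ v) (δ tip v))
      where
      calc : ∀ (μ d : ℤ) → (μ + 1ℤ * d) + - 1ℤ * (μ + - 1ℤ * d) ≡ + 2 * d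
      calc = solve-∀

  record Opposite (μ : Fin n → ℤ) : Set where
    field
      b₁ b₂ : Config
      v     : Fin n
      s     : Sign
      ex₁   : ∀ u → ex b₁ u ≡ bump μ v (sgn s) u
      ex₂   : ∀ u → ex b₂ u ≡ bump μ v (- sgn s) u

  tok-shift : ∀ {A b₀ v₀ s₀ b v s} {μ : Fin n → ℤ} → (∀ u → ex b₀ u ≡ bump μ v₀ (sgn s₀) u) →
    Tok A b₀ v₀ s₀ b v s → ∀ u → ex b u ≡ bump μ v (sgn s) u
  tok-shift {v₀ = v₀} {s₀} {b} {v} {s} {μ} h k u = trans (tok-ex k u)
    (trans (cong (λ z → z - sgn s₀ * δ v₀ u + sgn s * δ v u) (h u)) (calc (μ u) (sgn s₀ * δ v₀ u) (sgn s * δ v u)))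
    where
    calc : ∀ (a b c : ℤ) → a + b - b + c ≡ a + c
    calc = solve-∀

  touched : ∀ {A b₀ v₀ s₀ b v s} {P : Fin n → Set} → (∀ u → (∃ λ s′ → Typed A b₀ v₀ s₀ u s′) → P u) →
    Tok A b₀ v₀ s₀ b v s → ∀ e → b e ≢ b₀ e → ∀ β → P (head e β)
  touched {P = P} h k e d β with history k e d
  ... | β′ , x , y with β′ Boolₚ.≟ β
  ...   | yes refl = h _ (_ , x)
  ...   | no β≢ = subst (λ c → P (head e c)) (trans (cong not (Boolₚ.¬-not β≢)) (Boolₚ.not-involutive β))
      (h _ (_ , y))

  -- Descent on the number of edges in which the two configurations differ.
  blossom : ∀ {μ} → Opposite μ → ¬ ¬ (∃ λ b₁ → Blossom b₁ μ)
  blossom {μ} = descent size step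
    where
    size : Opposite μ → ℕ
    size P = count (λ e → Opposite.b₁ P e xor Opposite.b₂ P e)
    step : ∀ P → ((P′ : Opposite μ) → size P′ ℕ.< size P → ¬ ¬ (∃ λ b₁ → Blossom b₁ μ)) → ¬ ¬
        (∃ λ b₁ → Blossom b₁ μ)
    step P smaller = do
      yes dbl ← em (Double A b₁ v s)
        where no nd → ⊥-elim (single-typed-⊥ D nd D-sign D-off D-nonneg D-strict)
      found dbl
      where
      open Opposite P
      -- Tokens are confined to the edges where the two configurations differ. There `D` has the
      -- sign required by `single-typed-⊥`, and its boundary is twice the token.
      A : Fin m → Set
      A e = b₁ e ≢ b₂ e
      D : Fin m → ℤ
      D e = val b₁ e + - 1ℤ * val b₂ e
      gap : ∀ q c c′ → c ≢ c′ → q + + bit c + - 1ℤ * (q + + bit c′) ≡ - (sgn (step-sign c) * 1ℤ)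
      gap q false false h = contradiction refl h
      gap q true  true  h = contradiction refl h
      gap q false true  h = calc q
        where
        calc : ∀ (q : ℤ) → q + 0ℤ + - 1ℤ * (q + 1ℤ) ≡ - 1ℤ
        calc = solve-∀
      gap q true false h = calc q
        where
        calc : ∀ (q : ℤ) → q + 1ℤ + - 1ℤ * (q + 0ℤ) ≡ 1ℤ
        calc = solve-∀
      D-sign : ∀ e → A e → ∃ λ k → D e ≡ - (sgn (step-sign (b₁ e)) * + k)
      D-sign e a = 1 , gap (q e) (b₁ e) (b₂ e) a
      D-off : ∀ e → ¬ A e → D e ≡ 0ℤ
      D-off e ¬a with b₁ e Boolₚ.≟ b₂ e
      ... | no a = contradiction a ¬a
      ... | yes eq = trans (cong (λ c → val b₁ e + - 1ℤ * (q e + + bit c)) (sym eq)) (self-cancel (val b₁ e))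
      ∂D : ∀ u → ∂ D u ≡ + 2 * (sgn s * δ v u)
      ∂D u = trans (∂-difference (val b₁) (val b₂) u (ex₁ u) (ex₂ u)) (calc (μ u) (sgn s) (δ v u))
        where
        calc : ∀ (μ s d : ℤ) → (μ + s * d) + - 1ℤ * (μ + - s * d) ≡ + 2 * (s * d)
        calc = solve-∀
      two : ∀ s → sgn s * (+ 2 * (sgn s * 1ℤ)) ≡ + 2
      two pos = refl
      two neg = refl
      D-strict : 0ℤ ℤ.< sgn s * ∂ D v
      D-strict = subst (0ℤ ℤ.<_) (sym (trans (cong (sgn s *_)
          (trans (∂D v) (cong (λ z → + 2 * (sgn s * z)) (δ-refl v)))) (two s))) (ℤ.+<+ (s≤s z≤n))
      D-nonneg : ∀ u s′ → v ≢ u → Typed A b₁ v s u s′ → 0ℤ ℤ.≤ sgn s′ * ∂ D u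
      D-nonneg u s′ v≢u k = ℤₚ.≤-reflexive (sym (trans (cong (sgn s′ *_) (trans (∂D u)
        (trans (cong (λ z → + 2 * (sgn s * z)) (δ-≢ v≢u)) (cong (+ 2 *_) (ℤₚ.*-zeroʳ (sgn s))))))
            (ℤₚ.*-zeroʳ (sgn s′))))
      found : Double A b₁ v s → ¬ ¬ (∃ λ b₁ → Blossom b₁ μ)
      found (v′ , (bp , kp) , (bn , kn)) = do
        -- Agreement on an edge of `A` gives a pair with a smaller difference set. Without it, each
        -- edge of `A` was changed by one of the two tokens, so `A` lies inside the visited set.
        no full ← em (∃ λ e → A e × bp e ≡ bn e)
          where yes (e , a , same) → smaller next (count-< _ _ sub e (same-xor same) (diff-xor a))
        O ← setOf (λ u → ∃ λ s′ → Typed A b₁ v s u s′)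
        return (b₁ , record
          { O = SetOf.mem O
          ; tip = v
          ; tip∈ = SetOf.compl O v (s , b₁ , start)
          ; tip-sgn = s
          ; base = ex₁
          ; reroute = λ x x∈ s₁ → reroute x (SetOf.sound O x x∈) s₁ (λ e a → inside (SetOf.compl O) full e a) })
        where
        next : Opposite μ
        next = record { b₁ = bp ; b₂ = bn ; v = v′ ; s = pos
                      ; ex₁ = tok-shift {μ = μ} ex₁ kp ; ex₂ = tok-shift {μ = μ} ex₁ kn }
        same-xor : ∀ {x y : Bool} → x ≡ y → x xor y ≡ false
        same-xor {false} refl = refl
        same-xor {true}  refl = refl
        diff-xor : ∀ {x y : Bool} → x ≢ y → x xor y ≡ true
        diff-xor {false} {false} h = contradiction refl h
        diff-xor {false} {true}  h = refl
        diff-xor {true}  {false} h = refl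
        diff-xor {true}  {true}  h = contradiction refl h
        xor-diff : ∀ {x y : Bool} → x xor y ≡ true → x ≢ y
        xor-diff {false} () refl
        xor-diff {true}  () refl
        sub : ∀ e → bp e xor bn e ≡ true → b₁ e xor b₂ e ≡ true
        sub e h with bp e Boolₚ.≟ b₁ e | bn e Boolₚ.≟ b₁ e
        ... | no d | _ = diff-xor (tok-A kp e d)
        ... | yes _ | no d = diff-xor (tok-A kn e d)
        ... | yes x | yes y = contradiction (trans x (sym y)) (xor-diff h)
        inside : {P : Fin n → Set} → (∀ u → (∃ λ s′ → Typed A b₁ v s u s′) → P u) →
          ¬ (∃ λ e → A e × bp e ≡ bn e) → ∀ e → A e → ∀ β → P (head e β)
        inside h full e a β with bp e Boolₚ.≟ b₁ e
        ... | no d = touched h kp e d β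
        ... | yes x with bn e Boolₚ.≟ b₁ e
        ...   | no d = touched h kn e d β
        ...   | yes y = contradiction (e , a , trans x (sym y)) full
        reroute : ∀ x → (∃ λ s′ → Typed A b₁ v s x s′) → ∀ s₁ → {P : Fin m → Set} → (∀ e → A e → P e) →
          ∃ λ b → (∀ e → b e ≢ b₁ e → P e) × (∀ u → ex b u ≡ bump μ x (sgn s₁) u)
        reroute x (s′ , b , k) s₁ {P} ins = pick s′ s₁ refl refl
          where
          exb : ∀ u → ex b u ≡ bump μ x (sgn s′) u
          exb = tok-shift {μ = μ} ex₁ k
          -- Flipping `b` on all of `A` yields the values of `b₁` plus those of `b₂` minus those of
          -- `b`, which puts the opposite sign at `x`.
          c : Config
          c e = if b₁ e xor b₂ e then not (b e) else b e
          c-diff : ∀ e → c e ≢ b₁ e → A e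
          c-diff e h with b₁ e Boolₚ.≟ b₂ e
          ... | no d = d
          ... | yes eq with b e Boolₚ.≟ b₁ e
          ...   | no d = tok-A k e d
          ...   | yes y = contradiction (trans (cong (λ z → if z then not (b e) else b e) (same-xor eq)) y) h
          val-c : ∀ e → val c e ≡ (val b₁ e + val b₂ e) + - 1ℤ * val b e
          val-c e = go (q e) (b₁ e) (b₂ e) (b e) (λ eq → not-diff (λ d → tok-A k e d eq))
            where
            not-diff : ∀ {x y : Bool} → ¬ (x ≢ y) → x ≡ y
            not-diff {x} {y} h = decidable-stable (x Boolₚ.≟ y) h
            l₀ : ∀ (q x : ℤ) → q + x ≡ ((q + x) + (q + x)) + - 1ℤ * (q + x)
            l₀ = solve-∀
            l₁ : ∀ (q x y : ℤ) → q + y ≡ ((q + x) + (q + y)) + - 1ℤ * (q + x)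
            l₁ = solve-∀
            l₂ : ∀ (q x y : ℤ) → q + y ≡ ((q + y) + (q + x)) + - 1ℤ * (q + x)
            l₂ = solve-∀
            go : ∀ q x y z → (x ≡ y → z ≡ x) →
              q + + bit (if x xor y then not z else z) ≡ ((q + + bit x) + (q + + bit y)) + - 1ℤ * (q + + bit z)
            go q false false z h with h refl
            ... | refl = l₀ q 0ℤ
            go q true true z h with h refl
            ... | refl = l₀ q 1ℤ
            go q false true false h = l₁ q 0ℤ 1ℤ
            go q false true true  h = l₂ q 1ℤ 0ℤ
            go q true false false h = l₂ q 0ℤ 1ℤ
            go q true false true  h = l₁ q 1ℤ 0ℤ
          exc : ∀ u → ex c u ≡ bump μ x (- sgn s′) u
          exc u = trans (∂-cong val-c u) (trans (∂-difference (λ e → val b₁ e + val b₂ e) (val b) u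
            (trans (∂-+ (val b₁) (val b₂) u) (cong₂ _+_ (ex₁ u) (ex₂ u))) (exb u))
                (calc (μ u) (sgn s) (δ v u) (sgn s′) (δ x u)))
            where
            calc : ∀ (μ s d s′ d′ : ℤ) → ((μ + s * d) + (μ + - s * d)) + - 1ℤ * (μ + s′ * d′) ≡ μ + - s′ * d′
            calc = solve-∀
          pick : ∀ a a′ → s′ ≡ a → s₁ ≡ a′ → ∃ λ b → (∀ e → b e ≢ b₁ e → P e) × (∀ u → ex b u ≡ bump μ x (sgn s₁) u)
          pick pos pos refl refl = b , (λ e h → ins e (tok-A k e h)) , exb
          pick neg neg refl refl = b , (λ e h → ins e (tok-A k e h)) , exb
          pick pos neg refl refl = c , (λ e h → ins e (c-diff e h)) , exc
          pick neg pos refl refl = c , (λ e h → ins e (c-diff e h)) , exc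

  Φ : Config → ℕ
  Φ b = norm (ex b)

  -- The configurations round the fractional flow F / 6 with F = r + 6 q.
  module Fractional (r : Fin m → ℕ) (r≥1 : ∀ e → 1 ℕ.≤ r e) (r≤5 : ∀ e → r e ℕ.≤ 5)
    (flow : Flow (λ e → + r e + + 6 * q e)) where

    All : Fin m → Set
    All _ = ⊤

    -- Six times the rounding error, kept integral. Its boundary is six times the excess since `F`
    -- is a flow, and on each edge its sign is opposite to the change made by a flip.
    deviation : Config → Fin m → ℤ
    deviation b e = + 6 * val b e + - 1ℤ * (+ r e + + 6 * q e)

    ∂-deviation : ∀ b v → ∂ (deviation b) v ≡ + 6 * ex b v
    ∂-deviation b v = trans (∂-difference (λ e → + 6 * val b e) (λ e → + r e + + 6 * q e) v
        (∂-* (+ 6) (val b) v) (flow v))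
      (ℤₚ.+-identityʳ (+ 6 * ex b v))

    deviation-sign : ∀ b e → ∃ λ k → deviation b e ≡ - (sgn (step-sign (b e)) * + k)
    deviation-sign b e = go (b e) (r e) (r≤5 e)
      where
      off : ∀ (q r : ℤ) → + 6 * (q + 0ℤ) + - 1ℤ * (r + + 6 * q) ≡ - (1ℤ * r)
      off = solve-∀
      on : ∀ (q r k : ℤ) → + 6 ≡ r + k → + 6 * (q + 1ℤ) + - 1ℤ * (r + + 6 * q) ≡ - (- 1ℤ * k)
      on q r k h = trans (alg q r) (trans (cong (_- r) h) (alg′ r k))
        where
        alg : ∀ (q r : ℤ) → + 6 * (q + 1ℤ) + - 1ℤ * (r + + 6 * q) ≡ + 6 - r
        alg = solve-∀
        alg′ : ∀ (r k : ℤ) → r + k - r ≡ - (- 1ℤ * k)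
        alg′ = solve-∀
      go : ∀ c k → k ℕ.≤ 5 → ∃ λ j → + 6 * (q e + + bit c) + - 1ℤ * (+ k + + 6 * q e) ≡ - (sgn (step-sign c) * + j)
      go false k _ = k , off (q e) (+ k)
      go true k le = (6 ℕ.∸ k) , on (q e) (+ k) (+ (6 ℕ.∸ k))
          (cong +_ (sym (ℕₚ.m+[n∸m]≡n (ℕₚ.≤-trans le (ℕₚ.n≤1+n 5)))))

    private
      neg-or-nonneg : ∀ x → x ℤ.< 0ℤ ⊎ 0ℤ ℤ.≤ x
      neg-or-nonneg (+ k)    = inj₂ (ℤ.+≤+ z≤n)
      neg-or-nonneg -[1+ k ] = inj₁ ℤ.-<+

      opp-< : ∀ s x → 0ℤ ℤ.< sgn s * x → sgn (opp s) * x ℤ.< 0ℤ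
      opp-< s x p = subst (ℤ._< 0ℤ) (sym (trans (cong (_* x) (sgn-opp s))
          (sym (ℤₚ.neg-distribˡ-* (sgn s) x)))) (ℤₚ.neg-mono-< p)

      restore : ∀ (h : Fin n → ℤ) v s u → h u ≡ bump (bump h v (sgn (opp s))) v (sgn s) u
      restore h v s u = trans (calc (h u) (sgn s) (δ v u)) (cong (λ a → (h u + a * δ v u) + sgn s * δ v u)
          (sym (sgn-opp s)))
        where
        calc : ∀ (h s d : ℤ) → h ≡ (h + - s * d) + s * d
        calc = solve-∀

      commute : ∀ (s x : ℤ) → + 6 * (s * x) ≡ s * (+ 6 * x)
      commute = solve-∀

      scale : ∀ s x → 0ℤ ℤ.≤ sgn s * x → 0ℤ ℤ.≤ sgn s * (+ 6 * x)
      scale s x p = subst (0ℤ ℤ.≤_) (commute (sgn s) x) (ℤₚ.*-monoˡ-≤-nonNeg (+ 6) p)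

      scale< : ∀ s x → 0ℤ ℤ.< sgn s * x → 0ℤ ℤ.< sgn s * (+ 6 * x)
      scale< s x p = subst (0ℤ ℤ.<_) (commute (sgn s) x) (ℤₚ.*-monoˡ-<-pos (+ 6) p)

      sign-of : ∀ x → x ≢ 0ℤ → ∃ λ s → 0ℤ ℤ.< sgn s * x
      sign-of (+ zero) h = contradiction refl h
      sign-of (+ suc k) h = pos , subst (0ℤ ℤ.<_) (sym (ℤₚ.*-identityˡ (+ suc k))) (ℤ.+<+ (s≤s z≤n))
      sign-of -[1+ k ] h = neg , ℤ.+<+ (s≤s z≤n)

    -- By minimality the token never meets excess of the opposite sign, since both would cancel. So
    -- if no vertex saw both signs, the deviation would satisfy the hypotheses of `single-typed-⊥`.
    minimal-double : ∀ b₁ → (∀ b → Φ b₁ ℕ.≤ Φ b) → ∀ v s → 0ℤ ℤ.< sgn s * ex b₁ v →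
      ¬ ¬ Double All b₁ v s
    minimal-double b₁ min v s p = do
      no nd ← em (Double All b₁ v s)
        where yes d → return d
      ⊥-elim (single-typed-⊥ (deviation b₁) nd (λ e _ → deviation-sign b₁ e) (λ e h → contradiction tt h)
        (λ u s′ v≢u k → subst (λ z → 0ℤ ℤ.≤ sgn s′ * z) (sym (∂-deviation b₁ u))
            (scale s′ (ex b₁ u) (nonneg u s′ v≢u k)))
        (subst (λ z → 0ℤ ℤ.< sgn s * z) (sym (∂-deviation b₁ v)) (scale< s (ex b₁ v) p)))
      where
      μ = bump (ex b₁) v (sgn (opp s))
      nonneg : ∀ u s′ → v ≢ u → Typed All b₁ v s u s′ → 0ℤ ℤ.≤ sgn s′ * ex b₁ u
      nonneg u s′ v≢u (b , k) with neg-or-nonneg (sgn s′ * μ u)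
      ... | inj₂ ge = subst (λ z → 0ℤ ℤ.≤ sgn s′ * z) (bump-off (ex b₁) (sgn (opp s)) v≢u) ge
      ... | inj₁ lt = ⊥-elim (ℕₚ.<-irrefl refl (ℕₚ.≤-trans too-small (min b)))
        where
        too-small : suc (Φ b) ℕ.≤ Φ b₁
        too-small = ℕₚ.≤-trans (ℕₚ.≤-reflexive (trans (cong suc
            (norm-cong (tok-shift {μ = μ} (restore (ex b₁) v s) k))) (norm-down μ u s′ lt)))
          (ℕₚ.≤-trans (ℕₚ.n≤1+n _) (ℕₚ.≤-reflexive (norm-down (ex b₁) v (opp s) (opp-< s (ex b₁ v) p))))

    -- With all weights 1 an edge has coefficient 0, 2 or -2; this parity is what remains of the
    -- vanishing total in an ordinary graph.
    excess-even : ∀ b → + 2 ∣ sumℤ n (ex b)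
    excess-even b = subst (+ 2 ∣_) (trans (sym (double-counting (λ _ → 1ℤ) (val b)))
        (sum-cong n (λ v → ℤₚ.*-identityˡ (ex b v))))
      (div m _ (λ e → ∣m⇒∣m*n (val b e) (even-coef (τ e false) (τ e true))))
      where
      even-coef : ∀ a c → + 2 ∣ 1ℤ * sgn a + 1ℤ * sgn c
      even-coef pos pos = divides (+ 1) refl
      even-coef pos neg = divides (+ 0) refl
      even-coef neg pos = divides (+ 0) refl
      even-coef neg neg = divides (- 1ℤ) refl
      div : ∀ n (f : Fin n → ℤ) → (∀ i → + 2 ∣ f i) → + 2 ∣ sumℤ n f
      div zero    f h = divides (+ 0) refl
      div (suc n) f h = ∣m∣n⇒∣m+n (h zero) (div n (f ∘ suc) (h ∘ suc))

    round : (∀ O → ¬ (¬ Bal O × ¬ Bal (not ∘ O))) → ¬ ¬ (∃ λ b → ∀ v → ex b v ≡ 0ℤ)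
    round no-disjoint = descent Φ step (λ _ → false)
      where
      Goal = ∃ λ b → ∀ v → ex b v ≡ 0ℤ
      step : ∀ b → ((b′ : Config) → Φ b′ ℕ.< Φ b → ¬ ¬ Goal) → ¬ ¬ Goal
      step b smaller = do
        no none ← em (∃ λ b′ → Φ b′ ℕ.< Φ b)
          where yes (b′ , lt) → smaller b′ lt
        yes (v₀ , v₀≢0) ← em (∃ λ v → ex b v ≢ 0ℤ)
          where no flat → return (b , λ v → decidable-stable (ex b v ℤₚ.≟ 0ℤ) (λ h → flat (v , h)))
        let (s₀ , s₀>0) = sign-of (ex b v₀) v₀≢0
        ⊥-elim ((contra (λ b′ → ℕₚ.≮⇒≥ (λ lt → none (b′ , lt))) v₀ s₀ s₀>0) id)
        where
        contra : (∀ b′ → Φ b ℕ.≤ Φ b′) → ∀ v₀ s₀ → 0ℤ ℤ.< sgn s₀ * ex b v₀ → ¬ ¬ ⊥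
        contra min v₀ s₀ s₀>0 = do
          (v , (bp , kp) , (bn , kn)) ← minimal-double b min v₀ s₀ s₀>0
          (b₁ , B) ← blossom {μ} record
            { b₁ = bp ; b₂ = bn ; v = v ; s = pos
            ; ex₁ = tok-shift {μ = μ} (restore (ex b) v₀ s₀) kp
            ; ex₂ = tok-shift {μ = μ} (restore (ex b) v₀ s₀) kn }
          second b₁ B
          where
          μ = bump (ex b) v₀ (sgn (opp s₀))
          Φ-b : suc (norm μ) ≡ Φ b
          Φ-b = norm-down (ex b) v₀ (opp s₀) (opp-< s₀ (ex b v₀) s₀>0)
          second : ∀ b₁ → Blossom b₁ μ → ¬ ¬ ⊥
          second b₁ B = do
            -- If `μ` vanished, the total excess of `b₁` would be the single token, an odd number.
            yes (w , w≢0) ← em (∃ λ w → μ w ≢ 0ℤ)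
              where no none → λ _ → odd (λ w → decidable-stable (μ w ℤₚ.≟ 0ℤ) (λ h → none (w , h)))
            let (s , s>0) = sign-of (μ w) w≢0
                w∉O = w∉ w w≢0
                s>0′ = subst (λ z → 0ℤ ℤ.< sgn s * z) (sym (ex-w w w≢0)) s>0
            -- The second token is first kept off the edges inside `O`, so that its changes are
            -- independent of a rerouting of the first one.
            no miss ← em (∃ λ x → O x ≡ true × ∃ λ s′ → ∃ λ b′ → Tok Out b₁ w s b′ x s′)
              where yes (x , x∈ , s′ , b′ , k) → λ _ → meet w s s>0 x x∈ s′ b′ k
            (v , (bp , kp) , (bn , kn)) ← minimal-double b₁ min₁ w s s>0′
            λ _ → no-disjoint O (blossom-unbalanced B , second-odd w s w∉O miss v bp kp bn kn)
            where
            open Blossom B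
            Out : Fin m → Set
            Out e = ¬ Inside O e
            -- Excess of `μ` inside `O` could be cancelled by parking the token on it, against
            -- minimality.
            μ≥0 : ∀ x → O x ≡ true → ∀ s → 0ℤ ℤ.≤ sgn s * μ x
            μ≥0 x x∈ s with neg-or-nonneg (sgn s * μ x)
            ... | inj₂ ge = ge
            ... | inj₁ lt with reroute x x∈ s
            ...   | b′ , _ , eq = ⊥-elim (ℕₚ.<-irrefl refl (ℕₚ.≤-trans
              (ℕₚ.≤-trans (ℕₚ.≤-reflexive (trans (cong suc (norm-cong eq)) (norm-down μ x s lt)))
                (ℕₚ.≤-trans (ℕₚ.n≤1+n _) (ℕₚ.≤-reflexive Φ-b))) (min b′)))
            μ≡0 : ∀ x → O x ≡ true → μ x ≡ 0ℤ
            μ≡0 x x∈ = ℤₚ.≤-antisym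
              (subst (ℤ._≤ 0ℤ) (negneg (μ x)) (ℤₚ.neg-mono-≤ (μ≥0 x x∈ neg)))
              (subst (0ℤ ℤ.≤_) (ℤₚ.*-identityˡ (μ x)) (μ≥0 x x∈ pos))
              where
              negneg : ∀ (x : ℤ) → - (- 1ℤ * x) ≡ x
              negneg = solve-∀
            w∉ : ∀ w → μ w ≢ 0ℤ → O w ≡ false
            w∉ w h = ¬true (λ w∈ → h (μ≡0 w w∈))
            tip≢ : ∀ w → μ w ≢ 0ℤ → tip ≢ w
            tip≢ w h refl = h (μ≡0 tip tip∈)
            ex-w : ∀ w → μ w ≢ 0ℤ → ex b₁ w ≡ μ w
            ex-w w h = trans (base w) (bump-off μ (sgn tip-sgn) (tip≢ w h))
            Φ-b₁ : Φ b₁ ≡ suc (norm μ)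
            Φ-b₁ = trans (norm-cong base) (norm-up μ tip tip-sgn (μ≥0 tip tip∈ tip-sgn))
            min₁ : ∀ b′ → Φ b₁ ℕ.≤ Φ b′
            min₁ b′ = subst (ℕ._≤ Φ b′) (trans (sym Φ-b) (sym Φ-b₁)) (min b′)
            odd : (∀ w → μ w ≡ 0ℤ) → ⊥
            odd h = not-even tip-sgn (subst (+ 2 ∣_) total (excess-even b₁))
              where
              total : sumℤ n (ex b₁) ≡ sgn tip-sgn
              total = trans (sum-cong n (λ u → trans (base u) (trans (cong (_+ sgn tip-sgn * δ tip u) (h u))
                              (trans (ℤₚ.+-identityˡ _) (ℤₚ.*-comm (sgn tip-sgn) (δ tip u))))))
                            (sum-δ n tip (λ _ → sgn tip-sgn))
              not-even : ∀ s → ¬ (+ 2 ∣ sgn s)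
              not-even pos = from-no (+ 2 ∣? 1ℤ)
              not-even neg = from-no (+ 2 ∣? - 1ℤ)
            meet : ∀ w s → 0ℤ ℤ.< sgn s * μ w → ∀ x → O x ≡ true → ∀ s′ b′ → Tok Out b₁ w s b′ x s′ → ⊥
            meet w s s>0 x x∈ s′ b′ k with reroute x x∈ (opp s′)
            ... | c , c-in , c-ex = ℕₚ.<-irrefl refl (ℕₚ.≤-trans too-small (min₁ g))
              where
              -- The changes of `c` lie inside `O` and those of `b′` do not, so both can be made at
              -- once; the tokens meet at `x` with opposite signs and vanish.
              g : Config
              g e = if c e xor b₁ e then c e else b′ e
              val-g : ∀ e → val g e ≡ (val b′ e + val c e) + - 1ℤ * val b₁ e
              val-g e = go (q e) (c e) (b₁ e) (b′ e) (λ c≢ → not-diff (λ d → tok-A k e d (c-in e c≢)))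
                where
                not-diff : ∀ {x y : Bool} → ¬ (x ≢ y) → x ≡ y
                not-diff {x} {y} h = decidable-stable (x Boolₚ.≟ y) h
                l₁ : ∀ (q x y : ℤ) → q + y ≡ ((q + y) + (q + x)) + - 1ℤ * (q + x)
                l₁ = solve-∀
                l₂ : ∀ (q x y : ℤ) → q + x ≡ ((q + y) + (q + x)) + - 1ℤ * (q + y)
                l₂ = solve-∀
                go : ∀ q x y z → (x ≢ y → z ≡ y) →
                  q + + bit (if x xor y then x else z) ≡ ((q + + bit z) + (q + + bit x)) + - 1ℤ * (q + + bit y)
                go q false false z h = l₁ q 0ℤ (+ bit z)
                go q true true z h = l₁ q 1ℤ (+ bit z)
                go q false true z h with h (λ ())
                ... | refl = l₂ q 0ℤ 1ℤ
                go q true false z h with h (λ ())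
                ... | refl = l₂ q 1ℤ 0ℤ
              ex-g : ∀ u → ex g u ≡ bump μ w (sgn (opp s)) u
              ex-g u = trans (∂-cong val-g u) (trans (∂-difference (λ e → val b′ e + val c e) (val b₁) u
                (trans (∂-+ (val b′) (val c) u) (cong₂ _+_ (tok-ex k u) (c-ex u))) refl)
                (trans (cong₂ (λ a d → ((ex b₁ u - sgn s * δ w u + sgn s′ * δ x u) +
                    (μ u + a * δ x u)) + - 1ℤ * d) (sgn-opp s′) refl)
                (trans (calc (ex b₁ u) (sgn s) (δ w u) (sgn s′) (δ x u) (μ u))
                  (cong (λ a → μ u + a * δ w u) (sym (sgn-opp s))))))
                where
                calc : ∀ (E s d s′ d′ μ : ℤ) → ((E - s * d + s′ * d′) + (μ + - s′ * d′)) + - 1ℤ * E ≡ μ + - s * d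
                calc = solve-∀
              too-small : suc (Φ g) ℕ.≤ Φ b₁
              too-small = ℕₚ.≤-trans (ℕₚ.≤-reflexive (trans (cong suc (norm-cong ex-g))
                  (norm-down μ w (opp s) (opp-< s (μ w) s>0))))
                (ℕₚ.≤-trans (ℕₚ.n≤1+n _) (ℕₚ.≤-reflexive (sym Φ-b₁)))
            -- Using an edge inside `O` would require standing in `O` before, so the restriction to
            -- `Out` costs nothing.
            avoid : ∀ {w s b v s′} → O w ≡ false → ¬ (∃ λ x → O x ≡ true × ∃ λ s′ → ∃ λ b′ →
                Tok Out b₁ w s b′ x s′) →
              Tok All b₁ w s b v s′ → Tok Out b₁ w s b v s′
            avoid w∉O miss start = start
            avoid w∉O miss (move k e β a p h) =
              move (avoid w∉O miss k) e β (λ ins → miss (_ , subst (λ z → O z ≡ true) p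
                  (ins β) , _ , _ , avoid w∉O miss k)) p h
            second-odd : ∀ w s → O w ≡ false → ¬ (∃ λ x → O x ≡ true × ∃ λ s′ → ∃ λ b′ → Tok Out b₁ w s b′ x s′) →
              ∀ v bp → Tok All b₁ w s bp v pos → ∀ bn → Tok All b₁ w s bn v neg → ¬ Bal (not ∘ O)
            second-odd w s w∉O miss v bp kp bn kn = unbalanced-by (not ∘ O) f v supp (out v (_ , _ , kp))
                (+ 2) (λ ()) eq
              where
              out : ∀ u → (∃ λ s′ → Typed All b₁ w s u s′) → not (O u) ≡ true
              out u (s′ , b′ , k) = not-true (¬true (λ u∈ → miss (u , u∈ , s′ , b′ , avoid w∉O miss k)))
              f : Fin m → ℤ
              f e = val bp e + - 1ℤ * val bn e
              supp : ∀ e → f e ≢ 0ℤ → Inside (not ∘ O) e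
              supp e h with bp e Boolₚ.≟ b₁ e | bn e Boolₚ.≟ b₁ e
              ... | no d | _ = touched out kp e d
              ... | yes _ | no d = touched out kn e d
              ... | yes x | yes y = contradiction
                (trans (cong₂ (λ a c → (q e + + bit a) + - 1ℤ * (q e + + bit c)) x y) (self-cancel (val b₁ e))) h
              eq : ∀ u → ∂ f u ≡ + 2 * δ v u
              eq u = trans (∂-difference (val bp) (val bn) u (tok-ex kp u) (tok-ex kn u))
                  (calc (ex b₁ u - sgn s * δ w u) (δ v u))
                where
                calc : ∀ (μ d : ℤ) → (μ + 1ℤ * d) + - 1ℤ * (μ + - 1ℤ * d) ≡ + 2 * d
                calc = solve-∀

-- Switching and the edges left negative by it

module Switching {n m : ℕ} (S : SG n m) where
  open Core S

  equal : Sign → Sign → Bool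
  equal pos pos = true
  equal pos neg = false
  equal neg pos = false
  equal neg neg = true

  equal-opp : ∀ a b → equal (opp a) b ≡ not (equal a b)
  equal-opp pos pos = refl
  equal-opp pos neg = refl
  equal-opp neg pos = refl
  equal-opp neg neg = refl

  equal-comm : ∀ a b → equal a b ≡ equal b a
  equal-comm pos pos = refl
  equal-comm pos neg = refl
  equal-comm neg pos = refl
  equal-comm neg neg = refl

  equal-opp₂ : ∀ a b → equal (opp a) (opp b) ≡ equal a b
  equal-opp₂ pos pos = refl
  equal-opp₂ pos neg = refl
  equal-opp₂ neg pos = refl
  equal-opp₂ neg neg = refl

  opp-⊗ : ∀ a b → opp a ⊗ b ≡ opp (a ⊗ b)
  opp-⊗ pos pos = refl
  opp-⊗ pos neg = refl
  opp-⊗ neg pos = refl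
  opp-⊗ neg neg = refl

  different-zero : ∀ u a v b → equal (u ⊗ a) (v ⊗ b) ≡ false → sgn u * sgn a + sgn v * sgn b ≡ 0ℤ
  different-zero u a v b h = trans (cong₂ _+_ (sym (sgn-⊗ u a)) (sym (sgn-⊗ v b))) (go (u ⊗ a) (v ⊗ b) h)
    where
    go : ∀ x y → equal x y ≡ false → sgn x + sgn y ≡ 0ℤ
    go pos neg _ = refl
    go neg pos _ = refl

  equal-nonzero : ∀ u a v b → equal (u ⊗ a) (v ⊗ b) ≡ true → sgn u * sgn a + sgn v * sgn b ≢ 0ℤ
  equal-nonzero u a v b h z = go (u ⊗ a) (v ⊗ b) h (trans (cong₂ _+_ (sgn-⊗ u a) (sgn-⊗ v b)) z)
    where
    go : ∀ x y → equal x y ≡ true → sgn x + sgn y ≢ 0ℤ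
    go pos pos _ ()
    go neg neg _ ()

  equal-sign : ∀ u a v b → equal (u ⊗ a) (v ⊗ b) ≡ true → opp (a ⊗ b) ≡ opp (u ⊗ v)
  equal-sign pos pos pos pos _ = refl
  equal-sign pos pos neg neg _ = refl
  equal-sign pos neg pos neg _ = refl
  equal-sign pos neg neg pos _ = refl
  equal-sign neg pos pos neg _ = refl
  equal-sign neg pos neg pos _ = refl
  equal-sign neg neg pos pos _ = refl
  equal-sign neg neg neg neg _ = refl

  -- The edges that are negative after switching by `s`, written through half-edges so that `switch`
  -- acts on each end separately.
  bad : (Fin n → Sign) → Fin m → Bool
  bad s e = equal (s (head e false) ⊗ τ e false) (s (head e true) ⊗ τ e true)

  not-bad : ∀ s e → bad s e ≡ false → coef (sgn ∘ s) e ≡ 0ℤ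
  not-bad s e = different-zero (s (head e false)) (τ e false) (s (head e true)) (τ e true)

  is-bad : ∀ s e → bad s e ≡ true → coef (sgn ∘ s) e ≢ 0ℤ
  is-bad s e = equal-nonzero (s (head e false)) (τ e false) (s (head e true)) (τ e true)

  switch : (Fin n → Bool) → (Fin n → Sign) → Fin n → Sign
  switch Y s v = if Y v then opp (s v) else s v

  bad-switch : ∀ Y s e → bad (switch Y s) e ≡ (if Y (head e false) xor Y (head e true) then not
      (bad s e) else bad s e)
  bad-switch Y s e with Y (head e false) | Y (head e true)
  ... | false | false = refl
  ... | true  | false = trans (cong (λ z → equal z (s (head e true) ⊗ τ e true))
      (opp-⊗ (s (head e false)) (τ e false))) (equal-opp (s (head e false) ⊗ τ e false) _)
  ... | false | true = trans (cong (equal (s (head e false) ⊗ τ e false)) (opp-⊗ (s (head e true)) (τ e true)))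
      (trans (equal-comm (s (head e false) ⊗ τ e false) _) (trans (equal-opp (s (head e true) ⊗ τ e true) _)
          (cong not (equal-comm (s (head e true) ⊗ τ e true) _))))
  ... | true | true = trans (cong₂ equal (opp-⊗ (s (head e false)) (τ e false))
      (opp-⊗ (s (head e true)) (τ e true))) (equal-opp₂ (s (head e false) ⊗ τ e false) _)

  crossing-xor : ∀ Y e → Crossing Y e → Y (head e false) xor Y (head e true) ≡ true
  crossing-xor Y e (false , p , q) rewrite p | q = refl
  crossing-xor Y e (true , p , q) rewrite p | q = refl

  xor-crossing : ∀ Y e → Y (head e false) xor Y (head e true) ≡ true → Crossing Y e
  xor-crossing Y e h with Y (head e false) in p | Y (head e true) in q
  ... | true | false = false , p , q
  ... | false | true = true , q , p

  σ-bad : ∀ s z → bad s z ≡ true → σ z ≡ opp (s (head z false) ⊗ s (head z true))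
  σ-bad s z = equal-sign (s (head z false)) (τ z false) (s (head z true)) (τ z true)

  opp-self : ∀ a → opp a ⊗ a ≡ neg
  opp-self pos = refl
  opp-self neg = refl

-- Edge-disjoint trails

module Trails {n m : ℕ} (S : SG n m) where
  open Core S

  module _ {A : Fin m → Set} where

    on-++ʳ : ∀ {x y z} v (u : Walk A x y) (w : Walk A y z) → On v w → On v (u ++ w)
    on-++ʳ v nil w o = o
    on-++ʳ v (cons e β a p q u) w o = inj₂ (on-++ʳ v u w o)

    onBool : ∀ {x y} → Walk A x y → Fin n → Bool
    onBool w v = does (On? v w)

    onBool-sound : ∀ {x y} (w : Walk A x y) v → onBool w v ≡ true → On v w
    onBool-sound w v h with On? v w
    ... | yes o = o

    onBool-compl : ∀ {x y} (w : Walk A x y) v → On v w → onBool w v ≡ true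
    onBool-compl w v o with On? v w
    ... | yes _ = refl
    ... | no ¬o = contradiction o ¬o

  ∨-intro : ∀ {a b} → a ≡ true ⊎ b ≡ true → a ∨ b ≡ true
  ∨-intro {true}  _ = refl
  ∨-intro {false} (inj₂ h) = h

  ∨-elim : ∀ {a b} → a ∨ b ≡ true → a ≡ true ⊎ b ≡ true
  ∨-elim {true}  _ = inj₁ refl
  ∨-elim {false} h = inj₂ h

  part : ∀ {a b c} → c ≡ a ℕ.+ b → c ≡ 0 → a ≡ 0
  part {a} eq z = ℕₚ.m+n≡0⇒m≡0 a (trans (sym eq) z)

  zero? : ∀ k → k ≡ 0 ⊎ k ≢ 0
  zero? zero    = inj₁ refl
  zero? (suc k) = inj₂ λ ()

  -- A relative form of 2-edge-connectivity, applied to regions inside a vertex set and to the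
  -- positive edges of a minimal switching. `connected` is separate because `bridgeless` is silent
  -- as long as no edge is given.
  module Bridgeless (A : Fin m → Set) (D : Fin n → Set)
    (inside : ∀ e → A e → ∀ β → D (head e β))
    (connected : ∀ p q → D p → D q → ¬ ¬ Walk A p q)
    (bridgeless : ∀ e p q → D p → D q → ¬ ¬ Walk (λ e′ → A e′ × e ≢ e′) p q) where

    record Pair (x y : Fin n) : Set where
      constructor pair
      field
        P Q      : Walk A x y
        disjoint : ∀ e → cnt P e ℕ.+ cnt Q e ℕ.≤ 1

    swap-pair : ∀ {x y} → Pair x y → Pair x y
    swap-pair (pair P Q d) = pair Q P (λ e → subst (ℕ._≤ 1) (ℕₚ.+-comm (cnt P e) (cnt Q e)) (d e))

    on-pair : ∀ {x y} → Pair x y → Fin n → Bool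
    on-pair (pair P Q _) v = onBool P v ∨ onBool Q v

    private
      off-both : ∀ {x y} (PQ : Pair x y) e β → on-pair PQ (head e β) ≡ false →
        cnt (Pair.P PQ) e ≡ 0 × cnt (Pair.Q PQ) e ≡ 0
      off-both (pair P Q d) e β h = off P inj₁ , off Q inj₂
        where
        off : ∀ {x y} (w : Walk A x y) → (onBool w (head e β) ≡ true → onBool P (head e β) ≡ true ⊎ onBool Q
            (head e β) ≡ true) → cnt w e ≡ 0
        off w i with zero? (cnt w e)
        ... | inj₁ z = z
        ... | inj₂ nz = ⊥-elim (true≢false (∨-intro (i (onBool-compl w _ (cnt⇒On w e nz β)))) h)

    -- The part of `P` behind `z` is traversed backwards after `Q`.
    shortcut : ∀ {x y} (PQ : Pair x y) z → On z (Pair.P PQ) → Pair x z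
    shortcut (pair P Q d) z o = pair pre (Q ++ rev suf) d′
      where
      open Split (split P z o)
      d′ : ∀ e → cnt pre e ℕ.+ cnt (Q ++ rev suf) e ℕ.≤ 1
      d′ e = ℕₚ.≤-trans (ℕₚ.≤-reflexive (begin
        cnt pre e ℕ.+ cnt (Q ++ rev suf) e       ≡⟨ cong (cnt pre e ℕ.+_)
            (trans (cnt-++ Q (rev suf) e) (cong (cnt Q e ℕ.+_) (cnt-rev suf e))) ⟩
        cnt pre e ℕ.+ (cnt Q e ℕ.+ cnt suf e)    ≡⟨ cong (cnt pre e ℕ.+_) (ℕₚ.+-comm (cnt Q e) _) ⟩
        cnt pre e ℕ.+ (cnt suf e ℕ.+ cnt Q e)    ≡⟨ sym (ℕₚ.+-assoc (cnt pre e) _ _) ⟩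
        (cnt pre e ℕ.+ cnt suf e) ℕ.+ cnt Q e    ≡⟨ cong (ℕ._+ cnt Q e) (sym (cnt≡ e)) ⟩
        cnt P e ℕ.+ cnt Q e                      ∎)) (d e)
        where open ≡-Reasoning

    -- An augmentation step: `P` is left at `k` and continued along `R` backwards, while `Q` is
    -- prolonged by `e`. Both now end at the new vertex.
    detach : ∀ {x y} (PQ : Pair x y) e β → A e → head e β ≡ y →
      cnt (Pair.P PQ) e ≡ 0 → cnt (Pair.Q PQ) e ≡ 0 → ∀ {k} (R : Walk A (head e (not β)) k) → On k (Pair.P PQ) →
      (∀ e′ → cnt R e′ ℕ.≤ 1) → cnt R e ≡ 0 →
      (∀ e′ → cnt R e′ ≢ 0 → cnt (Pair.P PQ) e′ ≡ 0 × cnt (Pair.Q PQ) e′ ≡ 0) → Pair x (head e (not β))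
    detach (pair P Q d) e β a p Pe Qe {k} R o R≤1 Re apart = pair (pre ++ rev R) (Q ++ edge e β a p refl) d′
      where
      open Split (split P k o)
      pre≤ : ∀ e′ → cnt pre e′ ℕ.≤ cnt P e′
      pre≤ e′ = subst (cnt pre e′ ℕ.≤_) (sym (cnt≡ e′)) (ℕₚ.m≤m+n (cnt pre e′) _)
      expand : ∀ e′ → cnt (pre ++ rev R) e′ ℕ.+ cnt (Q ++ edge e β a p refl) e′ ≡
        (cnt pre e′ ℕ.+ cnt R e′) ℕ.+ (cnt Q e′ ℕ.+ (δℕ e e′ ℕ.+ 0))
      expand e′ = cong₂ ℕ._+_ (trans (cnt-++ pre (rev R) e′) (cong (cnt pre e′ ℕ.+_) (cnt-rev R e′)))
        (cnt-++ Q (edge e β a p refl) e′)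
      bound : ∀ e′ → (cnt pre e′ ℕ.+ cnt R e′) ℕ.+ (cnt Q e′ ℕ.+ (δℕ e e′ ℕ.+ 0)) ℕ.≤ 1
      bound e′ with e ≟ e′
      ... | yes refl rewrite ℕₚ.n≤0⇒n≡0 (subst (cnt pre e ℕ.≤_) Pe (pre≤ e)) | Re | Qe = ℕₚ.≤-refl
      ... | no _ with zero? (cnt R e′)
      ...   | inj₁ z rewrite z | ℕₚ.+-identityʳ (cnt pre e′) | ℕₚ.+-identityʳ (cnt Q e′) =
        ℕₚ.≤-trans (ℕₚ.+-monoˡ-≤ (cnt Q e′) (pre≤ e′)) (d e′)
      ...   | inj₂ nz with apart e′ nz
      ...     | Pe′ , Qe′ rewrite ℕₚ.n≤0⇒n≡0 (subst (cnt pre e′ ℕ.≤_) Pe′ (pre≤ e′)) | Qe′ | ℕₚ.+-identityʳ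
          (cnt R e′) = R≤1 e′
      d′ : ∀ e′ → cnt (pre ++ rev R) e′ ℕ.+ cnt (Q ++ edge e β a p refl) e′ ℕ.≤ 1
      d′ e′ = subst (ℕ._≤ 1) (sym (expand e′)) (bound e′)

    extend : ∀ {x y} → D x → Pair x y → ∀ e β → A e → head e β ≡ y → ¬ ¬ Pair x (head e (not β))
    extend {x} {y} x∈ PQ@(pair P Q d) e β a p with On? (head e (not β)) P | On? (head e (not β)) Q
    ... | yes o | _ = return (shortcut PQ _ o)
    ... | no _ | yes o = return (shortcut (swap-pair PQ) _ o)
    ... | no ∉P | no ∉Q = do
      w ← bridgeless e z x (inside e a (not β)) x∈
      let (R₀ , simple , _) = erase-loops w
          (k , R , k∈ , R≤ , out) = first-hit (on-pair PQ) R₀ (∨-intro (inj₁ (onBool-compl P x (on-start P))))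
          R′ = wmap (λ _ → proj₁) R
          cnt≡ = cnt-wmap {B = A} (λ _ → proj₁) R
          R≤1 = λ e′ → subst (ℕ._≤ 1) (sym (cnt≡ e′)) (ℕₚ.≤-trans (R≤ e′) (simple⇒trail R₀ simple e′))
          Re = trans (cnt≡ e) (avoids R)
          apart = λ e′ nz → let (β′ , h) = out e′ (nz ∘ trans (cnt≡ e′)) in off-both PQ e′ β′ h
      return (finish k∈ R′ R≤1 Re apart)
      where
      z = head e (not β)
      off : ∀ {x y} (w : Walk A x y) → ¬ On z w → cnt w e ≡ 0
      off w ∉ with zero? (cnt w e)
      ... | inj₁ h = h
      ... | inj₂ nz = contradiction (cnt⇒On w e nz (not β)) ∉
      avoids : ∀ {x y} (R : Walk (λ e′ → A e′ × e ≢ e′) x y) → cnt R e ≡ 0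
      avoids R with zero? (cnt R e)
      ... | inj₁ h = h
      ... | inj₂ nz = contradiction refl (proj₂ (cnt⇒A R e nz))
      finish : ∀ {k} → on-pair PQ k ≡ true → (R : Walk A z k) → (∀ e′ → cnt R e′ ℕ.≤ 1) → cnt R e ≡ 0 →
        (∀ e′ → cnt R e′ ≢ 0 → cnt P e′ ≡ 0 × cnt Q e′ ≡ 0) → Pair x z
      finish {k} k∈ R R≤1 Re apart with ∨-elim {onBool P k} k∈
      ... | inj₁ h = detach PQ e β a p (off P ∉P) (off Q ∉Q) R (onBool-sound P k h) R≤1 Re apart
      ... | inj₂ h = detach (swap-pair PQ) e β a p (off Q ∉Q) (off P ∉P) R (onBool-sound Q k h) R≤1 Re
                       (λ e′ nz → proj₂ (apart e′ nz) , proj₁ (apart e′ nz))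

    -- The edge version of Menger's theorem for two paths; the common end of the pair is carried
    -- along a walk, one edge at a time.
    two-trails : ∀ {x y} → D x → D y → ¬ ¬ Pair x y
    two-trails {x} {y} x∈ y∈ = do
      w ← connected x y x∈ y∈
      go w (pair nil nil (λ _ → z≤n))
      where
      go : ∀ {v y} → Walk A v y → Pair x v → ¬ ¬ Pair x y
      go nil PQ = return PQ
      go (cons e β a p refl w) PQ = do
        PQ′ ← extend x∈ PQ e β a p
        go w PQ′

    -- The two feet may coincide; `out` keeps the fan edge-disjoint from everything inside `Y`.
    record Fan (Y : Fin n → Bool) (u : Fin n) : Set where
      field
        k₁ k₂    : Fin n
        k₁∈      : Y k₁ ≡ true
        k₂∈      : Y k₂ ≡ true
        R₁       : Walk A u k₁
        R₂       : Walk A u k₂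
        disjoint : ∀ e → cnt R₁ e ℕ.+ cnt R₂ e ℕ.≤ 1
        out      : ∀ e → cnt R₁ e ℕ.+ cnt R₂ e ≢ 0 → ∃ λ β → Y (head e β) ≡ false

    fan : ∀ Y {u x} → D u → D x → Y x ≡ true → ¬ ¬ Fan Y u
    fan Y u∈ x∈ Yx = do
      pair P Q d ← two-trails u∈ x∈
      let (k₁ , R₁ , k₁∈ , le₁ , out₁) = first-hit Y P Yx
          (k₂ , R₂ , k₂∈ , le₂ , out₂) = first-hit Y Q Yx
      return record { k₁ = k₁ ; k₂ = k₂ ; k₁∈ = k₁∈ ; k₂∈ = k₂∈ ; R₁ = R₁ ; R₂ = R₂
        ; disjoint = λ e → ℕₚ.≤-trans (ℕₚ.+-mono-≤ (le₁ e) (le₂ e)) (d e)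
        ; out = λ e → either (cnt R₁ e) (cnt R₂ e) (out₁ e) (out₂ e) }
      where
      either : ∀ a b {C : Set} → (a ≢ 0 → C) → (b ≢ 0 → C) → a ℕ.+ b ≢ 0 → C
      either zero    b f g h = g h
      either (suc a) b f g h = f λ ()

    record Linked (u₁ v₁ u₂ v₂ : Fin n) : Set where
      field
        B₁ : Walk A u₁ v₁
        B₂ : Walk A u₂ v₂
        apart : ∀ e → cnt B₁ e ≡ 0 ⊎ cnt B₂ e ≡ 0

    record Ring (u₁ v₁ u₂ v₂ : Fin n) : Set where
      field
        PQ  : Pair u₁ v₁
        u₂∈ : On u₂ (Pair.P PQ)
        v₂∈ : On v₂ (Pair.Q PQ)

    -- The segment of `P` between `k₁` and `k₂`, which may occur in either order, is replaced by the
    -- two walks through `u`.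
    detour : ∀ {x y u k₁ k₂} (P : Walk A x y) → On k₁ P → On k₂ P → (R₁ : Walk A u k₁) (R₂ : Walk A u k₂) →
      Σ (Walk A x y) λ N → On u N × (∀ e → cnt N e ℕ.≤ cnt P e ℕ.+ (cnt R₁ e ℕ.+ cnt R₂ e))
    detour {x} {y} {u} {k₁} {k₂} P o₁ o₂ R₁ R₂ with split P k₁ o₁
    ... | s with Split.on⇒ s k₂ o₂
    ...   | inj₂ o = T.pre ++ rev R₁ ++ R₂ ++ U.suf ,
                     on-++ʳ u T.pre _ (on-++ʳ u (rev R₁) _ (on-start (R₂ ++ U.suf))) , bound
      where
      module T = Split s
      module U = Split (split T.suf k₂ o)
      bound : ∀ e → cnt (T.pre ++ rev R₁ ++ R₂ ++ U.suf) e ℕ.≤ cnt P e ℕ.+ (cnt R₁ e ℕ.+ cnt R₂ e)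
      bound e rewrite cnt-++ T.pre (rev R₁ ++ R₂ ++ U.suf) e | cnt-++ (rev R₁) (R₂ ++ U.suf) e | cnt-++ R₂ U.suf e
        | cnt-rev R₁ e | T.cnt≡ e | U.cnt≡ e = arith (cnt T.pre e) (cnt R₁ e) (cnt R₂ e) (cnt U.suf e) (cnt U.pre e)
        where
        arith : ∀ a b c d x → a ℕ.+ (b ℕ.+ (c ℕ.+ d)) ℕ.≤ (a ℕ.+ (x ℕ.+ d)) ℕ.+ (b ℕ.+ c)
        arith a b c d x = ℕₚ.≤-trans (ℕₚ.≤-reflexive (trans
            (cong (a ℕ.+_) (trans (sym (ℕₚ.+-assoc b c d)) (ℕₚ.+-comm (b ℕ.+ c) d)))
            (sym (ℕₚ.+-assoc a d (b ℕ.+ c)))))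
          (ℕₚ.+-monoˡ-≤ (b ℕ.+ c) (ℕₚ.+-monoʳ-≤ a (ℕₚ.m≤n+m d x)))
    ...   | inj₁ o = U.pre ++ rev R₂ ++ R₁ ++ T.suf ,
                     on-++ʳ u U.pre _ (on-++ʳ u (rev R₂) _ (on-start (R₁ ++ T.suf))) , bound
      where
      module T = Split s
      module U = Split (split T.pre k₂ o)
      bound : ∀ e → cnt (U.pre ++ rev R₂ ++ R₁ ++ T.suf) e ℕ.≤ cnt P e ℕ.+ (cnt R₁ e ℕ.+ cnt R₂ e)
      bound e rewrite cnt-++ U.pre (rev R₂ ++ R₁ ++ T.suf) e | cnt-++ (rev R₂) (R₁ ++ T.suf) e | cnt-++ R₁ T.suf e
        | cnt-rev R₂ e | T.cnt≡ e | U.cnt≡ e = arith (cnt U.pre e) (cnt R₂ e) (cnt R₁ e) (cnt T.suf e) (cnt U.suf e)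
        where
        arith : ∀ a b c d x → a ℕ.+ (b ℕ.+ (c ℕ.+ d)) ℕ.≤ ((a ℕ.+ x) ℕ.+ d) ℕ.+ (c ℕ.+ b)
        arith a b c d x = ℕₚ.≤-trans (ℕₚ.≤-reflexive (trans
            (cong (a ℕ.+_) (trans (sym (ℕₚ.+-assoc b c d)) (trans (ℕₚ.+-comm (b ℕ.+ c) d)
            (cong (d ℕ.+_) (ℕₚ.+-comm b c))))) (sym (ℕₚ.+-assoc a d (c ℕ.+ b)))))
          (ℕₚ.+-monoˡ-≤ (c ℕ.+ b) (ℕₚ.+-monoˡ-≤ d (ℕₚ.m≤m+n a x)))

    -- If the two pairs cannot be linked, then the fans of u₂ and v₂ attach to different trails
    -- of a pair from u₁ to v₁, and each trail can be rerouted through its own fan.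
    linked-or-ring : ∀ {u₁ v₁ u₂ v₂} → D u₁ → D v₁ → D u₂ → D v₂ → ¬ ¬ (Linked u₁ v₁ u₂ v₂ ⊎ Ring u₁ v₁ u₂ v₂)
    linked-or-ring {u₁} {v₁} {u₂} {v₂} u₁∈ v₁∈ u₂∈ v₂∈ = do
      PQ ← two-trails u₁∈ v₁∈
      F ← fan (on-pair PQ) u₂∈ u₁∈ (∨-intro (inj₁ (onBool-compl (Pair.P PQ) u₁ (on-start (Pair.P PQ)))))
      F′ ← fan (on-pair PQ) v₂∈ u₁∈ (∨-intro (inj₁ (onBool-compl (Pair.P PQ) u₁ (on-start (Pair.P PQ)))))
      no nl ← em (Linked u₁ v₁ u₂ v₂)
        where yes l → return (inj₁ l)
      return (inj₂ (ring PQ F F′ nl))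
      where
      module _ (PQ : Pair u₁ v₁) where
        clear : ∀ {Y u} (F : Fan Y u) → Y ≡ on-pair PQ → ∀ e → cnt (Fan.R₁ F) e ℕ.+ cnt (Fan.R₂ F) e ≢ 0 →
          cnt (Pair.P PQ) e ≡ 0 × cnt (Pair.Q PQ) e ≡ 0
        clear F refl e h with Fan.out F e h
        ... | β , h′ = off-both PQ e β h′

      ring : ∀ (PQ : Pair u₁ v₁) → Fan (on-pair PQ) u₂ → Fan (on-pair PQ) v₂ → ¬ Linked u₁ v₁ u₂ v₂ →
          Ring u₁ v₁ u₂ v₂
      ring PQ@(pair P Q d) F F′ nl = assemble (side F.k₁∈)
        where
        module F = Fan F
        module F′ = Fan F′
        side : ∀ {k} → on-pair PQ k ≡ true → On k P ⊎ On k Q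
        side {k} h with ∨-elim {onBool P k} h
        ... | inj₁ h′ = inj₁ (onBool-sound P k h′)
        ... | inj₂ h′ = inj₂ (onBool-sound Q k h′)
        -- A path from u₂ to v₂ through P leaves Q free.
        via : ∀ {k k′} (P Q : Walk A u₁ v₁) → (∀ e → cnt P e ℕ.+ cnt Q e ℕ.≤ 1) →
          (R : Walk A u₂ k) (R′ : Walk A v₂ k′) →
          (∀ e → cnt R e ≢ 0 → cnt Q e ≡ 0) → (∀ e → cnt R′ e ≢ 0 → cnt Q e ≡ 0) → On k P → On k′ P → ⊥
        via {k} {k′} P Q d R R′ cR cR′ o o′ = nl record { B₁ = Q ; B₂ = R ++ rev T.pre ++ U.pre ++ rev R′ ;
            apart = apart }
          where
          module T = Split (split P k o)
          module U = Split (split P k′ o′)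
          apart : ∀ e → cnt Q e ≡ 0 ⊎ cnt (R ++ rev T.pre ++ U.pre ++ rev R′) e ≡ 0
          apart e with zero? (cnt Q e)
          ... | inj₁ z = inj₁ z
          ... | inj₂ nz = inj₂ total
            where
            Pe : cnt P e ≡ 0
            Pe with cnt P e | cnt Q e | d e
            ... | zero | _ | _ = refl
            ... | suc a | zero | _ = contradiction refl nz
            Pe | suc zero | suc b | s≤s ()
            Pe | suc (suc a) | suc b | s≤s ()
            T0 : cnt T.pre e ≡ 0
            T0 = part (T.cnt≡ e) Pe
            U0 : cnt U.pre e ≡ 0
            U0 = part (U.cnt≡ e) Pe
            total : cnt (R ++ rev T.pre ++ U.pre ++ rev R′) e ≡ 0
            total rewrite cnt-++ R (rev T.pre ++ U.pre ++ rev R′) e | cnt-++ (rev T.pre)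
                (U.pre ++ rev R′) e | cnt-++ U.pre (rev R′) e
              | cnt-rev T.pre e | cnt-rev R′ e | T0 | U0
              | ≢0-stable (λ h → nz (cR e h)) | ≢0-stable (λ h → nz (cR′ e h)) = refl
        d′ : ∀ e → cnt Q e ℕ.+ cnt P e ℕ.≤ 1
        d′ = Pair.disjoint (swap-pair PQ)
        l : ∀ a b → a ≢ 0 → a ℕ.+ b ≢ 0
        l zero b h _ = h refl
        r : ∀ a b → b ≢ 0 → a ℕ.+ b ≢ 0
        r zero b h h′ = h h′
        cF₁ = λ e h → clear PQ F refl e (l (cnt F.R₁ e) (cnt F.R₂ e) h)
        cF₂ = λ e h → clear PQ F refl e (r (cnt F.R₁ e) (cnt F.R₂ e) h)
        cF₁′ = λ e h → clear PQ F′ refl e (l (cnt F′.R₁ e) (cnt F′.R₂ e) h)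
        cF₂′ = λ e h → clear PQ F′ refl e (r (cnt F′.R₁ e) (cnt F′.R₂ e) h)
        -- A common edge of the two fans would join `u₂` to `v₂` off `P`, again a linkage.
        meet : ∀ {k k′} (R : Walk A u₂ k) (R′ : Walk A v₂ k′) → (∀ e → cnt R e ≢ 0 → cnt P e ≡ 0) →
            (∀ e → cnt R′ e ≢ 0 → cnt P e ≡ 0) →
          ∀ e → cnt R e ≢ 0 → cnt R′ e ≢ 0 → ⊥
        meet R R′ cR cR′ e h h′ = nl record { B₁ = P ; B₂ = T.pre ++ rev U.pre ; apart = apart }
          where
          module T = Split (split R (head e false) (cnt⇒On R e h false))
          module U = Split (split R′ (head e false) (cnt⇒On R′ e h′ false))
          apart : ∀ e → cnt P e ≡ 0 ⊎ cnt (T.pre ++ rev U.pre) e ≡ 0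
          apart e with zero? (cnt P e)
          ... | inj₁ z = inj₁ z
          ... | inj₂ nz = inj₂ (trans (cnt-++ T.pre (rev U.pre) e) (cong₂ ℕ._+_
            (part (T.cnt≡ e) (≢0-stable (λ h → nz (cR e h))))
                (trans (cnt-rev U.pre e) (part (U.cnt≡ e) (≢0-stable (λ h → nz (cR′ e h)))))))
        fans-apart : ∀ e → cnt F.R₁ e ℕ.+ cnt F.R₂ e ≢ 0 → cnt F′.R₁ e ℕ.+ cnt F′.R₂ e ≢ 0 → ⊥
        fans-apart e h h′ with zero? (cnt F.R₁ e) | zero? (cnt F′.R₁ e)
        ... | inj₂ a | inj₂ b = meet F.R₁ F′.R₁ (λ e → proj₁ ∘ cF₁ e) (λ e → proj₁ ∘ cF₁′ e) e a b
        ... | inj₂ a | inj₁ b = meet F.R₁ F′.R₂ (λ e → proj₁ ∘ cF₁ e) (λ e → proj₁ ∘ cF₂′ e) e a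
            (λ z → h′ (cong₂ ℕ._+_ b z))
        ... | inj₁ a | inj₂ b = meet F.R₂ F′.R₁ (λ e → proj₁ ∘ cF₂ e) (λ e → proj₁ ∘ cF₁′ e) e
            (λ z → h (cong₂ ℕ._+_ a z)) b
        ... | inj₁ a | inj₁ b = meet F.R₂ F′.R₂ (λ e → proj₁ ∘ cF₂ e) (λ e → proj₁ ∘ cF₂′ e) e
            (λ z → h (cong₂ ℕ._+_ a z)) (λ z → h′ (cong₂ ℕ._+_ b z))
        build : ∀ (P₁ Q₁ : Walk A u₁ v₁) → (∀ e → cnt P₁ e ℕ.+ cnt Q₁ e ℕ.≤ 1) →
          (∀ e → cnt F.R₁ e ℕ.+ cnt F.R₂ e ≢ 0 → cnt P₁ e ≡ 0 × cnt Q₁ e ≡ 0) →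
          (∀ e → cnt F′.R₁ e ℕ.+ cnt F′.R₂ e ≢ 0 → cnt P₁ e ≡ 0 × cnt Q₁ e ≡ 0) →
          On F.k₁ P₁ → On F.k₂ P₁ → On F′.k₁ Q₁ → On F′.k₂ Q₁ → Ring u₁ v₁ u₂ v₂
        build P₁ Q₁ d₁ c c′ a₁ a₂ b₁ b₂ with detour P₁ a₁ a₂ F.R₁ F.R₂ | detour Q₁ b₁ b₂ F′.R₁ F′.R₂
        ... | N , u∈ , le | N′ , v∈ , le′ = record { PQ = pair N N′ bound ; u₂∈ = u∈ ; v₂∈ = v∈ }
          where
          bound : ∀ e → cnt N e ℕ.+ cnt N′ e ℕ.≤ 1
          bound e = ℕₚ.≤-trans (ℕₚ.+-mono-≤ (le e) (le′ e)) small
            where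
            small : (cnt P₁ e ℕ.+ (cnt F.R₁ e ℕ.+ cnt F.R₂ e)) ℕ.+
                (cnt Q₁ e ℕ.+ (cnt F′.R₁ e ℕ.+ cnt F′.R₂ e)) ℕ.≤ 1
            small with zero? (cnt F.R₁ e ℕ.+ cnt F.R₂ e) | zero? (cnt F′.R₁ e ℕ.+ cnt F′.R₂ e)
            ... | inj₂ h | inj₂ h′ = ⊥-elim (fans-apart e h h′)
            ... | inj₁ h | inj₁ h′ rewrite h | h′ | ℕₚ.+-identityʳ (cnt P₁ e) | ℕₚ.+-identityʳ (cnt Q₁ e) = d₁ e
            ... | inj₂ h | inj₁ h′ rewrite h′ | proj₁ (c e h) | proj₂ (c e h) | ℕₚ.+-identityʳ
                (cnt F.R₁ e ℕ.+ cnt F.R₂ e) = F.disjoint e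
            ... | inj₁ h | inj₂ h′ rewrite h | proj₁ (c′ e h′) | proj₂ (c′ e h′) = F′.disjoint e
        not-both : {C D : Set} → C ⊎ D → ¬ C → D
        not-both (inj₁ c) h = contradiction c h
        not-both (inj₂ d) h = d
        flip⊎ : {C D : Set} → C ⊎ D → D ⊎ C
        flip⊎ (inj₁ c) = inj₂ c
        flip⊎ (inj₂ d) = inj₁ d
        assemble : On F.k₁ P ⊎ On F.k₁ Q → Ring u₁ v₁ u₂ v₂
        assemble (inj₁ a) = build P Q d (clear PQ F refl) (clear PQ F′ refl) a a₂ b₁ b₂
          where
          b₁ : On F′.k₁ Q
          b₁ = not-both (side F′.k₁∈) (via P Q d F.R₁ F′.R₁ (λ e → proj₂ ∘ cF₁ e) (λ e → proj₂ ∘ cF₁′ e) a)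
          b₂ : On F′.k₂ Q
          b₂ = not-both (side F′.k₂∈) (via P Q d F.R₁ F′.R₂ (λ e → proj₂ ∘ cF₁ e) (λ e → proj₂ ∘ cF₂′ e) a)
          a₂ : On F.k₂ P
          a₂ = not-both (flip⊎ (side F.k₂∈)) (λ o → via Q P d′ F.R₂ F′.R₁ (λ e → proj₁ ∘ cF₂ e)
              (λ e → proj₁ ∘ cF₁′ e) o b₁)
        assemble (inj₂ a) = build Q P d′ (λ e h → swap (clear PQ F refl e h))
            (λ e h → swap (clear PQ F′ refl e h)) a a₂ b₁ b₂
          where
          swap : {C D : Set} → C × D → D × C
          swap (c , d) = d , c
          b₁ : On F′.k₁ P
          b₁ = not-both (flip⊎ (side F′.k₁∈)) (via Q P d′ F.R₁ F′.R₁ (λ e → proj₁ ∘ cF₁ e) (λ e → proj₁ ∘ cF₁′ e) a)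
          b₂ : On F′.k₂ P
          b₂ = not-both (flip⊎ (side F′.k₂∈)) (via Q P d′ F.R₁ F′.R₂ (λ e → proj₁ ∘ cF₁ e) (λ e → proj₁ ∘ cF₂′ e) a)
          a₂ : On F.k₂ Q
          a₂ = not-both (side F.k₂∈) (λ o → via P Q d F.R₂ F′.R₁ (λ e → proj₂ ∘ cF₂ e) (λ e → proj₂ ∘ cF₁′ e) o b₁)

-- Parity, corrections modulo 3 and their extension

private
  three-cancel : ∀ p → + 3 ∣ + 2 * p → + 3 ∣ p
  three-cancel p d = subst (+ 3 ∣_) (re p) (∣m∣n⇒∣m+n (∣m⇒∣m*n p (divides (+ 1) refl)) (∣m⇒∣-m d))
    where
    re : ∀ (p : ℤ) → + 3 * p + - (+ 2 * p) ≡ p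
    re = solve-∀

  gap₁ : ∀ x p → + 3 ∣ x → + 3 ∣ x + 1ℤ * p → + 3 ∣ p
  gap₁ x p a b = subst (+ 3 ∣_) (ℤₚ.*-identityˡ p) (∣m+n∣m⇒∣n b a)

  gap₂ : ∀ x p → + 3 ∣ x → + 3 ∣ x + + 2 * p → + 3 ∣ p
  gap₂ x p a b = three-cancel p (∣m+n∣m⇒∣n b a)

  gap₁₂ : ∀ x p → + 3 ∣ x + 1ℤ * p → + 3 ∣ x + + 2 * p → + 3 ∣ p
  gap₁₂ x p a b = ∣m+n∣m⇒∣n (subst (+ 3 ∣_) (re x p) b) a
    where
    re : ∀ (x p : ℤ) → x + + 2 * p ≡ (x + 1ℤ * p) + p
    re = solve-∀

-- Of the three multiples of p each of the two conditions excludes at most one.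
avoid-two : ∀ x p y q → ¬ + 3 ∣ p → ¬ + 3 ∣ q → ∃ λ c → ¬ (+ 3 ∣ x + c * p) × ¬ (+ 3 ∣ y + c * q)
avoid-two x p y q p∤ q∤
  with + 3 ∣? x | + 3 ∣? y | + 3 ∣? x + 1ℤ * p | + 3 ∣? y + 1ℤ * q | + 3 ∣? x + + 2 * p | + 3 ∣? y + + 2 * q
... | no a | no b | _ | _ | _ | _ = + 0 , (λ d → a (subst (+ 3 ∣_) (z x p) d)) ,
    (λ d → b (subst (+ 3 ∣_) (z y q) d))
  where
  z : ∀ (x p : ℤ) → x + + 0 * p ≡ x
  z = solve-∀
... | _ | _ | no a | no b | _ | _ = 1ℤ , a , b
... | _ | _ | _ | _ | no a | no b = + 2 , a , b
... | yes a | _ | yes b | _ | _ | _ = contradiction (gap₁ x p a b) p∤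
... | yes a | _ | _ | _ | yes b | _ = contradiction (gap₂ x p a b) p∤
... | _ | _ | yes a | _ | yes b | _ = contradiction (gap₁₂ x p a b) p∤
... | _ | yes a | _ | yes b | _ | _ = contradiction (gap₁ y q a b) q∤
... | _ | yes a | _ | _ | _ | yes b = contradiction (gap₂ y q a b) q∤
... | _ | _ | _ | yes a | _ | yes b = contradiction (gap₁₂ y q a b) q∤

unit-odd : ∀ {x} → IsUnit x → ¬ (+ 2 ∣ x)
unit-odd (inj₁ refl) = from-no (+ 2 ∣? 1ℤ)
unit-odd (inj₂ refl) = from-no (+ 2 ∣? - 1ℤ)

unit-∤3 : ∀ {x} → IsUnit x → ¬ (+ 3 ∣ x)
unit-∤3 (inj₁ refl) = from-no (+ 3 ∣? 1ℤ)
unit-∤3 (inj₂ refl) = from-no (+ 3 ∣? - 1ℤ)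

unit-∤3′ : ∀ {x} → IsUnit x → ¬ (+ 3 ∣ + 2 * x)
unit-∤3′ (inj₁ refl) = from-no (+ 3 ∣? + 2 * 1ℤ)
unit-∤3′ (inj₂ refl) = from-no (+ 3 ∣? + 2 * - 1ℤ)

module Covering {n m : ℕ} (S : SG n m) where
  open Core S

  Supp : (Fin m → Set) → (Fin m → ℤ) → Set
  Supp X f = ∀ e → ¬ X e → f e ≡ 0ℤ

  Covered : (Fin m → ℤ) → (Fin m → ℤ) → Fin m → Set
  Covered h g e = ¬ (+ 2 ∣ h e) ⊎ ¬ (+ 3 ∣ g e)

  -- `g` is arbitrary, so values outside `X` can be fixed first; `X` is repaired afterwards without
  -- disturbing them.
  Good : (Fin m → Set) → (Fin m → ℤ) → Set
  Good X h = ∀ g → Flow g → ¬ ¬ (∃ λ g′ → Flow g′ × (∀ e → ¬ X e → g′ e ≡ g e) × (∀ e → X e → Covered h g′ e))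

  -- In a balanced graph the boundaries supported in W have a vanishing signed sum, in an
  -- unbalanced one an even sum; the factor 2 lets one definition serve both cases.
  Link : (Fin n → Bool) → (Fin m → Set) → Set
  Link W X = ∀ g → (∀ v → W v ≡ false → ∂ g v ≡ 0ℤ) →
    ¬ ¬ (∃ λ π → Supp X π × (∀ v → ∂ π v ≡ + 2 * ∂ g v))

  flow-+ : ∀ {f g} → Flow f → Flow g → Flow (λ e → f e + g e)
  flow-+ {f} {g} F G v = trans (∂-+ f g v) (cong₂ _+_ (F v) (G v))

  flow-lin : ∀ {f} c {g} → Flow f → Flow g → Flow (λ e → f e + c * g e)
  flow-lin {f} c {g} F G v = trans (∂-lin f c g v) (trans (cong₂ (λ a b → a + c * b) (F v) (G v))
    (trans (ℤₚ.+-identityˡ (c * 0ℤ)) (ℤₚ.*-zeroʳ c)))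

  -- Edges with an odd value are covered whatever happens modulo 3, and disjoint supports preserve
  -- the parities on both sides.
  good-odd : ∀ {X h} h′ (C : Fin m → Set) → Good X h → Supp X h → Supp C h′ →
    (∀ e → C e → ¬ X e) → (∀ e → C e → ¬ (+ 2 ∣ h′ e)) → Good (λ e → X e ⊎ C e) (λ e → h e + h′ e)
  good-odd {X} {h} h′ C good supp supp′ disj odd g G = do
    (g′ , G′ , off , cov) ← good g G
    return (g′ , G′ , (λ e ∉ → off e (∉ ∘ inj₁)) , λ { e (inj₁ x) → old cov e x ; e (inj₂ c) → new {g′} e c })
    where
    new : ∀ {g′} e → C e → Covered (λ e → h e + h′ e) g′ e
    new e c = inj₁ (λ d → odd e c (subst (+ 2 ∣_) (trans (cong (_+ h′ e) (supp e (disj e c)))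
        (ℤₚ.+-identityˡ (h′ e))) d))
    old : ∀ {g′} → (∀ e → X e → Covered h g′ e) → ∀ e → X e → Covered (λ e → h e + h′ e) g′ e
    old {g′} cov e x = subst (λ z → ¬ (+ 2 ∣ z) ⊎ ¬ (+ 3 ∣ g′ e))
      (sym (trans (cong (λ z → h e + z) (supp′ e (λ c → disj e c x))) (ℤₚ.+-identityʳ (h e)))) (cov e x)

  good-resp : ∀ {X X′ h} → (∀ e → X e → X′ e) → (∀ e → X′ e → X e) → Good X h → Good X′ h
  good-resp to from good g G = do
    (g′ , G′ , off , cov) ← good g G
    return (g′ , G′ , (λ e ∉ → off e (∉ ∘ to e)) , λ e i → cov e (from e i))

  -- A multiple of `ψ` makes `g` nonzero modulo 3 on `a` and `b`, whatever it spoils on `X`; the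
  -- repair of `X` then leaves `a` and `b` alone. Three residues suffice for two edges.
  good-pair : ∀ {X h} ψ a b → Good X h → Flow ψ → Supp (λ e → X e ⊎ (e ≡ a ⊎ e ≡ b)) ψ →
    ¬ X a → ¬ X b → ¬ (+ 3 ∣ ψ a) → ¬ (+ 3 ∣ ψ b) → Good (λ e → X e ⊎ (e ≡ a ⊎ e ≡ b)) h
  good-pair {X} {h} ψ a b good Ψ supp a∉ b∉ a∤ b∤ g G with avoid-two (g a) (ψ a) (g b) (ψ b) a∤ b∤
  ... | c , ca , cb = do
    (g′ , G′ , off , cov) ← good (λ e → g e + c * ψ e) (flow-lin c G Ψ)
    return (g′ , G′ ,
      (λ e ∉ → trans (off e (∉ ∘ inj₁)) (trans (cong (λ z → g e + c * z) (supp e ∉))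
          (trans (cong (λ z → g e + z) (ℤₚ.*-zeroʳ c)) (ℤₚ.+-identityʳ (g e))))) ,
      λ { e (inj₁ x) → cov e x
        ; e (inj₂ (inj₁ refl)) → inj₂ (λ d → ca (subst (+ 3 ∣_) (off e a∉) d))
        ; e (inj₂ (inj₂ refl)) → inj₂ (λ d → cb (subst (+ 3 ∣_) (off e b∉) d)) })

  link-mono : ∀ {W X X′} → (∀ e → X e → X′ e) → Link W X → Link W X′
  link-mono sub link g G = do
    (π , supp , eq) ← link g G
    return (π , (λ e ∉ → supp e (∉ ∘ sub e)) , eq)

  -- A means of moving one unit of boundary from `p` into `W`. The value at `p` is prescribed only
  -- when `p` is a new vertex, which lets the other vertices use zero.
  Anchor : (W W′ : Fin n → Bool) → (Fin m → Set) → Fin n → Set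
  Anchor W W′ X p = ∃ λ ρ → Supp X ρ × (W′ p ≡ true → W p ≡ false → ∂ ρ p ≡ 1ℤ) ×
    (∀ v → v ≢ p → W v ≡ false → ∂ ρ v ≡ 0ℤ)

  private
    W≢ : ∀ (W : Fin n → Bool) w v → W w ≡ true → W v ≡ false → w ≢ v
    W≢ W w v a b refl = true≢false a b

  anchor-old : ∀ {W W′ X p} → W p ≡ true ⊎ W′ p ≡ false → Anchor W W′ X p
  anchor-old old = (λ _ → 0ℤ) , (λ _ _ → refl) ,
    (λ a b → ⊥-elim ([ (λ c → true≢false c b) , true≢false a ]′ old)) , λ v _ _ → ∂-zero v

  anchor : ∀ {W W′ X} p f s w c → Supp X f → (∀ v → ∂ f v ≡ c * δ w v - sgn s * δ p v) → W w ≡ true →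
      Anchor W W′ X p
  anchor {W} p f s w c supp eq w∈ = (λ e → - sgn s * f e) ,
    (λ e ∉ → trans (cong (- sgn s *_) (supp e ∉)) (ℤₚ.*-zeroʳ (- sgn s))) ,
    (λ _ p∉ → trans (∂-* (- sgn s) f p) (trans (cong (- sgn s *_) (trans (eq p)
        (cong₂ (λ a b → c * a - sgn s * b) (δ-≢ (W≢ W w p w∈ p∉)) (δ-refl p))))
            (trans (calc (sgn s) c) (sgn² s)))) ,
    (λ v v≢p v∉ → trans (∂-* (- sgn s) f v) (trans (cong (- sgn s *_) (trans (eq v)
        (cong₂ (λ a b → c * a - sgn s * b) (δ-≢ (W≢ W w v w∈ v∉)) (δ-≢ (v≢p ∘ sym))))) (calc′ (sgn s) c)))
    where
    calc : ∀ (s c : ℤ) → - s * (c * 0ℤ - s * 1ℤ) ≡ s * s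
    calc = solve-∀
    calc′ : ∀ (s c : ℤ) → - s * (c * 0ℤ - s * 0ℤ) ≡ 0ℤ
    calc′ = solve-∀

  ∂-sum : ∀ {k} (f : Fin k → Fin m → ℤ) v → ∂ (λ e → sumℤ k (λ p → f p e)) v ≡ sumℤ k (λ p → ∂ (f p) v)
  ∂-sum {k} f v = trans (sum-cong m (λ e → sym (sum-* k (inc e v) (λ p → f p e))))
      (sum-swap m k (λ e p → inc e v * f p e))

  -- Anchors sweep the boundary of `g` from the new vertices into `W`; the given link handles the
  -- swept function, and twice the sweeping is subtracted from its answer.
  link-extend : ∀ {W W′ X X′} → (∀ e → X e → X′ e) → (∀ p → Anchor W W′ X′ p) → Link W X → Link W′ X′
  link-extend {W} {W′} {X} {X′} sub anc link g G = do
    (π , supp , eq) ← link g′ G′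
    return ((λ e → π e + - + 2 * fix e) ,
      (λ e ∉ → trans (cong₂ (λ a b → a + - + 2 * b) (supp e (∉ ∘ sub e)) (fix-supp e ∉)) refl) ,
      (λ v → trans (∂-lin π (- + 2) fix v) (trans (cong (_+ - + 2 * ∂ fix v)
          (trans (eq v) (cong (+ 2 *_) (∂-+ g fix v)))) (calc (∂ g v) (∂ fix v)))))
    where
    calc : ∀ (a b : ℤ) → + 2 * (a + b) + - + 2 * b ≡ + 2 * a
    calc = solve-∀
    ρ : Fin n → Fin m → ℤ
    ρ p = proj₁ (anc p)
    c : Fin n → ℤ
    c p = if W p then 0ℤ else - ∂ g p
    fix : Fin m → ℤ
    fix e = sumℤ n (λ p → c p * ρ p e)
    fix-supp : ∀ e → ¬ X′ e → fix e ≡ 0ℤ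
    fix-supp e ∉ = sum-zero n (λ p → trans (cong (c p *_) (proj₁ (proj₂ (anc p)) e ∉)) (ℤₚ.*-zeroʳ (c p)))
    g′ : Fin m → ℤ
    g′ e = g e + fix e
    ∂fix : ∀ v → W v ≡ false → ∂ fix v ≡ - ∂ g v
    ∂fix v v∉ = trans (∂-sum (λ p e → c p * ρ p e) v) (trans (sum-cong n (λ p → ∂-* (c p) (ρ p) v))
      (trans (sum-single n v _ (λ p p≢v → trans (cong (c p *_)
          (proj₂ (proj₂ (proj₂ (anc p))) v (p≢v ∘ sym) v∉)) (ℤₚ.*-zeroʳ (c p))))
        (main (W′ v) refl)))
      where
      cv : c v ≡ - ∂ g v
      cv = cong (λ z → if z then 0ℤ else - ∂ g v) v∉
      main : ∀ b → W′ v ≡ b → c v * ∂ (ρ v) v ≡ - ∂ g v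
      main true  h = trans (cong₂ _*_ cv (proj₁ (proj₂ (proj₂ (anc v))) h v∉)) (ℤₚ.*-identityʳ (- ∂ g v))
      main false h = trans (cong (_* ∂ (ρ v) v) (trans cv (cong -_ (G v h))))
        (trans (ℤₚ.*-zeroˡ (∂ (ρ v) v)) (sym (cong -_ (G v h))))
    G′ : ∀ v → W v ≡ false → ∂ g′ v ≡ 0ℤ
    G′ v v∉ = trans (∂-+ g fix v) (trans (cong (λ z → ∂ g v + z) (∂fix v v∉)) (ℤₚ.+-inverseʳ (∂ g v)))

  χ-difference-odd : ∀ {A B x y x′ y′} (P : Walk A x y) (Q : Walk B x′ y′) e →
    cnt P e ℕ.+ cnt Q e ℕ.≤ 1 → cnt P e ℕ.+ cnt Q e ≢ 0 → ¬ (+ 2 ∣ χ P e + - 1ℤ * χ Q e)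
  χ-difference-odd P Q e le nz = unit-odd (go (cnt P e) (cnt Q e) refl refl le nz)
    where
    re : ∀ (x : ℤ) → 0ℤ + - 1ℤ * x ≡ - x
    re = solve-∀
    go : ∀ k l → cnt P e ≡ k → cnt Q e ≡ l → k ℕ.+ l ℕ.≤ 1 → k ℕ.+ l ≢ 0 → IsUnit (χ P e + - 1ℤ * χ Q e)
    go zero zero p q _ nz = contradiction refl nz
    go zero (suc zero) p q _ _ =
      subst IsUnit (sym (trans (cong (_+ - 1ℤ * χ Q e) (χ-zero P e p)) (re (χ Q e)))) (unit-neg (χ-unit Q e q))
    go (suc zero) zero p q _ _ =
      subst IsUnit (sym (trans (cong (λ z → χ P e + - 1ℤ * z) (χ-zero Q e q)) (ℤₚ.+-identityʳ (χ P e))))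
          (χ-unit P e p)
    go zero (suc (suc l)) p q (s≤s ()) _
    go (suc zero) (suc l) p q (s≤s ()) _
    go (suc (suc k)) l p q (s≤s ()) _

  χ-difference-supp : ∀ {A B x y x′ y′} (P : Walk A x y) (Q : Walk B x′ y′) →
    Supp (λ e → cnt P e ℕ.+ cnt Q e ≢ 0) (λ e → χ P e + - 1ℤ * χ Q e)
  χ-difference-supp P Q e h = cong₂ (λ p q → p + - 1ℤ * q) (χ-zero P e (ℕₚ.m+n≡0⇒m≡0 (cnt P e) z))
      (χ-zero Q e (ℕₚ.m+n≡0⇒n≡0 (cnt P e) z))
    where
    z = ≢0-stable h

  -- The doubled edge is closed up through `X` to a flow with value 2 on `e₀`; the edge plays both
  -- parts in `good-pair`.
  good-edge : ∀ {W X h} e₀ → (∀ β → W (head e₀ β) ≡ true) → Good X h → Link W X → ¬ X e₀ →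
    Good (λ e → X e ⊎ (e ≡ e₀ ⊎ e ≡ e₀)) h
  good-edge {W} {X} e₀ ends good link e₀∉ g G = do
    (π , supp , eq) ← link (δ e₀) (λ v v∉ → trans (∂-δ e₀ v) (trans
      (cong₂ (λ a b → a * t e₀ false + b * t e₀ true) (δ-≢ (W≢ W (head e₀ false) v (ends false) v∉))
          (δ-≢ (W≢ W (head e₀ true) v (ends true) v∉))) (zeros (t e₀ false) (t e₀ true))))
    let ψ = λ e → + 2 * δ e₀ e + - 1ℤ * π e
        ψ₀ : ψ e₀ ≡ + 2
        ψ₀ = cong₂ (λ a b → + 2 * a + - 1ℤ * b) (δ-refl e₀) (supp e₀ e₀∉)
        ∤ = λ d → from-no (+ 3 ∣? + 2) (subst (+ 3 ∣_) ψ₀ d)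
        Ψ = flow-difference {λ e → + 2 * δ e₀ e} {π} (λ v → trans (∂-* (+ 2) (δ e₀) v) (sym (eq v)))
    good-pair ψ e₀ e₀ good Ψ
      (λ e ∉ → cong₂ (λ a b → + 2 * a + - 1ℤ * b) (δ-≢ (λ p → ∉ (inj₂ (inj₁ (sym p))))) (supp e (∉ ∘ inj₁)))
      e₀∉ e₀∉ ∤ ∤ g G
    where
    zeros : ∀ (a b : ℤ) → 0ℤ * a + 0ℤ * b ≡ 0ℤ
    zeros = solve-∀

  good-all : ∀ {W X h} → (∀ e β → W (head e β) ≡ true) → Good X h → Link W X → ¬ ¬ Good (λ _ → ⊤) h
  good-all {W} {X₀} {h} ends good₀ link₀ = do
    (X , good , _ , all) ← go m id X₀ good₀ link₀
    return (λ g G → do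
      (g′ , G′ , off , cov) ← good g G
      return (g′ , G′ , (λ e ∉ → contradiction tt ∉) , λ e _ → cov e (all e)))
    where
    go : ∀ k (emb : Fin k → Fin m) X → Good X h → Link W X →
      ¬ ¬ (∃ λ X′ → Good X′ h × (∀ e → X e → X′ e) × (∀ i → X′ (emb i)))
    go zero emb X good link = return (X , good , (λ _ → id) , λ ())
    go (suc k) emb X good link = do
      no ∉ ← em (X (emb zero))
        where yes x → do
                (X′ , good′ , sub , all) ← go k (emb ∘ suc) X good link
                return (X′ , good′ , sub , λ { zero → sub _ x ; (suc i) → all i })
      (X′ , good′ , sub , all) ← go k (emb ∘ suc) (λ e → X e ⊎ (e ≡ emb zero ⊎ e ≡ emb zero))
        (good-edge (emb zero) (ends (emb zero)) good link ∉) (link-mono (λ _ → inj₁) link)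
      return (X′ , good′ , (λ e x → sub e (inj₁ x)) , λ { zero → sub _ (inj₂ (inj₁ refl)) ; (suc i) → all i })

  nowhere-zero-mod-6 : ∀ {h} → Flow h → Good (λ _ → ⊤) h → ¬ ¬ (∃ λ F → Flow F × (∀ e → ¬ (+ 6 ∣ F e)))
  nowhere-zero-mod-6 {h} H good = do
    (g , G , _ , cov) ← good (λ _ → 0ℤ) ∂-zero
    return ((λ e → + 3 * h e + + 2 * g e) ,
      (λ v → trans (∂-lin (λ e → + 3 * h e) (+ 2) g v) (cong₂ (λ a b → a + + 2 * b)
          (trans (∂-* (+ 3) h v) (cong (+ 3 *_) (H v))) (G v))) ,
      λ e d → [ (λ odd → odd (even (h e) (g e) d)) , (λ ∤ → ∤ (triple (h e) (g e) d)) ]′ (cov e tt))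
    where
    even : ∀ x y → + 6 ∣ + 3 * x + + 2 * y → + 2 ∣ x
    even x y (divides q eq) = divides (+ 3 * q - x - y) (trans (re₁ x y)
        (trans (cong (λ z → z - + 2 * x - + 2 * y) eq) (re₂ q x y)))
      where
      re₁ : ∀ (x y : ℤ) → x ≡ (+ 3 * x + + 2 * y) - + 2 * x - + 2 * y
      re₁ = solve-∀
      re₂ : ∀ (q x y : ℤ) → q * + 6 - + 2 * x - + 2 * y ≡ (+ 3 * q - x - y) * + 2
      re₂ = solve-∀
    triple : ∀ x y → + 6 ∣ + 3 * x + + 2 * y → + 3 ∣ y
    triple x y (divides q eq) = divides (x + y - + 2 * q) (trans (re₁ x y)
        (trans (cong (λ z → + 3 * x + + 3 * y - z) eq) (re₂ q x y)))
      where
      re₁ : ∀ (x y : ℤ) → y ≡ + 3 * x + + 3 * y - (+ 3 * x + + 2 * y)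
      re₁ = solve-∀
      re₂ : ∀ (q x y : ℤ) → + 3 * x + + 3 * y - q * + 6 ≡ (x + y - + 2 * q) * + 3
      re₂ = solve-∀

-- Seymour's growing argument

∧-elim : ∀ {a b} → a ∧ b ≡ true → a ≡ true × b ≡ true
∧-elim {true} h = refl , h

∧-intro : ∀ {a b} → a ≡ true → b ≡ true → a ∧ b ≡ true
∧-intro refl refl = refl

bool-cases : ∀ b → b ≡ true ⊎ b ≡ false
bool-cases true  = inj₁ refl
bool-cases false = inj₂ refl

-- `K` holds the vertices surviving contraction. In `no-small-cut` the edges `e` and `e′` may
-- coincide and need not cross, so cuts of one edge are excluded as well.
module Growing {n m : ℕ} (S : SG n m) (K : Fin n → Bool)
  (ends : ∀ e β → K (SG.head S e β) ≡ true)
  (conn : ∀ Y p q → K p ≡ true → K q ≡ true → Y p ≡ true → Y q ≡ false → ¬ ¬ (∃ λ e → Core.Crossing S Y e))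
  (no-small-cut : ∀ Y p q → K p ≡ true → K q ≡ true → Y p ≡ true → Y q ≡ false →
    ∀ e e′ → ¬ (∀ e₂ → Core.Crossing S Y e₂ → e₂ ≡ e ⊎ e₂ ≡ e′))
  where
  open Core S
  open Covering S
  open Trails S
  open Switching S

  -- By `outside` any region disjoint from `W` is balanced, so that trails in it with common ends
  -- have equal signs and growth proceeds as in an ordinary graph.
  record State : Set₁ where
    field
      W       : Fin n → Bool
      X       : Fin m → Set
      h       : Fin m → ℤ
      flow    : Flow h
      supp    : Supp X h
      good    : Good X h
      link    : Link W X
      inside  : ∀ e → X e → Inside W e
      root    : Fin n
      root∈   : W root ≡ true
      W⊆K     : ∀ v → W v ≡ true → K v ≡ true
      outside : ∀ Y → (∀ v → Y v ≡ true → W v ≡ false) → ¬ ¬ Bal Y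

  -- `P` and `Q` together carry a flow because `Y` is balanced, and its values become the new odd
  -- part. The path through `a`, `P` and `b` has both ends in `W`; doubled and closed up by `Link`,
  -- it is the flow correcting `a` and `b`.
  module Attach (St : State) (Y : Fin n → Bool)
    (disj : ∀ v → Y v ≡ true → State.W St v ≡ false) (Y⊆K : ∀ v → Y v ≡ true → K v ≡ true) (bal : Bal Y)
    (a : Fin m) (α : Bool) (a∈Y : Y (head a α) ≡ true) (a∈W : State.W St (head a (not α)) ≡ true)
    (b : Fin m) (β : Bool) (b∈Y : Y (head b β) ≡ true) (b∈W : State.W St (head b (not β)) ≡ true) (a≢b : a ≢ b)
    (P Q : Walk (Inside Y) (head a α) (head b β)) (once : ∀ e → cnt P e ℕ.+ cnt Q e ℕ.≤ 1) where

    open State St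

    private
      x = head a α
      y = head b β
      w = head a (not α)
      w′ = head b (not β)

      C : Fin m → Set
      C e = cnt P e ℕ.+ cnt Q e ≢ 0

      C⇒Y : ∀ e → C e → Inside Y e
      C⇒Y e c with zero? (cnt P e)
      ... | inj₂ nz = cnt⇒A P e nz
      ... | inj₁ z with zero? (cnt Q e)
      ...   | inj₂ nz = cnt⇒A Q e nz
      ...   | inj₁ z′ = contradiction (cong₂ ℕ._+_ z z′) c

      C-disj : ∀ e → C e → ¬ X e
      C-disj e c xe = true≢false (inside e xe false) (disj _ (C⇒Y e c false))

      a∉C : ¬ C a
      a∉C c = true≢false a∈W (disj w (C⇒Y a c (not α)))
      b∉C : ¬ C b
      b∉C c = true≢false b∈W (disj w′ (C⇒Y b c (not β)))
      a∉X : ¬ X a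
      a∉X xa = true≢false (inside a xa α) (disj x a∈Y)
      b∉X : ¬ X b
      b∉X xb = true≢false (inside b xb β) (disj y b∈Y)

      X₁ X′ : Fin m → Set
      X₁ e = X e ⊎ C e
      X′ e = X₁ e ⊎ (e ≡ a ⊎ e ≡ b)

      h₁ : Fin m → ℤ
      h₁ e = χ P e + - 1ℤ * χ Q e

      χP-zero : ∀ e → ¬ C e → χ P e ≡ 0ℤ
      χP-zero e ¬c = χ-zero P e (ℕₚ.m+n≡0⇒m≡0 (cnt P e) (≢0-stable ¬c))

      h₁-supp : Supp C h₁
      h₁-supp = χ-difference-supp P Q

      h₁-flow : Flow h₁
      h₁-flow = flow-difference {χ P} {χ Q} (λ v → trans (∂χ P v)
          (trans (cong (λ s → δ x v - sgn s * δ y v) same) (sym (∂χ Q v))))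
        where
        same : wsg P ≡ wsg Q
        same = trans (balanced-sign (proj₁ bal) (proj₂ bal) P) (sym (balanced-sign (proj₁ bal) (proj₂ bal) Q))

      h₁-odd : ∀ e → C e → ¬ (+ 2 ∣ h₁ e)
      h₁-odd e c = χ-difference-odd P Q e (once e) c

      good₁ : Good X₁ (λ e → h e + h₁ e)
      good₁ = good-odd h₁ C good supp h₁-supp C-disj h₁-odd

      ta = t a α
      sb = sgn (wsg P) * t b β
      -- The coefficients of `a` and `b` are those that cancel the boundary of `χ P` at its two
      -- ends.
      g : Fin m → ℤ
      g e = (χ P e + - ta * δ a e) + sb * δ b e

      ∂g : ∀ v → ∂ g v ≡ - (ta * t a (not α)) * δ w v + (sb * t b (not β)) * δ w′ v
      ∂g v = begin
        ∂ g v ≡⟨ ∂-lin (λ e → χ P e + - ta * δ a e) sb (δ b) v ⟩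
        ∂ (λ e → χ P e + - ta * δ a e) v + sb * ∂ (δ b) v
          ≡⟨ cong₂ (λ p q → p + sb * q) (∂-lin (χ P) (- ta) (δ a) v) (trans (∂-δ b v) (inc-β b β v)) ⟩
        (∂ (χ P) v + - ta * ∂ (δ a) v) + sb * (δ y v * t b β + δ w′ v * t b (not β))
          ≡⟨ cong₂ (λ p q → (p + - ta * q) + sb * (δ y v * t b β + δ w′ v * t b (not β))) (∂χ P v)
              (trans (∂-δ a v) (inc-β a α v)) ⟩
        ((δ x v - sP * δ y v) + - ta * (δ x v * ta + δ w v * t a (not α))) + (sP * t b β) *
            (δ y v * t b β + δ w′ v * t b (not β))
          ≡⟨ calc (δ x v) (δ y v) (δ w v) (δ w′ v) ta (t a (not α)) (t b β) (t b (not β)) sP ⟩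
        (- (ta * t a (not α)) * δ w v + (sP * t b β * t b (not β)) * δ w′ v) + (1ℤ - ta * ta) * δ x v + sP *
            (t b β * t b β - 1ℤ) * δ y v
          ≡⟨ cong₂ (λ p q → (- (ta * t a (not α)) * δ w v + (sP * t b β * t b (not β)) * δ w′ v) +
              (1ℤ - p) * δ x v + sP * (q - 1ℤ) * δ y v) (sgn² (τ a α)) (sgn² (τ b β)) ⟩
        (- (ta * t a (not α)) * δ w v + (sP * t b β * t b (not β)) * δ w′ v) + 0ℤ * δ x v + sP * 0ℤ * δ y v
          ≡⟨ tidy (- (ta * t a (not α)) * δ w v + (sP * t b β * t b (not β)) * δ w′ v) (δ x v) sP (δ y v) ⟩
        - (ta * t a (not α)) * δ w v + (sb * t b (not β)) * δ w′ v ∎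
        where
        open ≡-Reasoning
        sP = sgn (wsg P)
        calc : ∀ (X Y W W′ p p′ q q′ s : ℤ) →
          ((X - s * Y) + - p * (X * p + W * p′)) + (s * q) * (Y * q + W′ * q′) ≡
          (- (p * p′) * W + (s * q * q′) * W′) + (1ℤ - p * p) * X + s * (q * q - 1ℤ) * Y
        calc = solve-∀
        tidy : ∀ (z X s Y : ℤ) → z + 0ℤ * X + s * 0ℤ * Y ≡ z
        tidy = solve-∀

      ∂g-supp : ∀ v → W v ≡ false → ∂ g v ≡ 0ℤ
      ∂g-supp v v∉ = trans (∂g v) (trans (cong₂ (λ p q → - (ta * t a (not α)) * p + (sb * t b (not β)) * q)
        (δ-≢ {i = w} (λ { refl → true≢false a∈W v∉ })) (δ-≢ {i = w′} (λ { refl → true≢false b∈W v∉ })))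
            (zeros (- (ta * t a (not α))) (sb * t b (not β))))
        where
        zeros : ∀ (p q : ℤ) → p * 0ℤ + q * 0ℤ ≡ 0ℤ
        zeros = solve-∀

      good₂ : Good X′ (λ e → h e + h₁ e)
      good₂ f F = do
        (π , π-supp , π-eq) ← link g ∂g-supp
        -- On `a` and `b`, where `π` vanishes, the values are 2 or -2.
        let ψ = λ e → + 2 * g e + - 1ℤ * π e
            Ψ = flow-difference {λ e → + 2 * g e} {π} (λ v → trans (∂-* (+ 2) g v) (sym (π-eq v)))
            ψa = trans (cong₂ (λ p q → + 2 * p + - 1ℤ * q) ga (π-supp a a∉X)) (ℤₚ.+-identityʳ (+ 2 * - ta))
            ψb = trans (cong₂ (λ p q → + 2 * p + - 1ℤ * q) gb (π-supp b b∉X)) (ℤₚ.+-identityʳ (+ 2 * sb))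
        good-pair ψ a b good₁ Ψ
          (λ e ∉ → cong₂ (λ p q → + 2 * p + - 1ℤ * q) (g-supp e ∉) (π-supp e (λ xe → ∉ (inj₁ (inj₁ xe)))))
          [ a∉X , a∉C ]′ [ b∉X , b∉C ]′
          (λ d → unit-∤3′ (unit-neg (sgn-unit (τ a α))) (subst (+ 3 ∣_) ψa d))
          (λ d → unit-∤3′ (unit-* (sgn-unit (wsg P)) (sgn-unit (τ b β))) (subst (+ 3 ∣_) ψb d)) f F
        where
        at : ∀ (p q : ℤ) → (0ℤ + p * 1ℤ) + q * 0ℤ ≡ p
        at = solve-∀
        at′ : ∀ (p q : ℤ) → (0ℤ + p * 0ℤ) + q * 1ℤ ≡ q
        at′ = solve-∀
        at″ : ∀ (p q : ℤ) → (0ℤ + p * 0ℤ) + q * 0ℤ ≡ 0ℤ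
        at″ = solve-∀
        ga : g a ≡ - ta
        ga = trans (cong₂ (λ p q → (χ P a + - ta * p) + sb * q) (δ-refl a) (δ-≢ (a≢b ∘ sym)))
            (trans (cong (λ p → (p + - ta * 1ℤ) + sb * 0ℤ) (χP-zero a a∉C)) (at (- ta) sb))
        gb : g b ≡ sb
        gb = trans (cong₂ (λ p q → (χ P b + - ta * p) + sb * q) (δ-≢ a≢b) (δ-refl b))
            (trans (cong (λ p → (p + - ta * 0ℤ) + sb * 1ℤ) (χP-zero b b∉C)) (at′ (- ta) sb))
        g-supp : ∀ e → ¬ X′ e → g e ≡ 0ℤ
        g-supp e ∉ = trans (cong₂ (λ p q → (χ P e + - ta * p) + sb * q)
            (δ-≢ (λ p → ∉ (inj₂ (inj₁ (sym p))))) (δ-≢ (λ p → ∉ (inj₂ (inj₂ (sym p))))))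
          (trans (cong (λ p → (p + - ta * 0ℤ) + sb * 0ℤ) (χP-zero e (λ c → ∉ (inj₁ (inj₂ c))))) (at″ (- ta) sb))

      W′ : Fin n → Bool
      W′ v = W v ∨ (onBool P v ∨ onBool Q v)

      anchor-on : ∀ (R : Walk (Inside Y) x y) → (∀ e → cnt R e ≢ 0 → C e) → ∀ p → On p R → Anchor W W′ X′ p
      anchor-on R R⊆C p o = anchor {W′ = W′} p (λ e → χ pre e + - ta * δ a e) (wsg pre) w
          (- (ta * t a (not α))) supp′ eq a∈W
        where
        open Split (split R p o)
        supp′ : Supp X′ (λ e → χ pre e + - ta * δ a e)
        supp′ e ∉ = trans (cong₂ (λ p q → p + - ta * q) (χ-zero pre e
            (part (cnt≡ e) (≢0-stable (λ nz → ∉ (inj₁ (inj₂ (R⊆C e nz)))))))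
          (δ-≢ (λ q → ∉ (inj₂ (inj₁ (sym q)))))) (trans (ℤₚ.+-identityˡ (- ta * 0ℤ)) (ℤₚ.*-zeroʳ (- ta)))
        eq : ∀ v → ∂ (λ e → χ pre e + - ta * δ a e) v ≡ - (ta * t a (not α)) * δ w v - sgn (wsg pre) * δ p v
        eq v = trans (∂-lin (χ pre) (- ta) (δ a) v) (trans (cong₂ (λ p q → p + - ta * q) (∂χ pre v)
            (trans (∂-δ a v) (inc-β a α v)))
          (trans (calc (δ x v) (sgn (wsg pre) * δ p v) ta (δ w v) (t a (not α)))
            (trans (cong (λ z → (- (ta * t a (not α)) * δ w v - sgn (wsg pre) * δ p v) + (1ℤ - z) * δ x v)
                (sgn² (τ a α)))
                   (tidy (- (ta * t a (not α)) * δ w v - sgn (wsg pre) * δ p v) (δ x v)))))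
          where
          calc : ∀ (X z p W p′ : ℤ) → (X - z) + - p * (X * p + W * p′) ≡ (- (p * p′) * W - z) + (1ℤ - p * p) * X
          calc = solve-∀
          tidy : ∀ (z X : ℤ) → z + 0ℤ * X ≡ z
          tidy = solve-∀

      anchors : ∀ p → Anchor W W′ X′ p
      anchors p with bool-cases (W′ p)
      ... | inj₂ p∉ = anchor-old {W′ = W′} (inj₂ p∉)
      ... | inj₁ p∈ with ∨-elim {W p} p∈
      ...   | inj₁ old = anchor-old {W′ = W′} (inj₁ old)
      ...   | inj₂ new with ∨-elim {onBool P p} new
      ...     | inj₁ o = anchor-on P (λ e nz z → nz (ℕₚ.m+n≡0⇒m≡0 (cnt P e) z)) p (onBool-sound P p o)
      ...     | inj₂ o = anchor-on Q (λ e nz z → nz (ℕₚ.m+n≡0⇒n≡0 (cnt P e) z)) p (onBool-sound Q p o)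

      grown : ∀ v → W v ≡ true → W′ v ≡ true
      grown v v∈ = ∨-intro (inj₁ v∈)

      on-Y : ∀ {A B} (R : Walk (Inside Y) A B) → Y A ≡ true → ∀ v → On v R → Y v ≡ true
      on-Y nil A∈ v refl = A∈
      on-Y (cons e γ i p q R) A∈ v (inj₁ refl) = A∈
      on-Y (cons e γ i p refl R) A∈ v (inj₂ o) = on-Y R (i (not γ)) v o

      C⇒W′ : ∀ e → C e → Inside W′ e
      C⇒W′ e c γ with zero? (cnt P e)
      ... | inj₂ nz = ∨-intro {W (head e γ)} (inj₂ (∨-intro (inj₁ (onBool-compl P _ (cnt⇒On P e nz γ)))))
      ... | inj₁ z with zero? (cnt Q e)
      ...   | inj₂ nz = ∨-intro {W (head e γ)} (inj₂ (∨-intro {onBool P (head e γ)}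
          (inj₂ (onBool-compl Q _ (cnt⇒On Q e nz γ)))))
      ...   | inj₁ z′ = contradiction (cong₂ ℕ._+_ z z′) c

      x∈′ : W′ x ≡ true
      x∈′ = ∨-intro {W x} (inj₂ (∨-intro (inj₁ (onBool-compl P x (on-start P)))))
      y∈′ : W′ y ≡ true
      y∈′ = ∨-intro {W y} (inj₂ (∨-intro (inj₁ (onBool-compl P y (on-end P)))))

      ends-of : ∀ e γ → W′ (head e γ) ≡ true → W (head e (not γ)) ≡ true → Inside W′ e
      ends-of e false p q false = p
      ends-of e false p q true  = grown _ q
      ends-of e true  p q true  = p
      ends-of e true  p q false = grown _ q

    attached : State
    attached = record
      { W = W′ ; X = X′ ; h = λ e → h e + h₁ e
      ; flow = flow-+ flow h₁-flow
      ; supp = λ e ∉ → cong₂ _+_ (supp e (λ xe → ∉ (inj₁ (inj₁ xe)))) (h₁-supp e (λ c → ∉ (inj₁ (inj₂ c))))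
      ; good = good₂
      ; link = link-extend (λ e xe → inj₁ (inj₁ xe)) anchors link
      ; inside = λ { e (inj₁ (inj₁ xe)) γ → grown _ (inside e xe γ)
                   ; e (inj₁ (inj₂ c)) γ → C⇒W′ e c γ
                   ; e (inj₂ (inj₁ refl)) γ → ends-of a α x∈′ a∈W γ
                   ; e (inj₂ (inj₂ refl)) γ → ends-of b β y∈′ b∈W γ }
      ; root = root ; root∈ = grown root root∈
      ; W⊆K = λ v v∈ → [ W⊆K v , (λ o → Y⊆K v ([ (λ o′ → on-Y P a∈Y v (onBool-sound P v o′)) ,
          (λ o′ → on-Y Q a∈Y v (onBool-sound Q v o′)) ]′ (∨-elim {onBool P v} o))) ]′ (∨-elim {W v} v∈)
      ; outside = λ Y₁ d → outside Y₁ (λ v v∈ → ¬true (λ v∈W → true≢false (grown v v∈W) (d v v∈))) }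

    attached-grows : (∀ v → W v ≡ true → State.W attached v ≡ true) × State.W attached x ≡ true
    attached-grows = grown , x∈′

  Out : (W Y : Fin n → Bool) → Fin m → Set
  Out W Y e = ∃ λ β → Y (head e β) ≡ true × Y (head e (not β)) ≡ false × W (head e (not β)) ≡ false

  Toward : (W Y : Fin n → Bool) → Fin m → Set
  Toward W Y e = ∃ λ β → Y (head e β) ≡ true × W (head e (not β)) ≡ true

  record Region (W : Fin n → Bool) : Set where
    field
      Y     : Fin n → Bool
      p     : Fin n
      p∈    : Y p ≡ true
      off-W : ∀ v → Y v ≡ true → W v ≡ false
      Y⊆K   : ∀ v → Y v ≡ true → K v ≡ true
      one   : ∀ e e′ → Out W Y e → Out W Y e′ → e ≡ e′

  Grown : State → Set₁
  Grown St = ∃ λ St′ → (∀ v → State.W St v ≡ true → State.W St′ v ≡ true) ×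
    (∃ λ v → State.W St v ≡ false × State.W St′ v ≡ true)

  -- A smallest region with at most one edge to the rest of the outside is bridgeless,
  -- and by 3-edge-connectivity it has two edges to W.
  grow : (St : State) → ∀ q → K q ≡ true → State.W St q ≡ false → ¬ ¬ Grown St
  grow St q q∈K q∉W k = descent (λ R → count (Region.Y R)) {⊥}
      (λ R smaller → return (step R (λ R′ lt → smaller R′ lt id))) start id
    where
    open State St
    -- All edges end in `K`, so the complement of `W` in `K` has no `Out` edge at all.
    start : Region W
    start = record
      { Y = λ v → K v ∧ not (W v) ; p = q ; p∈ = ∧-intro q∈K (not-true q∉W)
      ; off-W = λ v h → not-true⁻ (proj₂ (∧-elim {K v} h)) ; Y⊆K = λ v h → proj₁ (∧-elim {K v} h)
      ; one = λ { e _ (β , _ , out , w) _ → ⊥-elim (true≢false (∧-intro (ends e (not β)) (not-true w)) out) } }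

    step : (R : Region W) → ((R′ : Region W) → count (Region.Y R′) ℕ.< count (Region.Y R) → ⊥) → ⊥
    step R smaller = two-edges (λ { (a , b , (α , a∈Y , a∈W) , (β , b∈Y , b∈W) , a≢b) →
      absurd¬¬ (do
        bal ← outside Y off-W
        Bridgeless.pair P Q once ← Bridgeless.two-trails (Inside Y) (λ v → Y v ≡ true) (λ _ → id)
          (λ p q p∈ q∈ → do
            w ← bridgeless a p q p∈ q∈
            return (wmap (λ _ → proj₁) w))
          bridgeless a∈Y b∈Y
        let module At = Attach St Y off-W Y⊆K bal a α a∈Y a∈W b β b∈Y b∈W a≢b P Q once
        λ _ → k (At.attached , proj₁ At.attached-grows , _ , off-W _ a∈Y , proj₂ At.attached-grows)) })
      where
      open Region R

      -- If `e` separated `Y`, neither part would be a region, so each part would have an `Out` edge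
      -- other than `e`. Both edges leave `Y` and coincide by `one`, but a single edge cannot start
      -- in both parts and end outside `Y`.
      bridgeless : ∀ e p q → Y p ≡ true → Y q ≡ true → ¬ ¬ Walk (λ e′ → Inside Y e′ × e ≢ e′) p q
      bridgeless e p q p∈ q∈ no-walk = absurd¬¬ (do
        reach ← setOf (λ v → Walk (λ e′ → Inside Y e′ × e ≢ e′) p v)
        let Y₁ = λ v → Y v ∧ SetOf.mem reach v
            Y₂ = λ v → Y v ∧ not (SetOf.mem reach v)
            q∉ = ¬true (λ h → no-walk (SetOf.sound reach q h))
            p∈₁ = SetOf.compl reach p nil
            between : ∀ e₁ β → Y₁ (head e₁ β) ≡ true → Y₂ (head e₁ (not β)) ≡ true → e ≡ e₁
            between = λ e₁ β h₁ h₂ → decidable-stable (e ≟ e₁) (λ e≢ →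
              true≢false (SetOf.compl reach _ (SetOf.sound reach _ (proj₂ (∧-elim {Y (head e₁ β)} h₁)) ++
                edge e₁ β ((λ { γ → both e₁ β γ (proj₁ (∧-elim {Y (head e₁ β)} h₁))
                    (proj₁ (∧-elim {Y (head e₁ (not β))} h₂)) }) , e≢) refl refl))
                (not-true⁻ (proj₂ (∧-elim {Y (head e₁ (not β))} h₂))))
        yes (e₁ , e₁′ , o₁ , o₁′ , ne₁) ← em (∃₂ λ e e′ → Out W Y₁ e × Out W Y₁ e′ × e ≢ e′)
          where no one₁ → λ _ → smaller (sub-region Y₁ p (∧-intro p∈ p∈₁) (λ v h → proj₁ (∧-elim {Y v} h)) one₁)
                                 (count-< Y₁ Y (λ v h → proj₁ (∧-elim {Y v} h)) q (∧-false (Y q) q∉) q∈)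
        yes (e₂ , e₂′ , o₂ , o₂′ , ne₂) ← em (∃₂ λ e e′ → Out W Y₂ e × Out W Y₂ e′ × e ≢ e′)
          where no one₂ → λ _ → smaller (sub-region Y₂ q (∧-intro q∈ (not-true q∉))
                    (λ v h → proj₁ (∧-elim {Y v} h)) one₂)
                                 (count-< Y₂ Y (λ v h → proj₁ (∧-elim {Y v} h)) p (∧-false (Y p) (cong not p∈₁)) p∈)
        λ _ → clash Y₁ Y₂
          (λ v h → proj₁ (∧-elim {Y v} h)) (λ v h → proj₁ (∧-elim {Y v} h))
          (λ v h₁ h₂ → true≢false (proj₂ (∧-elim {Y v} h₁)) (not-true⁻ (proj₂ (∧-elim {Y v} h₂))))
          (other-out Y₁ e (λ v h → proj₁ (∧-elim {Y v} h)) (λ e′ β h y n → between e′ β h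
              (∧-intro y (not-true (and-false y n)))) e₁ e₁′ o₁ o₁′ ne₁)
          (other-out Y₂ e (λ v h → proj₁ (∧-elim {Y v} h)) (λ e′ β h y n → between e′ (not β)
              (∧-intro y (not-false (and-false y n)))
             (subst (λ c → Y₂ (head e′ c) ≡ true) (sym (Boolₚ.not-involutive β)) h)) e₂ e₂′ o₂ o₂′ ne₂))
        where
        ∧-false : ∀ b {c} → c ≡ false → b ∧ c ≡ false
        ∧-false true  h = h
        ∧-false false h = refl
        and-false : ∀ {b c} → b ≡ true → b ∧ c ≡ false → c ≡ false
        and-false refl h = h
        not-false : ∀ {c} → not c ≡ false → c ≡ true
        not-false {true} _ = refl
        both : ∀ e₁ β γ → Y (head e₁ β) ≡ true → Y (head e₁ (not β)) ≡ true → Y (head e₁ γ) ≡ true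
        both e₁ false false h h′ = h
        both e₁ false true  h h′ = h′
        both e₁ true  true  h h′ = h
        both e₁ true  false h h′ = h′
        sub-region : ∀ Y′ v → Y′ v ≡ true → (∀ v → Y′ v ≡ true → Y v ≡ true) →
          ¬ (∃₂ λ e e′ → Out W Y′ e × Out W Y′ e′ × e ≢ e′) → Region W
        sub-region Y′ v v∈ sub none = record
          { Y = Y′ ; p = v ; p∈ = v∈ ; off-W = λ v h → off-W v (sub v h) ; Y⊆K = λ v h → Y⊆K v (sub v h)
          ; one = λ e e′ o o′ → decidable-stable (e ≟ e′) (λ ne → none (e , e′ , o , o′ , ne)) }
        -- Of two distinct edges leaving Y′ one differs from e, and it leaves Y.
        other-out : (Y′ : Fin n → Bool) (e : Fin m) → (∀ v → Y′ v ≡ true → Y v ≡ true) →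
          (∀ e′ β → Y′ (head e′ β) ≡ true → Y (head e′ (not β)) ≡ true → Y′ (head e′ (not β)) ≡ false → e ≡ e′) →
          ∀ e₁ e₂ → Out W Y′ e₁ → Out W Y′ e₂ → e₁ ≢ e₂ →
          ∃ λ o → ∃ λ β → Y′ (head o β) ≡ true × Y (head o (not β)) ≡ false × W (head o (not β)) ≡ false
        other-out Y′ e sub btw e₁ e₂ (β₁ , i₁ , x₁ , w₁) (β₂ , i₂ , x₂ , w₂) ne with e ≟ e₁
        ... | no e≢e₁ = e₁ , β₁ , i₁ , ¬true (λ y → e≢e₁ (btw e₁ β₁ i₁ y x₁)) , w₁
        ... | yes refl = e₂ , β₂ , i₂ , ¬true (λ y → ne (btw e₂ β₂ i₂ y x₂)) , w₂
        clash : (Y₁ Y₂ : Fin n → Bool) → (∀ v → Y₁ v ≡ true → Y v ≡ true) → (∀ v → Y₂ v ≡ true → Y v ≡ true) →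
          (∀ v → Y₁ v ≡ true → Y₂ v ≡ true → ⊥) →
          (∃ λ o → ∃ λ β → Y₁ (head o β) ≡ true × Y (head o (not β)) ≡ false × W (head o (not β)) ≡ false) →
          (∃ λ o → ∃ λ β → Y₂ (head o β) ≡ true × Y (head o (not β)) ≡ false × W (head o (not β)) ≡ false) → ⊥
        clash Y₁ Y₂ s₁ s₂ dis (o₁ , β₁ , i₁ , x₁ , w₁) (o₂ , β₂ , i₂ , x₂ , w₂)
          with one o₁ o₂ (β₁ , s₁ _ i₁ , x₁ , w₁) (β₂ , s₂ _ i₂ , x₂ , w₂)
        ... | refl with β₁ Boolₚ.≟ β₂
        ...   | yes refl = dis _ i₁ i₂
        ...   | no ne = true≢false (s₁ _ (subst (λ c → Y₁ (head o₁ c) ≡ true) (Boolₚ.¬-not ne) i₁)) x₂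

      -- With at most one edge to `W` and at most one to the remaining outside, `Y` would be cut off
      -- by at most two edges.
      two-edges : ((∃₂ λ a b → Toward W Y a × Toward W Y b × a ≢ b) → ⊥) → ⊥
      two-edges found = absurd¬¬ (do
        (e₀ , _) ← conn Y p root (Y⊆K p p∈) (W⊆K root root∈) p∈ root∉
        da ← em (∃ λ a → Toward W Y a)
        dc ← em (∃ λ c → Out W Y c)
        λ _ → small e₀ da dc)
        where
        root∉ : Y root ≡ false
        root∉ = ¬true (λ h → true≢false root∈ (off-W root h))
        rest : ∀ e → Crossing Y e → Toward W Y e ⊎ Out W Y e
        rest e (β , i , x) with bool-cases (W (head e (not β)))
        ... | inj₁ w = inj₁ (β , i , w)
        ... | inj₂ w = inj₂ (β , i , x , w)
        same : ∀ a b → Toward W Y a → Toward W Y b → a ≡ b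
        same a b ta tb = decidable-stable (a ≟ b) (λ ne → found (a , b , ta , tb , ne))
        small : Fin m → Dec (∃ λ a → Toward W Y a) → Dec (∃ λ c → Out W Y c) → ⊥
        small e₀ da dc = no-small-cut Y p root (Y⊆K p p∈) (W⊆K root root∈) p∈ root∉ (pick da) (pick dc)
          (λ e c → [ (λ t → inj₁ (hit da t same)) , (λ o → inj₂ (hit dc o one)) ]′ (rest e c))
          where
          -- `e₀` stands in when there is no edge of the kind asked for.
          pick : {P : Fin m → Set} → Dec (∃ P) → Fin m
          pick (yes (e , _)) = e
          pick (no _) = e₀
          hit : {P : Fin m → Set} (d : Dec (∃ P)) → ∀ {e} → P e → (∀ a b → P a → P b → a ≡ b) → e ≡ pick d
          hit (yes (e′ , p′)) p same = same _ _ p p′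
          hit (no none) p same = contradiction (_ , p) none

  fill : State → ¬ ¬ (∃ λ F → Flow F × (∀ e → ¬ (+ 6 ∣ F e)))
  fill = descent (λ St → count (not ∘ State.W St)) step
    where
    step : ∀ St → ((St′ : State) → count (not ∘ State.W St′) ℕ.< count (not ∘ State.W St) →
      ¬ ¬ (∃ λ F → Flow F × (∀ e → ¬ (+ 6 ∣ F e)))) → ¬ ¬ (∃ λ F → Flow F × (∀ e → ¬ (+ 6 ∣ F e)))
    step St smaller = do
      no full ← em (∃ λ q → K q ≡ true × W q ≡ false)
        where yes (q , q∈ , q∉) → do
                (St′ , sub , v , v∉ , v∈) ← grow St q q∈ q∉
                smaller St′ (count-< _ _ (λ u u∉ → not-true
                    (¬true (λ u∈ → true≢false u∉ (cong not (sub u u∈))))) v (cong not v∈) (not-true v∉))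
      all ← good-all {W = W} (λ e β → decidable-stable (W (head e β) Boolₚ.≟ true)
          (λ ne → full (_ , ends e β , ¬true ne))) good link
      nowhere-zero-mod-6 flow all
      where open State St

  -- Initial states, from balanced and from unbalanced graphs

  module _ {A X : Fin m → Set} where

    confine : ∀ {x y} (w : Walk A x y) → (∀ e → cnt w e ≢ 0 → X e) → Walk X x y
    confine nil h = nil
    confine (cons e β a p q w) h = cons e β (h e (first e (cnt w e))) p q
        (confine w (λ e′ nz → h e′ (later e e′ nz)))
      where
      first : ∀ e k → δℕ e e ℕ.+ k ≢ 0
      first e k rewrite δℕ-refl e = λ ()
      later : ∀ e e′ {k} → k ≢ 0 → δℕ e e′ ℕ.+ k ≢ 0
      later e e′ nz h = nz (ℕₚ.m+n≡0⇒n≡0 (δℕ e e′) h)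

    cnt-confine : ∀ {x y} (w : Walk A x y) h e → cnt (confine w h) e ≡ cnt w e
    cnt-confine nil h e = refl
    cnt-confine (cons e′ β a p q w) h e = cong (δℕ e′ e ℕ.+_) (cnt-confine w _ e)

    wsg-confine : ∀ {x y} (w : Walk A x y) h → wsg (confine w h) ≡ wsg w
    wsg-confine nil h = refl
    wsg-confine (cons e β a p q w) h = cong (σ e ⊗_) (wsg-confine w _)

  χ-supp : ∀ {X x y} (w : Walk X x y) → Supp X (χ w)
  χ-supp w e e∉ = χ-zero w e (≢0-stable (λ nz → e∉ (cnt⇒A w e nz)))

  odd-closed : ∀ {X x} (c : Walk X x x) → wsg c ≡ neg → ∀ v → ∂ (χ c) v ≡ + 2 * δ x v
  odd-closed {x = x} c odd v = trans (∂χ c v) (trans (cong (λ s → δ x v - sgn s * δ x v) odd) (calc (δ x v)))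
    where
    calc : ∀ (d : ℤ) → d - - 1ℤ * d ≡ + 2 * d
    calc = solve-∀

  closed-unbalanced : ∀ {X x} O (c : Walk X x x) → wsg c ≡ neg → (∀ e → X e → Inside O e) → O x ≡ true → ¬ Bal O
  closed-unbalanced {x = x} O c odd ins x∈ = unbalanced-by O (χ c) x
    (λ e nz → ins e (cnt⇒A c e (λ z → nz (χ-zero c e z)))) x∈ (+ 2) (λ ()) (odd-closed c odd)

  nothing-good : Good (λ _ → ⊥) (λ _ → 0ℤ)
  nothing-good g G = return (g , G , (λ _ _ → refl) , λ _ ())

  module Starting (NB : ∀ O → ¬ (¬ Bal O × ¬ Bal (not ∘ O))) where

    bal-sub : ∀ {O Y} → (∀ v → Y v ≡ true → O v ≡ true) → Bal O → Bal Y
    bal-sub sub (s , b) = s , λ e i → b e (λ β → sub _ (i β))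

    -- The odd closed walk realizes boundary 2 at `x`, exactly the factor in `Link`; the link for
    -- the single vertex `x` is then extended along walks in `X`. Since the walk unbalances `W`, the
    -- complement of `W` is balanced.
    start-state : ∀ x W X h → Flow h → Supp X h → Good X h → (∀ e → X e → Inside W e) → W x ≡ true →
      (∀ v → W v ≡ true → K v ≡ true) → (c : Walk X x x) → wsg c ≡ neg →
      (∀ p → W p ≡ true → Walk X x p) → State
    start-state x W X h flow supp good ins x∈ W⊆K c odd reach = record
      { W = W ; X = X ; h = h ; flow = flow ; supp = supp ; good = good ; inside = ins ; root = x ; root∈ =
          x∈ ; W⊆K = W⊆K
      ; link = link-extend {W = W₀} (λ _ → id) anchors base
      ; outside = λ Y off no-bal → NB W (closed-unbalanced W c odd ins x∈ , λ b → no-bal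
          (bal-sub (λ v v∈ → not-true (off v v∈)) b)) }
      where
      W₀ = single x
      base : Link W₀ X
      base g G = return ((λ e → ∂ g x * χ c e) , (λ e ∉ → trans (cong (∂ g x *_) (χ-supp c e ∉))
          (ℤₚ.*-zeroʳ (∂ g x))) , eq)
        where
        calc : ∀ (a : ℤ) → a * (+ 2 * 1ℤ) ≡ + 2 * a
        calc = solve-∀
        eq : ∀ v → ∂ (λ e → ∂ g x * χ c e) v ≡ + 2 * ∂ g v
        eq v = trans (∂-* (∂ g x) (χ c) v) (trans (cong (∂ g x *_) (odd-closed c odd v)) main)
          where
          main : ∂ g x * (+ 2 * δ x v) ≡ + 2 * ∂ g v
          main with x ≟ v
          ... | yes refl = calc (∂ g x)
          ... | no ne = trans (ℤₚ.*-zeroʳ (∂ g x)) (sym (cong (+ 2 *_) (G v (single-≢ ne))))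
      anchors : ∀ p → Anchor W₀ W X p
      anchors p with bool-cases (W p)
      ... | inj₂ p∉ = anchor-old {W′ = W} (inj₂ p∉)
      ... | inj₁ p∈ = anchor {W′ = W} p (χ R) (wsg R) x 1ℤ (χ-supp R)
          (λ v → trans (∂χ R v) (cong (_- sgn (wsg R) * δ p v) (sym (ℤₚ.*-identityˡ (δ x v))))) (single-refl x)
        where R = reach p p∈

    -- In a balanced graph a boundary supported at one vertex vanishes, so a link exists with empty
    -- `X`.
    balanced-state : ∀ root → K root ≡ true → Bal (λ _ → true) → State
    balanced-state root root∈ (s , bal) = record
      { W = single root ; X = λ _ → ⊥ ; h = λ _ → 0ℤ ; flow = ∂-zero ; supp = λ _ _ → refl ; good = nothing-good
      ; link = λ g G → return ((λ _ → 0ℤ) , (λ _ _ → refl) , λ v → trans (∂-zero v)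
          (sym (cong (+ 2 *_) (closed g G v))))
      ; inside = λ _ () ; root = root ; root∈ = single-refl root
      ; W⊆K = λ v v∈ → subst (λ u → K u ≡ true) (single-≡ v∈) root∈
      ; outside = λ Y _ → return (s , λ e _ → bal e (λ _ → refl)) }
      where
      closed : ∀ g → (∀ v → single root v ≡ false → ∂ g v ≡ 0ℤ) → ∀ v → ∂ g v ≡ 0ℤ
      closed g G v with root ≟ v
      ... | no ne = G v (single-≢ ne)
      ... | yes refl = begin
        ∂ g root                              ≡⟨ sym (ℤₚ.*-identityˡ (∂ g root)) ⟩
        1ℤ * ∂ g root                         ≡⟨ cong (_* ∂ g root) (sym (sgn² (s root))) ⟩
        sgn (s root) * sgn (s root) * ∂ g root ≡⟨ ℤₚ.*-assoc (sgn (s root)) (sgn (s root)) (∂ g root) ⟩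
        sgn (s root) * (sgn (s root) * ∂ g root) ≡⟨ cong (sgn (s root) *_) total ⟩
        sgn (s root) * 0ℤ                     ≡⟨ ℤₚ.*-zeroʳ (sgn (s root)) ⟩
        0ℤ ∎
        where
        open ≡-Reasoning
        total : sgn (s root) * ∂ g root ≡ 0ℤ
        total = trans (sym (sum-single n root (λ v → sgn (s v) * ∂ g v)
                  (λ v ne → trans (cong (sgn (s v) *_) (G v (single-≢ (ne ∘ sym)))) (ℤₚ.*-zeroʳ (sgn (s v))))))
          (trans (double-counting (sgn ∘ s) g) (sum-zero m (λ e → cong (_* g e) (bal e (λ _ → refl)))))

    module Frustrated (s : Fin n → Sign) (minimal : ∀ s′ → count (bad s) ℕ.≤ count (bad s′)) where

      H : Fin m → Set
      H e = bad s e ≡ false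

      -- Otherwise switching Y would leave fewer bad edges.
      one-bad : ∀ Y e → (∀ e₁ → Crossing Y e₁ → H e₁ → e ≡ e₁) →
        ∀ z z′ → Crossing Y z → Crossing Y z′ → bad s z ≡ true → bad s z′ ≡ true → z ≢ z′ → ⊥
      one-bad Y e only z z′ cz cz′ bz bz′ z≢z′ = ℕₚ.<⇒≱ lt (minimal (switch Y s))
        where
        s′ = switch Y s
        -- After switching, `z` and `z′` are no longer bad and at most `e` has become bad; the
        -- inequality is summed over all edges.
        pointwise : ∀ x → bit (bad s′ x) ℕ.+ (δℕ z x ℕ.+ δℕ z′ x) ℕ.≤ bit (bad s x) ℕ.+ δℕ e x
        pointwise x with z ≟ x | z′ ≟ x
        ... | yes refl | yes refl = contradiction refl z≢z′
        ... | yes refl | no _ rewrite bad-switch Y s z | crossing-xor Y z cz | bz = s≤s z≤n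
        ... | no _ | yes refl rewrite bad-switch Y s z′ | crossing-xor Y z′ cz′ | bz′ = s≤s z≤n
        ... | no _ | no _ rewrite bad-switch Y s x | ℕₚ.+-identityʳ
            (bit (if Y (head x false) xor Y (head x true) then not (bad s x) else bad s x))
            with Y (head x false) xor Y (head x true) in cr | bad s x in bx
        ...   | false | b = ℕₚ.m≤m+n (bit b) _
        ...   | true | true = z≤n
        ...   | true | false with only x (xor-crossing Y x cr) bx
        ...     | refl rewrite δℕ-refl e = s≤s z≤n
        total : count (bad s′) ℕ.+ 2 ℕ.≤ count (bad s) ℕ.+ 1
        total = subst₂ ℕ._≤_
          (trans (sumℕ-+ m _ _) (cong (count (bad s′) ℕ.+_)
              (trans (sumℕ-+ m _ _) (cong₂ ℕ._+_ (sumℕ-δ m z) (sumℕ-δ m z′)))))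
          (trans (sumℕ-+ m _ _) (cong (count (bad s) ℕ.+_) (sumℕ-δ m e)))
          (sumℕ-mono m pointwise)
        lt : count (bad s′) ℕ.< count (bad s)
        lt = ℕₚ.+-cancelʳ-≤ 1 _ _ (subst (ℕ._≤ count (bad s) ℕ.+ 1) (ℕₚ.+-suc (count (bad s′)) 1) total)

      -- The vertices reached without `e` have `e` as their only possible good crossing edge, and by
      -- `one-bad` at most one bad one; together these contradict `no-small-cut`.
      bridgeless : ∀ e p q → K p ≡ true → K q ≡ true → ¬ ¬ Walk (λ e′ → H e′ × e ≢ e′) p q
      bridgeless e p q p∈ q∈ no-walk = absurd¬¬ (do
        reach ← setOf (λ v → Walk (λ e′ → H e′ × e ≢ e′) p v)
        let Y = SetOf.mem reach
            q∉ = ¬true (λ h → no-walk (SetOf.sound reach q h))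
            only = λ e₁ (c : Crossing Y e₁) h → decidable-stable (e ≟ e₁) (λ ne → true≢false
              (SetOf.compl reach _ (SetOf.sound reach _ (proj₁ (proj₂ c)) ++ edge e₁ (proj₁ c)
                  (h , ne) refl refl)) (proj₂ (proj₂ c)))
        no single ← em (∃₂ λ z z′ → (Crossing Y z × bad s z ≡ true) × (Crossing Y z′ × bad s z′ ≡ true) × z ≢ z′)
          where yes (z , z′ , (cz , bz) , (cz′ , bz′) , ne) → λ _ → one-bad Y e only z z′ cz cz′ bz bz′ ne
        d ← em (∃ λ z → Crossing Y z × bad s z ≡ true)
        λ _ → no-small-cut Y p q p∈ q∈ (SetOf.compl reach p nil) q∉ e (pick d)
            (λ e₂ c → classify {Y} e₂ c only d single))
        where
        pick : {P : Fin m → Set} → Dec (∃ P) → Fin m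
        pick (yes (z , _)) = z
        pick (no _) = e
        classify : ∀ {Y} e₂ → Crossing Y e₂ → (∀ e₁ → Crossing Y e₁ → H e₁ → e ≡ e₁) →
          (d : Dec (∃ λ z → Crossing Y z × bad s z ≡ true)) →
          ¬ (∃₂ λ z z′ → (Crossing Y z × bad s z ≡ true) × (Crossing Y z′ × bad s z′ ≡ true) × z ≢ z′) →
              e₂ ≡ e ⊎ e₂ ≡ pick d
        classify e₂ c only d single with bool-cases (bad s e₂)
        ... | inj₂ h = inj₁ (sym (only e₂ c h))
        classify e₂ c only (no none) single | inj₁ b = contradiction (e₂ , c , b) none
        classify e₂ c only (yes (z , cz , bz)) single | inj₁ b =
          inj₂ (decidable-stable (e₂ ≟ z) (λ ne → single (e₂ , z , (c , b) , (cz , bz) , ne)))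

      -- Pairing a flow with `s` leaves only the bad edges; if there were just one, the flow would
      -- vanish on it.
      two-bad : (∃ λ g → Flow g × (∀ e → g e ≢ 0ℤ)) → ¬ Bal (λ _ → true) →
        ¬ ¬ (∃₂ λ z z′ → bad s z ≡ true × bad s z′ ≡ true × z ≢ z′)
      two-bad (g , G , g≢0) unbalanced k = absurd¬¬ (do
        yes (z , bz) ← em (∃ λ z → bad s z ≡ true)
          where no none → λ _ → unbalanced (s , λ e _ → not-bad s e (¬true (λ b → none (e , b))))
        let others = λ e ne → not-bad s e (¬true (λ b → k (z , e , bz , b , ne ∘ sym)))
            zero-product = trans (sym (sum-single m z (λ e → coef (sgn ∘ s) e * g e)
                (λ e ne → cong (_* g e) (others e ne))))
              (trans (sym (double-counting (sgn ∘ s) g)) (sum-zero n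
                  (λ v → trans (cong (sgn (s v) *_) (G v)) (ℤₚ.*-zeroʳ (sgn (s v))))))
        λ _ → [ is-bad s z bz , g≢0 z ]′ (ℤₚ.i*j≡0⇒i≡0∨j≡0 (coef (sgn ∘ s) z) zero-product))

      module TwoBad (z₁ z₂ : Fin m) (bz₁ : bad s z₁ ≡ true) (bz₂ : bad s z₂ ≡ true) (z₁≢z₂ : z₁ ≢ z₂) where

        connected : ∀ p q → K p ≡ true → K q ≡ true → ¬ ¬ Walk H p q
        connected p q p∈ q∈ = do
          w ← bridgeless z₁ p q p∈ q∈
          return (wmap (λ _ → proj₁) w)

        open module B = Bridgeless H (λ v → K v ≡ true) (λ e _ → ends e) connected bridgeless using (Linked; Ring)

        u₁ v₁ u₂ v₂ : Fin n
        u₁ = head z₁ false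
        v₁ = head z₁ true
        u₂ = head z₂ false
        v₂ = head z₂ true

        private
          wsgH : ∀ {x y} (w : Walk H x y) → wsg w ≡ s x ⊗ s y
          wsgH = balanced-sign s (λ e h → not-bad s e h)

          zigzag : ∀ a b c → (a ⊗ b) ⊗ (opp (b ⊗ c) ⊗ (a ⊗ c)) ≡ neg
          zigzag pos pos pos = refl
          zigzag pos pos neg = refl
          zigzag pos neg pos = refl
          zigzag pos neg neg = refl
          zigzag neg pos pos = refl
          zigzag neg pos neg = refl
          zigzag neg neg pos = refl
          zigzag neg neg neg = refl

          bad∉ : ∀ {x y} (w : Walk H x y) z → bad s z ≡ true → cnt w z ≡ 0
          bad∉ w z bz = ≢0-stable (λ nz → true≢false bz (cnt⇒A w z nz))

          on-K : ∀ {x y} (w : Walk H x y) → K x ≡ true → ∀ v → On v w → K v ≡ true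
          on-K nil x∈ v refl = x∈
          on-K (cons e β h p q w) x∈ v (inj₁ refl) = x∈
          on-K (cons e β h p refl w) x∈ v (inj₂ o) = on-K w (ends e (not β)) v o

        -- The ring supplies the odd part. Each chord closes with part of the ring to a negative
        -- walk at `u₁`; both walks have the same boundary, so their difference is a flow with value
        -- ±1 on each chord, as `good-pair` demands.
        ring-state : Ring u₁ v₁ u₂ v₂ → State
        ring-state R = start-state u₁ W X (λ e → 0ℤ + h e)
          (flow-+ {λ _ → 0ℤ} {h} ∂-zero h-flow)
          (λ e ∉ → trans (ℤₚ.+-identityˡ (h e)) (χ-difference-supp N N′ e (λ c → ∉ (inj₁ (inj₂ c)))))
          (good-pair ψ z₁ z₂ (good-odd h C nothing-good (λ _ _ → refl) (χ-difference-supp N N′) (λ _ _ ())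
              (λ e → χ-difference-odd N N′ e (once e)))
            ψ-flow (λ e ∉ → cong₂ (λ p q → p + - 1ℤ * q) (χ-supp c₁ e ∉) (χ-supp c₂ e ∉))
            [ (λ ()) , off z₁ bz₁ ]′ [ (λ ()) , off z₂ bz₂ ]′
            (λ d → unit-∤3 (χ-unit c₁ z₁ c₁z₁) (subst (+ 3 ∣_)
                (trans (cong (λ q → χ c₁ z₁ + - 1ℤ * q) (χ-zero c₂ z₁ c₂z₁)) (ℤₚ.+-identityʳ (χ c₁ z₁))) d))
            (λ d → unit-∤3 (unit-neg (χ-unit c₂ z₂ c₂z₂)) (subst (+ 3 ∣_)
                (trans (cong (_+ - 1ℤ * χ c₂ z₂) (χ-zero c₁ z₂ c₁z₂)) (minus (χ c₂ z₂))) d)))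
          X⇒W (∨-intro (inj₁ (onBool-compl N u₁ (on-start N))))
          (λ v v∈ → [ (λ o → on-K N (ends z₁ false) v (onBool-sound N v o)) ,
              (λ o → on-K N′ (ends z₁ false) v (onBool-sound N′ v o)) ]′ (∨-elim {onBool N v} v∈))
          c₁ c₁-odd reach
          where
          open Ring R
          N = B.Pair.P PQ
          N′ = B.Pair.Q PQ
          once = B.Pair.disjoint PQ
          C X : Fin m → Set
          C e = cnt N e ℕ.+ cnt N′ e ≢ 0
          X e = (⊥ ⊎ C e) ⊎ (e ≡ z₁ ⊎ e ≡ z₂)
          h : Fin m → ℤ
          h e = χ N e + - 1ℤ * χ N′ e
          h-flow : Flow h
          h-flow = flow-difference {χ N} {χ N′} (λ v → trans (∂χ N v)
            (trans (cong (λ a → δ u₁ v - sgn a * δ v₁ v) (trans (wsgH N) (sym (wsgH N′)))) (sym (∂χ N′ v))))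
          minus : ∀ (x : ℤ) → 0ℤ + - 1ℤ * x ≡ - x
          minus = solve-∀
          W : Fin n → Bool
          W v = onBool N v ∨ onBool N′ v
          in-N : ∀ e → cnt N e ≢ 0 → X e
          in-N e nz = inj₁ (inj₂ (λ z → nz (ℕₚ.m+n≡0⇒m≡0 (cnt N e) z)))
          in-N′ : ∀ e → cnt N′ e ≢ 0 → X e
          in-N′ e nz = inj₁ (inj₂ (λ z → nz (ℕₚ.m+n≡0⇒n≡0 (cnt N e) z)))
          pre⊆ : ∀ {x y p} {w : Walk H x y} (sp : Split w p) → (∀ e → cnt w e ≢ 0 → X e) → ∀ e → cnt
              (Split.pre sp) e ≢ 0 → X e
          pre⊆ sp sub e nz = sub e (λ z → nz (part (Split.cnt≡ sp e) z))
          module P = Split (split N u₂ u₂∈)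
          module Q = Split (split N′ v₂ v₂∈)
          NX : Walk X u₁ v₁
          NX = confine N in-N
          PX : Walk X u₁ u₂
          PX = confine P.pre (pre⊆ (split N u₂ u₂∈) in-N)
          QX : Walk X u₁ v₂
          QX = confine Q.pre (pre⊆ (split N′ v₂ v₂∈) in-N′)
          c₁ c₂ : Walk X u₁ u₁
          c₁ = cons z₁ false (inj₂ (inj₁ refl)) refl refl (rev NX)
          c₂ = PX ++ cons z₂ false (inj₂ (inj₂ refl)) refl refl (rev QX)
          sgn-X : ∀ {x y} (w : Walk H x y) sub → wsg (rev (confine {X = X} w sub)) ≡ s x ⊗ s y
          sgn-X w sub = trans (wsg-rev (confine w sub)) (trans (wsg-confine w sub) (wsgH w))
          c₁-odd : wsg c₁ ≡ neg
          c₁-odd = trans (cong₂ _⊗_ (σ-bad s z₁ bz₁) (sgn-X N in-N)) (opp-self (s u₁ ⊗ s v₁))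
          c₂-odd : wsg c₂ ≡ neg
          c₂-odd = trans (wsg-++ PX _) (trans (cong₂ _⊗_ (trans (wsg-confine P.pre _) (wsgH P.pre))
            (cong₂ _⊗_ (σ-bad s z₂ bz₂) (sgn-X Q.pre _))) (zigzag (s u₁) (s u₂) (s v₂)))
          none : ∀ {x y} (w : Walk H x y) sub z → bad s z ≡ true → cnt (confine {X = X} w sub) z ≡ 0
          none w sub z bz = trans (cnt-confine w sub z) (bad∉ w z bz)
          none-rev : ∀ {x y} (w : Walk H x y) sub z → bad s z ≡ true → cnt (rev (confine {X = X} w sub)) z ≡ 0
          none-rev w sub z bz = trans (cnt-rev (confine w sub) z) (none w sub z bz)
          c₁z₁ : cnt c₁ z₁ ≡ 1
          c₁z₁ = cong₂ ℕ._+_ (δℕ-refl z₁) (none-rev N in-N z₁ bz₁)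
          c₁z₂ : cnt c₁ z₂ ≡ 0
          c₁z₂ = cong₂ ℕ._+_ (δℕ-≢ z₁≢z₂) (none-rev N in-N z₂ bz₂)
          c₂z₁ : cnt c₂ z₁ ≡ 0
          c₂z₁ = trans (cnt-++ PX _ z₁) (cong₂ ℕ._+_ (none P.pre _ z₁ bz₁)
              (cong₂ ℕ._+_ (δℕ-≢ (z₁≢z₂ ∘ sym)) (none-rev Q.pre _ z₁ bz₁)))
          c₂z₂ : cnt c₂ z₂ ≡ 1
          c₂z₂ = trans (cnt-++ PX _ z₂) (cong₂ ℕ._+_ (none P.pre _ z₂ bz₂)
              (cong₂ ℕ._+_ (δℕ-refl z₂) (none-rev Q.pre _ z₂ bz₂)))
          ψ : Fin m → ℤ
          ψ e = χ c₁ e + - 1ℤ * χ c₂ e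
          ψ-flow : Flow ψ
          ψ-flow = flow-difference {χ c₁} {χ c₂} (λ v → trans (odd-closed c₁ c₁-odd v)
              (sym (odd-closed c₂ c₂-odd v)))
          off : ∀ z → bad s z ≡ true → ¬ C z
          off z bz c = c (cong₂ ℕ._+_ (bad∉ N z bz) (bad∉ N′ z bz))
          X⇒W : ∀ e → X e → Inside W e
          X⇒W e (inj₁ (inj₂ c)) β with zero? (cnt N e)
          ... | inj₂ nz = ∨-intro (inj₁ (onBool-compl N _ (cnt⇒On N e nz β)))
          ... | inj₁ z with zero? (cnt N′ e)
          ...   | inj₂ nz = ∨-intro {onBool N (head e β)} (inj₂ (onBool-compl N′ _ (cnt⇒On N′ e nz β)))
          ...   | inj₁ z′ = contradiction (cong₂ ℕ._+_ z z′) c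
          X⇒W e (inj₂ (inj₁ refl)) false = ∨-intro (inj₁ (onBool-compl N u₁ (on-start N)))
          X⇒W e (inj₂ (inj₁ refl)) true  = ∨-intro (inj₁ (onBool-compl N v₁ (on-end N)))
          X⇒W e (inj₂ (inj₂ refl)) false = ∨-intro (inj₁ (onBool-compl N u₂ u₂∈))
          X⇒W e (inj₂ (inj₂ refl)) true  = ∨-intro {onBool N v₂} (inj₂ (onBool-compl N′ v₂ v₂∈))
          reach : ∀ p → W p ≡ true → Walk X u₁ p
          reach p p∈ with ∨-elim {onBool N p} p∈
          ... | inj₁ o = let sp = split N p (onBool-sound N p o) in confine (Split.pre sp) (pre⊆ sp in-N)
          ... | inj₂ o = let sp = split N′ p (onBool-sound N′ p o) in confine (Split.pre sp) (pre⊆ sp in-N′)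

        -- Each path with its bad edge is a negative closed walk. Vertex-disjointness of the two
        -- contradicts `NB`. Based at a common vertex they have equal boundary, so their difference
        -- is a flow that is odd on all their edges.
        linked-state : Linked u₁ v₁ u₂ v₂ → ¬ ¬ State
        linked-state L = do
          yes (x , x∈₁ , x∈₂) ← em (∃ λ x → On x A₁ × On x A₂)
            where no apart → λ _ → NB (onBool A₁)
                    ( closed-unbalanced (onBool A₁) d₁ d₁-odd d₁-inside (onBool-compl A₁ u₁ (on-start A₁))
                    , closed-unbalanced (not ∘ onBool A₁) d₂ d₂-odd
                        (λ e i β → not-true (off₁ apart _ (onBool-sound A₂ _ (d₂-inside e i β))))
                        (not-true (off₁ apart u₂ (on-start A₂))) )
          return (meeting x x∈₁ x∈₂)
          where
          open Linked L
          A₁ = proj₁ (erase-loops B₁)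
          A₂ = proj₁ (erase-loops B₂)
          A₁≤1 = simple⇒trail A₁ (proj₁ (proj₂ (erase-loops B₁)))
          A₂≤1 = simple⇒trail A₂ (proj₁ (proj₂ (erase-loops B₂)))
          off₁ : ¬ (∃ λ x → On x A₁ × On x A₂) → ∀ v → On v A₂ → onBool A₁ v ≡ false
          off₁ apart v o = ¬true (λ h → apart (v , onBool-sound A₁ v h , o))
          disjoint : ∀ e → cnt A₁ e ≡ 0 ⊎ cnt A₂ e ≡ 0
          disjoint e with apart e
          ... | inj₁ z = inj₁ (ℕₚ.n≤0⇒n≡0 (subst (cnt A₁ e ℕ.≤_) z (proj₂ (proj₂ (erase-loops B₁)) e)))
          ... | inj₂ z = inj₂ (ℕₚ.n≤0⇒n≡0 (subst (cnt A₂ e ℕ.≤_) z (proj₂ (proj₂ (erase-loops B₂)) e)))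
          X₁ X₂ X : Fin m → Set
          X₁ e = cnt A₁ e ≢ 0 ⊎ e ≡ z₁
          X₂ e = cnt A₂ e ≢ 0 ⊎ e ≡ z₂
          X e = X₁ e ⊎ X₂ e
          closed : ∀ {Y : Fin m → Set} {A B} (w : Walk H A B) z → (∀ e → cnt w e ≢ 0 → Y e) → Y z →
            head z false ≡ A → head z true ≡ B → Walk Y A A
          closed w z sub i p q = cons z false i p q (rev (confine w sub))
          closed-odd : ∀ {Y : Fin m → Set} (z : Fin m) (w : Walk H (head z false) (head z true))
              (sub : ∀ e → cnt w e ≢ 0 → Y e) (i : Y z) →
            bad s z ≡ true → wsg (closed w z sub i refl refl) ≡ neg
          closed-odd z w sub i bz = trans (cong₂ _⊗_ (σ-bad s z bz)
              (trans (wsg-rev (confine w sub)) (trans (wsg-confine w sub) (wsgH w))))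
            (opp-self (s (head z false) ⊗ s (head z true)))
          d₁ = closed {X₁} A₁ z₁ (λ e → inj₁) (inj₂ refl) refl refl
          d₂ = closed {X₂} A₂ z₂ (λ e → inj₁) (inj₂ refl) refl refl
          d₁-odd : wsg d₁ ≡ neg
          d₁-odd = closed-odd {X₁} z₁ A₁ (λ e → inj₁) (inj₂ refl) bz₁
          d₂-odd : wsg d₂ ≡ neg
          d₂-odd = closed-odd {X₂} z₂ A₂ (λ e → inj₁) (inj₂ refl) bz₂
          d₁-inside : ∀ e → X₁ e → Inside (onBool A₁) e
          d₁-inside e (inj₁ nz) β = onBool-compl A₁ _ (cnt⇒On A₁ e nz β)
          d₁-inside e (inj₂ refl) false = onBool-compl A₁ u₁ (on-start A₁)
          d₁-inside e (inj₂ refl) true  = onBool-compl A₁ v₁ (on-end A₁)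
          d₂-inside : ∀ e → X₂ e → Inside (onBool A₂) e
          d₂-inside e (inj₁ nz) β = onBool-compl A₂ _ (cnt⇒On A₂ e nz β)
          d₂-inside e (inj₂ refl) false = onBool-compl A₂ u₂ (on-start A₂)
          d₂-inside e (inj₂ refl) true  = onBool-compl A₂ v₂ (on-end A₂)

          module Rooted (z : Fin m) (bz : bad s z ≡ true) (A : Walk H (head z false) (head z true))
            (sub : ∀ e → cnt A e ≢ 0 → X e) (z∈ : X z) (x : Fin n) (o : On x A) where
            module T = Split (split A x o)
            pre⊆ : ∀ e → cnt T.pre e ≢ 0 → X e
            pre⊆ e nz = sub e (λ q → nz (part (T.cnt≡ e) q))
            suf⊆ : ∀ e → cnt T.suf e ≢ 0 → X e
            suf⊆ e nz = sub e (λ q → nz (ℕₚ.m+n≡0⇒n≡0 (cnt T.pre e) (trans (sym (T.cnt≡ e)) q)))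
            to-start : Walk X x (head z false)
            to-start = rev (confine T.pre pre⊆)
            c : Walk X x x
            c = to-start ++ cons z false z∈ refl refl (rev (confine T.suf suf⊆))
            c-odd : wsg c ≡ neg
            c-odd = trans (wsg-++ to-start _) (trans (cong₂ _⊗_
                (trans (wsg-rev (confine T.pre pre⊆)) (trans (wsg-confine T.pre pre⊆)
                    (trans (wsgH T.pre) (⊗-comm (s (head z false)) (s x)))))
                (cong₂ _⊗_ (σ-bad s z bz) (trans (wsg-rev (confine T.suf suf⊆))
                    (trans (wsg-confine T.suf suf⊆) (wsgH T.suf)))))
              (zigzag (s x) (s (head z false)) (s (head z true))))
            cnt-c : ∀ e → cnt c e ≡ cnt A e ℕ.+ δℕ z e
            cnt-c e = trans (cnt-++ to-start _ e) (trans (cong₂ (λ a b → a ℕ.+ (δℕ z e ℕ.+ b))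
                (trans (cnt-rev (confine T.pre pre⊆) e) (cnt-confine T.pre pre⊆ e))
                    (trans (cnt-rev (confine T.suf suf⊆) e) (cnt-confine T.suf suf⊆ e)))
              (trans (cong (cnt T.pre e ℕ.+_) (ℕₚ.+-comm (δℕ z e) (cnt T.suf e)))
                  (trans (sym (ℕₚ.+-assoc (cnt T.pre e) _ _)) (cong (ℕ._+ δℕ z e) (sym (T.cnt≡ e))))))
            reach : ∀ p → On p A → Walk X x p
            reach p o′ = to-start ++ confine U.pre (λ e nz → sub e (λ q → nz (part (U.cnt≡ e) q)))
              where module U = Split (split A p o′)

          meeting : ∀ x → On x A₁ → On x A₂ → State
          meeting x x∈₁ x∈₂ = start-state x W X (λ e → 0ℤ + h e) (flow-+ {λ _ → 0ℤ} {h} ∂-zero h-flow)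
            (λ e ∉ → trans (ℤₚ.+-identityˡ (h e)) (χ-difference-supp R₁.c R₂.c e (λ c → ∉ (C⇒X e c))))
            (good-resp (λ e → [ (λ ()) , C⇒X e ]′) (λ e i → inj₂ (X⇒C e i))
              (good-odd h C nothing-good (λ _ _ → refl) (χ-difference-supp R₁.c R₂.c) (λ _ _ ())
                  (λ e → χ-difference-odd R₁.c R₂.c e (once e))))
            (λ { e (inj₁ i) β → ∨-intro (inj₁ (d₁-inside e i β)) ; e (inj₂ i) β →
                ∨-intro {onBool A₁ (head e β)} (inj₂ (d₂-inside e i β)) })
            (∨-intro (inj₁ (onBool-compl A₁ x x∈₁)))
            (λ v v∈ → [ (λ o → on-K A₁ (ends z₁ false) v (onBool-sound A₁ v o)) ,
                (λ o → on-K A₂ (ends z₂ false) v (onBool-sound A₂ v o)) ]′ (∨-elim {onBool A₁ v} v∈))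
            R₁.c R₁.c-odd
            (λ p p∈ → [ (λ o → R₁.reach p (onBool-sound A₁ p o)) ,
                (λ o → R₂.reach p (onBool-sound A₂ p o)) ]′ (∨-elim {onBool A₁ p} p∈))
            where
            module R₁ = Rooted z₁ bz₁ A₁ (λ e nz → inj₁ (inj₁ nz)) (inj₁ (inj₂ refl)) x x∈₁
            module R₂ = Rooted z₂ bz₂ A₂ (λ e nz → inj₂ (inj₁ nz)) (inj₂ (inj₂ refl)) x x∈₂
            W : Fin n → Bool
            W v = onBool A₁ v ∨ onBool A₂ v
            C : Fin m → Set
            C e = cnt R₁.c e ℕ.+ cnt R₂.c e ≢ 0
            C⇒X : ∀ e → C e → X e
            C⇒X e c with zero? (cnt R₁.c e) | zero? (cnt R₂.c e)
            ... | inj₂ nz | _ = cnt⇒A R₁.c e nz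
            ... | inj₁ _ | inj₂ nz = cnt⇒A R₂.c e nz
            ... | inj₁ a | inj₁ b = contradiction (cong₂ ℕ._+_ a b) c
            X⇒C : ∀ e → X e → C e
            X⇒C e i q with ℕₚ.m+n≡0⇒m≡0 (cnt R₁.c e) q | ℕₚ.m+n≡0⇒n≡0 (cnt R₁.c e) q
            X⇒C e (inj₁ (inj₁ nz)) q | a | _ = nz (part (R₁.cnt-c e) a)
            X⇒C e (inj₂ (inj₁ nz)) q | _ | b = nz (part (R₂.cnt-c e) b)
            X⇒C e (inj₁ (inj₂ refl)) q | a | _ = contradiction
                (trans (sym (δℕ-refl z₁)) (ℕₚ.m+n≡0⇒n≡0 (cnt A₁ z₁) (trans (sym (R₁.cnt-c z₁)) a))) (λ ())
            X⇒C e (inj₂ (inj₂ refl)) q | _ | b = contradiction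
                (trans (sym (δℕ-refl z₂)) (ℕₚ.m+n≡0⇒n≡0 (cnt A₂ z₂) (trans (sym (R₂.cnt-c z₂)) b))) (λ ())
            h : Fin m → ℤ
            h e = χ R₁.c e + - 1ℤ * χ R₂.c e
            h-flow : Flow h
            h-flow = flow-difference {χ R₁.c} {χ R₂.c} (λ v → trans (odd-closed R₁.c R₁.c-odd v)
                (sym (odd-closed R₂.c R₂.c-odd v)))
            once : ∀ e → cnt R₁.c e ℕ.+ cnt R₂.c e ℕ.≤ 1
            once e rewrite R₁.cnt-c e | R₂.cnt-c e with z₁ ≟ e | z₂ ≟ e
            ... | yes refl | yes refl = contradiction refl z₁≢z₂
            ... | yes refl | no _ rewrite bad∉ A₁ z₁ bz₁ | bad∉ A₂ z₁ bz₁ = s≤s z≤n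
            ... | no _ | yes refl rewrite bad∉ A₁ z₂ bz₂ | bad∉ A₂ z₂ bz₂ = s≤s z≤n
            ... | no _ | no _ rewrite ℕₚ.+-identityʳ (cnt A₁ e) | ℕₚ.+-identityʳ (cnt A₂ e) with disjoint e
            ...   | inj₁ q rewrite q = A₂≤1 e
            ...   | inj₂ q rewrite q | ℕₚ.+-identityʳ (cnt A₁ e) = A₁≤1 e

        unbalanced-state : ¬ ¬ State
        unbalanced-state = do
          inj₂ R ← B.linked-or-ring (ends z₁ false) (ends z₁ true) (ends z₂ false) (ends z₂ true)
            where inj₁ L → linked-state L
          return (ring-state R)

    cover : ∀ root → K root ≡ true → (∃ λ g → Flow g × (∀ e → g e ≢ 0ℤ)) →
      ¬ ¬ (∃ λ F → Flow F × (∀ e → ¬ (+ 6 ∣ F e)))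
    cover root root∈ adm = do
      no unbalanced ← em (Bal (λ _ → true))
        where yes bal → fill (balanced-state root root∈ bal)
      St ← descent {X = Fin n → Sign} (λ s → count (bad s)) (step unbalanced) (λ _ → pos)
      fill St
      where
      step : ¬ Bal (λ _ → true) → ∀ s → (∀ s′ → count (bad s′) ℕ.< count (bad s) → ¬ ¬ State) → ¬ ¬ State
      step unbalanced s smaller = do
        no minimal ← em (∃ λ s′ → count (bad s′) ℕ.< count (bad s))
          where yes (s′ , lt) → smaller s′ lt
        let module Fr = Frustrated s (λ s′ → ℕₚ.≮⇒≥ (λ lt → minimal (s′ , lt)))
        (z₁ , z₂ , b₁ , b₂ , ne) ← Fr.two-bad adm unbalanced
        Fr.TwoBad.unbalanced-state z₁ z₂ b₁ b₂ ne

-- Contracting small cuts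

-- The types of vertices and edges stay fixed while the graph shrinks; only `K` decreases.
record Instance (n m : ℕ) : Set where
  field
    S    : SG n m
    K    : Fin n → Bool
  open Core S
  field
    ends : ∀ e β → K (head e β) ≡ true
    conn : ∀ Y p q → K p ≡ true → K q ≡ true → Y p ≡ true → Y q ≡ false → ¬ ¬ (∃ λ e → Crossing Y e)
    NB   : ∀ O → ¬ (¬ Bal O × ¬ Bal (not ∘ O))
    adm  : ∃ λ g → Flow g × (∀ e → g e ≢ 0ℤ)
    root : Fin n
    root∈ : K root ≡ true

module SmallCut {n m : ℕ} (S : SG n m) where
  open Core S

  -- For a balanced side this weighting isolates the cut: edges inside cancel, and crossing edges
  -- get coefficient ±1.
  weight : (Fin n → Bool) → (Fin n → Sign) → Fin n → ℤ
  weight Z s v = if Z v then sgn (s v) else 0ℤ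

  crossing-not : ∀ Z e → Crossing (not ∘ Z) e → Crossing Z e
  crossing-not Z e (β , p , q) = not β , not-false q , trans (cong Z (head-not-not e β)) (not-true⁻ p)
    where
    not-false : ∀ {c} → not c ≡ false → c ≡ true
    not-false {true} _ = refl

  crossing-not⁻ : ∀ Z e → Crossing Z e → Crossing (not ∘ Z) e
  crossing-not⁻ Z e (β , p , q) = not β , not-true q , cong not (trans (cong Z (head-not-not e β)) p)

  module _ (Z : Fin n → Bool) (bal : Bal Z) where

    private
      s = proj₁ bal
      w = weight Z s

    coef-crossing : ∀ e → Crossing Z e → IsUnit (coef w e)
    coef-crossing e (β , p , q) = subst IsUnit (sym (trans (coef-β w e β) (trans
      (cong₂ (λ a b → (if a then sgn (s (head e β)) else 0ℤ) * t e β +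
          (if b then sgn (s (head e (not β))) else 0ℤ) * t e (not β)) p q)
      (ℤₚ.+-identityʳ (sgn (s (head e β)) * t e β))))) (unit-* (sgn-unit (s (head e β))) (sgn-unit (τ e β)))

    coef-other : ∀ e → ¬ Crossing Z e → coef w e ≡ 0ℤ
    coef-other e nc with Z (head e false) in p | Z (head e true) in q
    ... | true  | true  = proj₂ bal e (λ { false → p ; true → q })
    ... | true  | false = contradiction (false , p , q) nc
    ... | false | true  = contradiction (true , q , p) nc
    ... | false | false = refl

    total : ∀ F → Flow F → sumℤ m (λ e → coef w e * F e) ≡ 0ℤ
    total F flow = trans (sym (double-counting w F)) (sum-zero n
        (λ v → trans (cong (w v *_) (flow v)) (ℤₚ.*-zeroʳ (w v))))

    bridge-zero : ∀ e → Crossing Z e → (∀ e₂ → Crossing Z e₂ → e₂ ≡ e) → ∀ F → Flow F → F e ≡ 0ℤ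
    bridge-zero e c only F flow with ℤₚ.i*j≡0⇒i≡0∨j≡0 (coef w e)
        (trans (sym (sum-single m e (λ e₂ → coef w e₂ * F e₂)
        (λ e₂ ne → cong (_* F e₂) (coef-other e₂ (ne ∘ only e₂))))) (total F flow))
    ... | inj₂ z = z
    ... | inj₁ z = ⊥-elim (unit≢0 (coef-crossing e c) z)
      where
      unit≢0 : ∀ {x} → IsUnit x → x ≢ 0ℤ
      unit≢0 (inj₁ refl) ()
      unit≢0 (inj₂ refl) ()

    -- The two values on the cut agree up to sign. Hence the value recovered on a contracted edge
    -- inherits indivisibility by 6 from its partner.
    pair-divides : ∀ e e′ → e ≢ e′ → Crossing Z e → Crossing Z e′ → (∀ e₂ → Crossing Z e₂ → e₂ ≡ e ⊎ e₂ ≡ e′) →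
      ∀ F → Flow F → ∀ k → k ∣ F e → k ∣ F e′
    pair-divides e e′ ne c c′ only F flow k d = go (coef-crossing e′ c′)
        (trans (sym (sum-pair m e e′ ne (λ e₂ → coef w e₂ * F e₂)
        (λ e₂ n₁ n₂ → cong (_* F e₂) (coef-other e₂ (λ c₂ → [ n₁ , n₂ ]′ (only e₂ c₂)))))) (total F flow))
      where
      x = coef w e * F e
      k∣x : k ∣ x
      k∣x = ∣n⇒∣m*n (coef w e) d
      plus : ∀ (x y : ℤ) → x + 1ℤ * y ≡ 0ℤ → y ≡ - x
      plus x y h = trans (re x y) (trans (cong (_- x) h) (ℤₚ.+-identityˡ (- x)))
        where
        re : ∀ (x y : ℤ) → y ≡ x + 1ℤ * y - x
        re = solve-∀
      minus : ∀ (x y : ℤ) → x + - 1ℤ * y ≡ 0ℤ → y ≡ x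
      minus x y h = trans (re x y) (trans (cong (λ z → x - z) h) (ℤₚ.+-identityʳ x))
        where
        re : ∀ (x y : ℤ) → y ≡ x - (x + - 1ℤ * y)
        re = solve-∀
      go : ∀ {a} → IsUnit a → x + a * F e′ ≡ 0ℤ → k ∣ F e′
      go (inj₁ refl) h = subst (k ∣_) (sym (plus x (F e′) h)) (∣m⇒∣-m k∣x)
      go (inj₂ refl) h = subst (k ∣_) (sym (minus x (F e′) h)) k∣x

-- The edge e is contracted after switching it to positive; it stays as a positive loop,
-- so that the types of vertices and edges do not change.
module Contract {n m : ℕ} (I : Instance n m) (e : Fin m)
  (u≢v : SG.head (Instance.S I) e false ≢ SG.head (Instance.S I) e true) where
  open Instance I
  open Core S

  private
    u = head e false
    v = head e true

  μ : Fin n → Fin n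
  μ x = if does (x ≟ v) then u else x

  twist : Fin n → Sign
  twist x = if does (x ≟ v) then σ e else pos

  S′ : SG n m
  S′ = record { head = λ e₂ β → μ (head e₂ β) ; τ = λ e₂ β → τ e₂ β ⊗ twist (head e₂ β) }

  module C′ = Core S′

  μ-other : ∀ x → x ≢ v → μ x ≡ x
  μ-other x ne with x ≟ v
  ... | yes r = contradiction r ne
  ... | no _ = refl

  private
    half : ∀ x a w → w ≢ v → δ (μ x) w * sgn (a ⊗ twist x) ≡ δ x w * sgn a + (δ u w * sgn (σ e)) * (δ x v * sgn a)
    half x a w w≢v with x ≟ v
    ... | yes refl = trans (cong (δ u w *_) (sgn-⊗ a (σ e))) (trans (calc (δ u w) (sgn a) (sgn (σ e)))
          (cong (λ z → z * sgn a + (δ u w * sgn (σ e)) * (1ℤ * sgn a)) (sym (δ-≢ (w≢v ∘ sym)))))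
      where
      calc : ∀ (d a s : ℤ) → d * (a * s) ≡ 0ℤ * a + (d * s) * (1ℤ * a)
      calc = solve-∀
    ... | no _ = trans (cong (λ z → δ x w * sgn z) (⊗-identityʳ a)) (calc (δ x w) (sgn a) (δ u w * sgn (σ e)))
      where
      calc : ∀ (d a z : ℤ) → d * a ≡ d * a + z * (0ℤ * a)
      calc = solve-∀

    half-v : ∀ x a → δ (μ x) v * a ≡ 0ℤ
    half-v x a with x ≟ v
    ... | yes _ = cong (_* a) (δ-≢ u≢v)
    ... | no ne = cong (_* a) (δ-≢ ne)

  -- Row `v` of the incidence matrix is multiplied by `σ e` and added to row `u`; this is switching
  -- followed by identification.
  inc′ : ∀ e₂ w → w ≢ v → C′.inc e₂ w ≡ inc e₂ w + (δ u w * sgn (σ e)) * inc e₂ v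
  inc′ e₂ w w≢v = trans (cong₂ _+_ (half (head e₂ false) (τ e₂ false) w w≢v)
      (half (head e₂ true) (τ e₂ true) w w≢v))
    (calc (δ (head e₂ false) w * t e₂ false) (δ (head e₂ true) w * t e₂ true) (δ u w * sgn (σ e))
        (δ (head e₂ false) v * t e₂ false) (δ (head e₂ true) v * t e₂ true))
    where
    calc : ∀ (a b c d f : ℤ) → (a + c * d) + (b + c * f) ≡ (a + b) + c * (d + f)
    calc = solve-∀

  ∂′ : ∀ f w → w ≢ v → C′.∂ f w ≡ ∂ f w + (δ u w * sgn (σ e)) * ∂ f v
  ∂′ f w w≢v = trans (sum-cong m (λ e₂ → trans (cong (_* f e₂) (inc′ e₂ w w≢v))
      (calc (inc e₂ w) c (inc e₂ v) (f e₂))))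
    (trans (sum-+ m _ _) (cong (λ z → ∂ f w + z) (sum-* m c _)))
    where
    c = δ u w * sgn (σ e)
    calc : ∀ (a c b f : ℤ) → (a + c * b) * f ≡ a * f + c * (b * f)
    calc = solve-∀

  ∂′-v : ∀ f → C′.∂ f v ≡ 0ℤ
  ∂′-v f = sum-zero m (λ e₂ → cong (_* f e₂) (cong₂ _+_ (half-v (head e₂ false)
      (sgn (τ e₂ false ⊗ twist (head e₂ false)))) (half-v (head e₂ true) (sgn (τ e₂ true ⊗ twist (head e₂ true))))))

  flow′ : ∀ g → Flow g → C′.Flow g
  flow′ g G w with w ≟ v
  ... | yes refl = ∂′-v g
  ... | no ne = trans (∂′ g w ne) (trans (cong₂ (λ a b → a + (δ u w * sgn (σ e)) * b) (G w) (G v))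
      (trans (ℤₚ.+-identityˡ _) (ℤₚ.*-zeroʳ (δ u w * sgn (σ e)))))

  -- Conservation at `u` dictates the value on `e`; conservation at `v` then follows from the merged
  -- vertex.
  lift : ∀ F → C′.Flow F → ∃ λ F₁ → Flow F₁ × (∀ e₂ → e₂ ≢ e → F₁ e₂ ≡ F e₂)
  lift F G = (λ e₂ → F e₂ + c * δ e e₂) , flow , λ e₂ ne → trans
      (cong (λ z → F e₂ + c * z) (δ-≢ (ne ∘ sym))) (trans (cong (λ z → F e₂ + z) (ℤₚ.*-zeroʳ c))
      (ℤₚ.+-identityʳ (F e₂)))
    where
    t₀ = t e false
    t₁ = t e true
    c = - (t₀ * ∂ F u)
    base : ∀ w → ∂ (λ e₂ → F e₂ + c * δ e e₂) w ≡ ∂ F w + c * (δ u w * t₀ + δ v w * t₁)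
    base w = trans (∂-lin F c (δ e) w) (cong (λ z → ∂ F w + c * z) (∂-δ e w))
    at-u : ∂ F u + sgn (σ e) * ∂ F v ≡ 0ℤ
    at-u = trans (cong (λ z → ∂ F u + z * ∂ F v) (sym (trans (cong (_* sgn (σ e)) (δ-refl u))
        (ℤₚ.*-identityˡ (sgn (σ e)))))) (trans (sym (∂′ F u u≢v)) (G u))
    flow : Flow (λ e₂ → F e₂ + c * δ e e₂)
    flow w with w ≟ u | w ≟ v
    ... | yes refl | _ = trans (base u) (trans (cong₂ (λ a b → ∂ F u + c * (a * t₀ + b * t₁)) (δ-refl u)
        (δ-≢ (u≢v ∘ sym)))
          (trans (calc (∂ F u) t₀ t₁) (trans (cong (λ z → (1ℤ - z) * ∂ F u) (sgn² (τ e false)))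
              (ℤₚ.*-zeroˡ (∂ F u)))))
      where
      calc : ∀ (x p q : ℤ) → x + - (p * x) * (1ℤ * p + 0ℤ * q) ≡ (1ℤ - p * p) * x
      calc = solve-∀
    ... | no _ | yes refl = trans (base v) (trans (cong₂ (λ a b → ∂ F v + c * (a * t₀ + b * t₁)) (δ-≢ u≢v)
        (δ-refl v))
          (trans (calc (∂ F v) (∂ F u) t₀ t₁) (trans (cong (λ z → ∂ F v + z * ∂ F u) (sym (σ-β e false)))
            (trans (calc′ (∂ F v) (∂ F u) (sgn (σ e))) (trans
                (cong₂ (λ a b → sgn (σ e) * a + (1ℤ - b) * ∂ F v) at-u (sgn² (σ e)))
              (cong₂ _+_ (ℤₚ.*-zeroʳ (sgn (σ e))) (ℤₚ.*-zeroˡ (∂ F v))))))))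
      where
      calc : ∀ (y x p q : ℤ) → y + - (p * x) * (0ℤ * p + 1ℤ * q) ≡ y + - (p * q) * x
      calc = solve-∀
      calc′ : ∀ (y x s : ℤ) → y + s * x ≡ s * (x + s * y) + (1ℤ - s * s) * y
      calc′ = solve-∀
    ... | no nu | no nv = trans (base w) (trans (cong₂ (λ a b → ∂ F w + c * (a * t₀ + b * t₁))
        (δ-≢ (nu ∘ sym)) (δ-≢ (nv ∘ sym)))
          (trans (calc (∂ F w) c t₀ t₁) (trans (tidy (∂ F w) (sgn (σ e)) (∂ F v))
              (trans (cong (λ z → ∂ F w + (z * sgn (σ e)) * ∂ F v) (sym (δ-≢ (nu ∘ sym))))
              (trans (sym (∂′ F w nv)) (G w))))))
      where
      calc : ∀ (x c p q : ℤ) → x + c * (0ℤ * p + 0ℤ * q) ≡ x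
      calc = solve-∀
      tidy : ∀ (x s y : ℤ) → x ≡ x + (0ℤ * s) * y
      tidy = solve-∀

  -- When `e` lies inside the preimage, the signs at `u` and `v` differ exactly by `σ e`, which the
  -- twist compensates.
  bal′ : ∀ O → Bal (O ∘ μ) → C′.Bal O
  bal′ O (s , b) = s , λ e₂ i → trans (cong₂ _+_ (half′ e₂ false (i false)) (half′ e₂ true (i true))) (b e₂ i)
    where
    twisted : ∀ x → O (μ x) ≡ true → sgn (s (μ x)) * sgn (twist x) ≡ sgn (s x)
    twisted x x∈ with x ≟ v
    ... | no _ = ℤₚ.*-identityʳ (sgn (s x))
    ... | yes refl = trans (cong (sgn (s u) *_) (σ-β e false))
        (trans (calc (sgn (s u)) (sgn (s v)) (t e false) (t e true))
          (trans (cong₂ (λ p q → sgn (s v) * p - q * t e true) (sgn² (τ e true)) (b e inside-e))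
              (tidy (sgn (s v)) (t e true))))
      where
      inside-e : Inside (O ∘ μ) e
      inside-e false = trans (cong O (μ-other u u≢v)) x∈
      inside-e true with v ≟ v
      ... | yes _ = x∈
      ... | no ne = contradiction refl ne
      calc : ∀ (x y p q : ℤ) → x * - (p * q) ≡ y * (q * q) - (x * p + y * q) * q
      calc = solve-∀
      tidy : ∀ (y q : ℤ) → y * 1ℤ - 0ℤ * q ≡ y
      tidy = solve-∀
    half′ : ∀ e₂ β → O (μ (head e₂ β)) ≡ true → sgn (s (μ (head e₂ β))) * sgn
        (τ e₂ β ⊗ twist (head e₂ β)) ≡ sgn (s (head e₂ β)) * t e₂ β
    half′ e₂ β i = trans (cong (sgn (s (μ (head e₂ β))) *_) (sgn-⊗ (τ e₂ β) (twist (head e₂ β))))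
      (trans (re (sgn (s (μ (head e₂ β)))) (t e₂ β) (sgn (twist (head e₂ β))))
          (cong (_* t e₂ β) (twisted (head e₂ β) i)))
      where
      re : ∀ (a b c : ℤ) → a * (b * c) ≡ (a * c) * b
      re = solve-∀

  K′ : Fin n → Bool
  K′ x = K x ∧ not (does (x ≟ v))

  private
    K′-other : ∀ x → K x ≡ true → x ≢ v → K′ x ≡ true
    K′-other x x∈ ne with x ≟ v
    ... | yes r = contradiction r ne
    ... | no _ = ∧-intro x∈ refl

    K′-≢ : ∀ x → K′ x ≡ true → x ≢ v
    K′-≢ x h with x ≟ v
    ... | yes _ = λ _ → true≢false h (Boolₚ.∧-zeroʳ (K x))
    ... | no ne = ne

    μ∈ : ∀ x → K x ≡ true → K′ (μ x) ≡ true
    μ∈ x x∈ with x ≟ v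
    ... | yes _ = K′-other u (ends e false) u≢v
    ... | no ne = K′-other x x∈ ne

  contracted : Instance n m
  contracted = record
    { S = S′ ; K = K′
    ; ends = λ e₂ β → μ∈ _ (ends e₂ β)
    ; conn = λ Y p q p∈ q∈ Yp Yq → conn (Y ∘ μ) p q (proj₁ (∧-elim {K p} p∈)) (proj₁ (∧-elim {K q} q∈))
        (trans (cong Y (μ-other p (K′-≢ p p∈))) Yp) (trans (cong Y (μ-other q (K′-≢ q q∈))) Yq)
    ; NB = λ O h → NB (O ∘ μ) (proj₁ h ∘ bal′ O , proj₂ h ∘ bal′ (not ∘ O))
    ; adm = proj₁ adm , flow′ _ (proj₁ (proj₂ adm)) , proj₂ (proj₂ adm)
    ; root = u ; root∈ = K′-other u (ends e false) u≢v }

  smaller : count K′ ℕ.< count K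
  smaller = count-< K′ K (λ x h → proj₁ (∧-elim {K x} h)) v gone (ends e true)
    where
    gone : K′ v ≡ false
    gone with v ≟ v
    ... | yes _ = Boolₚ.∧-zeroʳ (K v)
    ... | no ne = contradiction refl ne

NowhereZeroMod6 : ∀ {n m} → SG n m → Set
NowhereZeroMod6 S = ∃ λ F → Core.Flow S F × (∀ e → ¬ (+ 6 ∣ F e))

mod-6-flow : ∀ {n m} (I : Instance n m) → ¬ ¬ NowhereZeroMod6 (Instance.S I)
mod-6-flow {n} {m} I₀ = go (suc (count (Instance.K I₀))) I₀ ℕₚ.≤-refl
  where
  go : ∀ k (I : Instance n m) → count (Instance.K I) ℕ.< k → ¬ ¬ NowhereZeroMod6 (Instance.S I)
  go (suc k) I (s≤s lt) = do
    yes (Y , p , q , (p∈ , q∈ , Yp , Yq) , e , e′ , only) ← em (∃ λ Y → ∃ λ p → ∃ λ q →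
        (K p ≡ true × K q ≡ true × Y p ≡ true × Y q ≡ false) × ∃₂ λ e e′ → ∀ e₂ → Crossing Y e₂ → e₂ ≡ e ⊎ e₂ ≡ e′)
      where no none → Growing.Starting.cover S K ends conn
                        (λ Y p q p∈ q∈ Yp Yq e e′ only → none
                            (Y , p , q , (p∈ , q∈ , Yp , Yq) , e , e′ , only)) NB root root∈ adm
    -- The edges `e` and `e′` only bound the cut from above; `e₀` certainly crosses and is therefore
    -- one of them.
    (e₀ , c₀) ← conn Y p q p∈ q∈ Yp Yq
    bY ← em (Bal Y)
    bZ ← em (Bal (not ∘ Y))
    let (Z , bal , c₁ , only₁) = side Y bY bZ e₀ c₀ e e′ only
    either-end Z bal e₀ e e′ c₁ only₁ (only e₀ c₀)
    where
    open Instance I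
    open Core S
    open SmallCut S
    swap : {A B : Set} → A ⊎ B → B ⊎ A
    swap (inj₁ a) = inj₂ a
    swap (inj₂ b) = inj₁ b
    side : ∀ Y → Dec (Bal Y) → Dec (Bal (not ∘ Y)) → ∀ e₀ → Crossing Y e₀ → ∀ e e′ →
        (∀ e₂ → Crossing Y e₂ → e₂ ≡ e ⊎ e₂ ≡ e′) →
      ∃ λ Z → Bal Z × Crossing Z e₀ × (∀ e₂ → Crossing Z e₂ → e₂ ≡ e ⊎ e₂ ≡ e′)
    side Y (yes b) _ e₀ c e e′ only = Y , b , c , only
    side Y (no _) (yes b) e₀ c e e′ only = (not ∘ Y) , b , crossing-not⁻ Y e₀ c , λ e₂ c₂ → only e₂
        (crossing-not Y e₂ c₂)
    side Y (no ¬b) (no ¬b′) e₀ c e e′ only = ⊥-elim (NB Y (¬b , ¬b′))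
    reduce : ∀ Z → Bal Z → ∀ e e′ → Crossing Z e → (∀ e₂ → Crossing Z e₂ → e₂ ≡ e ⊎ e₂ ≡ e′) → ¬ ¬ NowhereZeroMod6 S
    reduce Z bal e e′ c only = do
      yes (c′ , e≢e′) ← em (Crossing Z e′ × e ≢ e′)
        where no bridge → ⊥-elim (proj₂ (proj₂ adm) e (bridge-zero Z bal e c
                (λ e₂ c₂ → [ id , (λ { refl → decidable-stable (e₂ ≟ e)
                    (λ ne → bridge (c₂ , ne ∘ sym)) }) ]′ (only e₂ c₂))
                (proj₁ adm) (proj₁ (proj₂ adm))))
      let module Co = Contract I e (distinct c)
      (F′ , flow′ , nz′) ← go k Co.contracted (ℕₚ.≤-trans Co.smaller lt)
      let (F , flow , eq) = Co.lift F′ flow′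
          nz = λ e₂ ne d → nz′ e₂ (subst (+ 6 ∣_) (eq e₂ ne) d)
      return (F , flow , λ e₂ d → case e₂ ≟ e of λ
        { (no ne) → nz e₂ ne d
        ; (yes refl) → nz e′ (e≢e′ ∘ sym) (pair-divides Z bal e₂ e′ e≢e′ c c′ only F flow (+ 6) d) })
      where
      distinct : Crossing Z e → head e false ≢ head e true
      distinct (false , p , q) eq = true≢false p (trans (cong Z eq) q)
      distinct (true , p , q) eq = true≢false p (trans (cong Z (sym eq)) q)
    either-end : ∀ Z → Bal Z → ∀ e₀ e e′ → Crossing Z e₀ → (∀ e₂ → Crossing Z e₂ → e₂ ≡ e ⊎ e₂ ≡ e′) →
        e₀ ≡ e ⊎ e₀ ≡ e′ → ¬ ¬ NowhereZeroMod6 S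
    either-end Z bal e₀ e e′ c only (inj₁ refl) = reduce Z bal e₀ e′ c only
    either-end Z bal e₀ e e′ c only (inj₂ refl) = reduce Z bal e₀ e c (λ e₂ c₂ → swap (only e₂ c₂))

-- Unbalanced circuits and long barbells

module OddCircuits {n m : ℕ} (S : SG n m) where
  open Core S
  open Switching S

  -- `p` is empty when `e` is a negative loop; `new` prevents `p` from running back along `e`
  -- itself.
  record OddCircuit (A : Fin m → Set) : Set where
    field
      e      : Fin m
      β      : Bool
      e∈     : A e
      p      : Walk A (head e (not β)) (head e β)
      simple : Simple p
      new    : cnt p e ≡ 0
      odd    : σ e ⊗ wsg p ≡ neg

  simple-closed : ∀ {A x} (w : Walk A x x) → Simple w → wsg w ≡ pos
  simple-closed nil _ = refl
  simple-closed (cons e β a p q w) (x∉ , _) = contradiction (on-end w) x∉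

  -- A simple path between the ends of e that uses e is e itself.
  simple-parallel : ∀ {A} e β {x y} (w : Walk A x y) → Simple w → head e (not β) ≡ x → head e β ≡ y →
      cnt w e ≢ 0 → wsg w ≡ σ e
  simple-parallel e β nil s p q nz = contradiction refl nz
  simple-parallel e β (cons e₁ β₁ a p₁ q₁ w) (x∉ , s) p q nz with e₁ ≟ e
  ... | no _ = contradiction (subst (λ z → On z w) p (cnt⇒On w e nz (not β))) x∉
  ... | yes refl with β₁ Boolₚ.≟ β
  ...   | yes refl = contradiction (subst (λ z → On z w) (trans (sym q₁) p) (on-start w)) x∉
  ...   | no ne = trans (cong (σ e ⊗_) (closed w s (trans (sym q₁)
      (trans (cong (head e) (sym (Boolₚ.¬-not (ne ∘ sym)))) q)))) (⊗-identityʳ (σ e))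
    where
    closed : ∀ {A x y} (w : Walk A x y) → Simple w → x ≡ y → wsg w ≡ pos
    closed w s refl = simple-closed w s

  -- Loop erasure under control of the sign: positive closed pieces are dropped, and the first
  -- negative one is already the circuit.
  reduce-loops : ∀ {A x y} (w : Walk A x y) → OddCircuit A ⊎ (Σ (Walk A x y) λ u → Simple u × wsg u ≡ wsg w)
  reduce-loops nil = inj₂ (nil , tt , refl)
  reduce-loops {A} {x} (cons e β a refl refl w) with reduce-loops w
  ... | inj₁ c = inj₁ c
  ... | inj₂ (u , s , eq) with On? x u
  ...   | no x∉ = inj₂ (cons e β a refl refl u , (x∉ , s) , cong (σ e ⊗_) eq)
  ...   | yes o = decide (σ e ⊗ wsg pre) refl
    where
    open Split (split u x o)
    decide : ∀ r → σ e ⊗ wsg pre ≡ r → OddCircuit A ⊎ (Σ (Walk A x _) λ u′ → Simple u′ × wsg u′ ≡ σ e ⊗ wsg w)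
    decide pos h = inj₂ (suf , simple-suf s , sym (trans (cong (σ e ⊗_) (trans (sym eq) wsg≡))
        (trans (sym (⊗-assoc (σ e) (wsg pre) (wsg suf))) (cong (_⊗ wsg suf) h))))
    decide neg h = inj₁ record { e = e ; β = β ; e∈ = a ; p = pre ; simple = simple-pre s
      -- If `pre` used `e`, it would consist of `e` alone, and the closed piece would be positive.
      ; new = ≢0-stable (λ nz → contradiction (trans (sym h)
          (trans (cong (σ e ⊗_) (simple-parallel e β pre (simple-pre s) refl refl nz)) (⊗-self (σ e)))) (λ ()))
      ; odd = h }

  OddClosed : (Fin m → Set) → Set
  OddClosed A = ∃ λ x → Σ (Walk A x x) λ w → wsg w ≡ neg

  odd-circuit : ∀ {A} → OddClosed A → OddCircuit A
  odd-circuit (x , w , odd) with reduce-loops w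
  ... | inj₁ c = c
  ... | inj₂ (u , s , eq) = contradiction (trans (sym (simple-closed u s)) (trans eq odd)) (λ ())

  -- Edges are added one at a time; an edge that joins two components of the previous
  -- edges can be made balanced by switching one of them.
  switching-or-odd : ∀ Y k (emb : Fin k → Fin m) →
    ¬ ¬ (OddClosed (Inside Y) ⊎ (∃ λ s → ∀ i → Inside Y (emb i) → bad s (emb i) ≡ false))
  switching-or-odd Y zero emb = return (inj₂ ((λ _ → pos) , λ ()))
  switching-or-odd Y (suc k) emb = do
    inj₂ (s , ok) ← switching-or-odd Y k (emb ∘ suc)
      where inj₁ c → return (inj₁ c)
    yes ins ← em (Inside Y e)
      where no out → return (inj₂ (s , λ { zero ins → contradiction ins out ; (suc i) ins → ok i ins }))
    reach ← setOf (λ v → Walk A (head e false) v)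
    return (decide s ok ins reach (bad s e) refl)
    where
    e = emb zero
    A : Fin m → Set
    A e′ = Inside Y e′ × (∃ λ i → emb (suc i) ≡ e′)
    decide : ∀ s → (∀ i → Inside Y (emb (suc i)) → bad s (emb (suc i)) ≡ false) → Inside Y e → SetOf
        (λ v → Walk A (head e false) v) →
      ∀ b → bad s e ≡ b → OddClosed (Inside Y) ⊎ (∃ λ s → ∀ i → Inside Y (emb i) → bad s (emb i) ≡ false)
    decide s ok ins reach false h = inj₂ (s , λ { zero _ → h ; (suc i) → ok i })
    decide s ok ins reach true h with bool-cases (SetOf.mem reach (head e true))
    ... | inj₁ r = inj₁ (head e false , cons e false ins refl refl (rev (wmap (λ _ → proj₁) w)) ,
        trans (cong₂ _⊗_ (σ-bad s e h) (trans (wsg-rev (wmap (λ _ → proj₁) w))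
            (trans (wsg-wmap w) (balanced-sign s bal w)))) (opp-self (s (head e false) ⊗ s (head e true))))
      where
      w = SetOf.sound reach _ r
      bal : ∀ e′ → A e′ → coef (sgn ∘ s) e′ ≡ 0ℤ
      bal e′ (i , (j , refl)) = not-bad s (emb (suc j)) (ok j i)
      wsg-wmap : ∀ {x y} (w : Walk A x y) → wsg (wmap {B = Inside Y} (λ _ → proj₁) w) ≡ wsg w
      wsg-wmap nil = refl
      wsg-wmap (cons e β a p q w) = cong (σ e ⊗_) (wsg-wmap w)
    ... | inj₂ r = inj₂ (switch R s , λ { zero _ → at-e ; (suc i) → at i })
      where
      R = SetOf.mem reach
      step : ∀ i → Inside Y (emb (suc i)) → ∀ β → R (head (emb (suc i)) β) ≡ true → R
          (head (emb (suc i)) (not β)) ≡ true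
      step i ins β r′ = SetOf.compl reach _ (SetOf.sound reach _ r′ ++ edge (emb (suc i)) β
          (ins , i , refl) refl refl)
      agree : ∀ i → Inside Y (emb (suc i)) → R (head (emb (suc i)) false) xor R (head (emb (suc i)) true) ≡ false
      agree i ins with R (head (emb (suc i)) false) in p | R (head (emb (suc i)) true) in q
      ... | true  | true  = refl
      ... | false | false = refl
      ... | true  | false = ⊥-elim (true≢false (step i ins false p) q)
      ... | false | true  = ⊥-elim (true≢false (step i ins true q) p)
      at : ∀ i → Inside Y (emb (suc i)) → bad (switch R s) (emb (suc i)) ≡ false
      at i ins = trans (bad-switch R s (emb (suc i))) (trans
          (cong (λ b → if b then not (bad s (emb (suc i))) else bad s (emb (suc i))) (agree i ins)) (ok i ins))
      at-e : bad (switch R s) e ≡ false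
      at-e = trans (bad-switch R s e) (trans (cong (λ b → if b then not (bad s e) else bad s e)
        (cong₂ _xor_ (SetOf.compl reach _ nil) r)) (cong not h))

  unbalanced⇒circuit : ∀ Y → ¬ Bal Y → ¬ ¬ OddCircuit (Inside Y)
  unbalanced⇒circuit Y unb = do
    inj₁ c ← switching-or-odd Y m id
      where inj₂ (s , ok) → ⊥-elim (unb (s , λ e i → not-bad s e (ok e i)))
    return (odd-circuit c)

-- From unbalanced vertex sets to a long barbell

toSG : (G : Graph) → Signature G → SG (nV G) (nE G)
toSG G sg = record { head = end G ; τ = λ { e false → pos ; e true → opp (sg e) } }

module Barbell (G : Graph) (sg : Signature G) where
  open Core (toSG G sg)
  open Trails (toSG G sg)
  open OddCircuits (toSG G sg)

  private
    n = nV G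
    m = nE G

  σ≡ : ∀ e → σ e ≡ sg e
  σ≡ e with sg e
  ... | pos = refl
  ... | neg = refl

  positive : ℕ → Bool
  positive zero    = false
  positive (suc _) = true

  positive⇒ : ∀ {k} → positive k ≡ true → k ≢ 0
  positive⇒ {suc k} _ ()

  ⇒positive : ∀ {k} → k ≢ 0 → positive k ≡ true
  ⇒positive {zero}  h = contradiction refl h
  ⇒positive {suc k} _ = refl

  ends-at : Fin m → Fin n → ℕ
  ends-at e v = δℕ (end G e false) v ℕ.+ δℕ (end G e true) v

  ends-at-β : ∀ e β v → ends-at e v ≡ δℕ (end G e β) v ℕ.+ δℕ (end G e (not β)) v
  ends-at-β e false v = refl
  ends-at-β e true  v = ℕₚ.+-comm (δℕ (end G e false) v) _

  weigh : (Fin m → ℕ) → (Fin m → ℕ) → ℕ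
  weigh c J = sumℕ m (λ e → c e ℕ.* J e)

  weigh-+ : ∀ e c J → weigh (λ e′ → δℕ e e′ ℕ.+ c e′) J ≡ J e ℕ.+ weigh c J
  weigh-+ e c J = trans (sumℕ-cong m (λ e′ → ℕₚ.*-distribʳ-+ (J e′) (δℕ e e′) (c e′))) (trans (sumℕ-+ m _ _)
    (cong (ℕ._+ weigh c J) (trans (sumℕ-single m e _ (λ i ne → cong (ℕ._* J i) (δℕ-≢ (ne ∘ sym))))
        (trans (cong (ℕ._* J e) (δℕ-refl e)) (ℕₚ.*-identityˡ (J e))))))

  module _ {A : Fin m → Set} where

    on# : ∀ {x y} → Walk A x y → Fin n → ℕ
    on# w v = bit (onBool w v)

    -- The two extra terms are the ends of an edge closing the path, so the resulting circuit has
    -- degree 2 at every vertex; loops and digons are included.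
    simple-degree : ∀ {x y} (w : Walk A x y) → Simple w → ∀ v →
      weigh (cnt w) (λ e → ends-at e v) ℕ.+ (δℕ x v ℕ.+ δℕ y v) ≡ 2 ℕ.* on# w v
    simple-degree {x} nil s v rewrite sumℕ-zero m {λ _ → 0} (λ _ → refl) with x ≟ v
    ... | yes _ = refl
    ... | no _ = refl
    simple-degree {x} {y} (cons {y = z} e β a refl refl w) (x∉ , s) v = begin
      weigh (cnt (cons e β a refl refl w)) J ℕ.+ (X ℕ.+ Y)
        ≡⟨ cong (ℕ._+ (X ℕ.+ Y)) (trans (weigh-+ e (cnt w) J) (cong (ℕ._+ weigh (cnt w) J) (ends-at-β e β v))) ⟩
      ((X ℕ.+ Z) ℕ.+ weigh (cnt w) J) ℕ.+ (X ℕ.+ Y)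
        ≡⟨ arith X Z (weigh (cnt w) J) Y ⟩
      2 ℕ.* X ℕ.+ (weigh (cnt w) J ℕ.+ (Z ℕ.+ Y))
        ≡⟨ cong (2 ℕ.* X ℕ.+_) (simple-degree w s v) ⟩
      2 ℕ.* X ℕ.+ 2 ℕ.* on# w v
        ≡⟨ sym (ℕₚ.*-distribˡ-+ 2 X (on# w v)) ⟩
      2 ℕ.* (X ℕ.+ on# w v)
        ≡⟨ cong (2 ℕ.*_) first ⟩
      2 ℕ.* on# (cons e β a refl refl w) v ∎
      where
      open ≡-Reasoning
      J = λ e → ends-at e v
      X = δℕ x v
      Y = δℕ y v
      Z = δℕ z v
      arith : ∀ a b c d → ((a ℕ.+ b) ℕ.+ c) ℕ.+ (a ℕ.+ d) ≡ 2 ℕ.* a ℕ.+ (c ℕ.+ (b ℕ.+ d))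
      arith = NatSolver.solve-∀
      first : X ℕ.+ on# w v ≡ on# (cons e β a refl refl w) v
      first with x ≟ v | On? v w
      ... | yes refl | yes o = contradiction o x∉
      ... | yes _ | no _ = refl
      ... | no _ | yes _ = refl
      ... | no _ | no _ = refl

  negs : Fin m → ℕ
  negs e = bit (isNeg (sg e))

  parity-bit : Sign → ℕ
  parity-bit pos = 0
  parity-bit neg = 1

  parity-step : ∀ a b k → ∃ λ k′ → bit (isNeg a) ℕ.+ (parity-bit b ℕ.+ k ℕ.* 2) ≡ parity-bit (a ⊗ b) ℕ.+ k′ ℕ.* 2
  parity-step pos b   k = k , refl
  parity-step neg pos k = k , refl
  parity-step neg neg k = suc k , refl

  walk-parity : ∀ {A x y} (w : Walk A x y) → ∃ λ k → weigh (cnt w) negs ≡ parity-bit (wsg w) ℕ.+ k ℕ.* 2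
  walk-parity nil = 0 , sumℕ-zero m (λ _ → refl)
  walk-parity (cons e β a p q w) with walk-parity w
  ... | k , eq with parity-step (sg e) (wsg w) k
  ...   | k′ , eq′ = k′ , trans (weigh-+ e (cnt w) negs) (trans (cong (negs e ℕ.+_) eq)
      (trans eq′ (cong (λ s → parity-bit (s ⊗ wsg w) ℕ.+ k′ ℕ.* 2) (sym (σ≡ e)))))

  module Circuit {A : Fin m → Set} (O : OddCircuit A) where
    open OddCircuit O

    mult : Fin m → ℕ
    mult e′ = δℕ e e′ ℕ.+ cnt p e′

    mult≤1 : ∀ e′ → mult e′ ℕ.≤ 1
    mult≤1 e′ with e ≟ e′
    ... | yes refl rewrite new = s≤s z≤n
    ... | no _ = simple⇒trail p simple e′

    edges : EdgeSet G
    edges e′ = positive (mult e′)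

    e∈edges : edges e ≡ true
    e∈edges rewrite δℕ-refl e = refl

    edges⇒on : ∀ e′ → edges e′ ≡ true → ∀ γ → On (end G e′ γ) p
    edges⇒on e′ h γ with e ≟ e′
    ... | no _ = cnt⇒On p e′ (positive⇒ h) γ
    ... | yes refl with γ Boolₚ.≟ β
    ...   | yes refl = on-end p
    ...   | no ne = subst (λ b → On (end G e b) p) (sym (Boolₚ.¬-not ne)) (on-start p)

    InV⇒on : ∀ v → InV G edges v → On v p
    InV⇒on v (e′ , h , γ , refl) = edges⇒on e′ h γ

    select : ∀ (J : Fin m → ℕ) e′ → (if edges e′ then J e′ else 0) ≡ mult e′ ℕ.* J e′
    select J e′ with mult e′ | mult≤1 e′
    ... | zero | _ = refl
    ... | suc zero | _ = sym (ℕₚ.*-identityˡ (J e′))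
    ... | suc (suc _) | s≤s ()

    degree-2 : ∀ v → InV G edges v → deg G edges v ≡ 2
    degree-2 v v∈ = trans (sumℕ-cong m (select (λ e′ → ends-at e′ v)))
        (trans (weigh-+ e (cnt p) (λ e′ → ends-at e′ v))
      (trans (cong (ℕ._+ weigh (cnt p) (λ e′ → ends-at e′ v))
          (trans (ends-at-β e β v) (ℕₚ.+-comm (δℕ (end G e β) v) _)))
      (trans (ℕₚ.+-comm _ (weigh (cnt p) (λ e′ → ends-at e′ v))) (trans (simple-degree p simple v)
        (cong (λ b → 2 ℕ.* bit b) (onBool-compl p v (InV⇒on v v∈)))))))

    join : ∀ {x y z} → WalkIn G edges x y → WalkIn G edges y z → WalkIn G edges x z
    join nil w = w
    join (cons e′ γ a p q u) w = cons e′ γ a p q (join u w)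

    sub-walk : ∀ {B x y} (w : Walk B x y) → (∀ e′ → cnt w e′ ≢ 0 → edges e′ ≡ true) → WalkIn G edges x y
    sub-walk nil h = nil
    sub-walk (cons e′ γ a p q w) h = cons e′ γ (h e′ (first (cnt w e′))) p q
        (sub-walk w (λ e″ nz → h e″ (λ z → nz (ℕₚ.m+n≡0⇒n≡0 (δℕ e′ e″) z))))
      where
      first : ∀ k → δℕ e′ e′ ℕ.+ k ≢ 0
      first k rewrite δℕ-refl e′ = λ ()

    connected : ∀ u v → InV G edges u → InV G edges v → WalkIn G edges u v
    connected u v u∈ v∈ = join
      (sub-walk (rev U.pre) (λ e′ nz → in-p e′ (λ z → nz (trans (cnt-rev U.pre e′)
          (ℕₚ.m+n≡0⇒m≡0 (cnt U.pre e′) (trans (sym (U.cnt≡ e′)) z))))))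
      (sub-walk V.pre (λ e′ nz → in-p e′ (λ z → nz (ℕₚ.m+n≡0⇒m≡0 (cnt V.pre e′) (trans (sym (V.cnt≡ e′)) z)))))
      where
      module U = Split (split p u (InV⇒on u u∈))
      module V = Split (split p v (InV⇒on v v∈))
      in-p : ∀ e′ → cnt p e′ ≢ 0 → edges e′ ≡ true
      in-p e′ nz = ⇒positive (λ z → nz (ℕₚ.m+n≡0⇒n≡0 (δℕ e e′) z))

    is-circuit : IsCircuit G edges
    is-circuit = (e , e∈edges) , degree-2 , connected

    unbalanced : Unbalanced G sg edges
    unbalanced with walk-parity (cons e β e∈ refl refl p)
    ... | k , eq = trans (cong (ℕ._% 2) (trans (sumℕ-cong m both)
        (trans eq (cong (λ s → parity-bit s ℕ.+ k ℕ.* 2) odd)))) (ℕDM.[m+kn]%n≡m%n 1 k 2)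
      where
      both : ∀ e′ → (if edges e′ ∧ isNeg (sg e′) then 1 else 0) ≡ mult e′ ℕ.* negs e′
      both e′ = trans (split-if (edges e′) (isNeg (sg e′))) (select negs e′)
        where
        split-if : ∀ a b → (if a ∧ b then 1 else 0) ≡ (if a then bit b else 0)
        split-if true  b = refl
        split-if false b = refl

  module _ {A : Fin m → Set} where

    len : ∀ {x y} → Walk A x y → ℕ
    len nil = 0
    len (cons e β a p q w) = suc (len w)

    vert : ∀ {x y} (w : Walk A x y) → Fin (suc (len w)) → Fin n
    vert {x} nil _ = x
    vert {x} (cons e β a p q w) zero = x
    vert (cons e β a p q w) (suc i) = vert w i

    edg : ∀ {x y} (w : Walk A x y) → Fin (len w) → Fin m
    edg (cons e β a p q w) zero = e
    edg (cons e β a p q w) (suc i) = edg w i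

    vert-zero : ∀ {x y} (w : Walk A x y) → vert w zero ≡ x
    vert-zero nil = refl
    vert-zero (cons e β a p q w) = refl

    vert-last : ∀ {x y} (w : Walk A x y) → vert w (fromℕ (len w)) ≡ y
    vert-last nil = refl
    vert-last (cons e β a p q w) = vert-last w

    vert-on : ∀ {x y} (w : Walk A x y) i → On (vert w i) w
    vert-on nil i = refl
    vert-on (cons e β a p q w) zero = inj₁ refl
    vert-on (cons e β a p q w) (suc i) = inj₂ (vert-on w i)

    edg-cnt : ∀ {x y} (w : Walk A x y) i → cnt w (edg w i) ≢ 0
    edg-cnt (cons e β a p q w) zero rewrite δℕ-refl e = λ ()
    edg-cnt (cons e β a p q w) (suc i) z = edg-cnt w i (ℕₚ.m+n≡0⇒n≡0 (δℕ e (edg w i)) z)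

    simple-path : ∀ {x y} (w : Walk A x y) → Simple w → IsPath G (len w) (vert w) (edg w)
    simple-path w s = vert-inj w s , edg-inj w s , incident w
      where
      vert-inj : ∀ {x y} (w : Walk A x y) → Simple w → ∀ {i j} → vert w i ≡ vert w j → i ≡ j
      vert-inj nil s {zero} {zero} _ = refl
      vert-inj (cons e β a p q w) s {zero} {zero} _ = refl
      vert-inj (cons e β a p q w) (x∉ , s) {zero} {suc j} h = contradiction
          (subst (λ z → On z w) (sym h) (vert-on w j)) x∉
      vert-inj (cons e β a p q w) (x∉ , s) {suc i} {zero} h = contradiction
          (subst (λ z → On z w) h (vert-on w i)) x∉
      vert-inj (cons e β a p q w) (x∉ , s) {suc i} {suc j} h = cong suc (vert-inj w s h)
      fresh : ∀ {x y} {e : Fin m} {β} (w : Walk A x y) → ¬ On (end G e β) w → ∀ j → e ≢ edg w j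
      fresh {β = β} w x∉ j refl = x∉ (cnt⇒On w _ (edg-cnt w j) β)
      edg-inj : ∀ {x y} (w : Walk A x y) → Simple w → ∀ {i j} → edg w i ≡ edg w j → i ≡ j
      edg-inj (cons e β a refl q w) s {zero} {zero} _ = refl
      edg-inj (cons e β a refl q w) (x∉ , s) {zero} {suc j} h = contradiction h (fresh {β = β} w x∉ j)
      edg-inj (cons e β a refl q w) (x∉ , s) {suc i} {zero} h = contradiction (sym h) (fresh {β = β} w x∉ i)
      edg-inj (cons e β a refl q w) (x∉ , s) {suc i} {suc j} h = cong suc (edg-inj w s h)
      incident : ∀ {x y} (w : Walk A x y) i → ∃ λ b → end G (edg w i) b ≡ vert w (inject₁ i) × end G
          (edg w i) (not b) ≡ vert w (suc i)
      incident (cons e β a p q w) zero = β , p , trans q (sym (vert-zero w))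
      incident (cons e β a p q w) (suc i) = incident w i

  module Connect {A : Fin m → Set} (V₁ V₂ : Fin n → Bool) (disjoint : ∀ v → V₁ v ≡ true → V₂ v ≡ true → ⊥) where

    record Link : Set where
      field
        a b    : Fin n
        w      : Walk A a b
        simple : Simple w
        a∈     : V₁ a ≡ true
        b∈     : V₂ b ≡ true
        only₁  : ∀ k → On k w → V₁ k ≡ true → k ≡ a
        only₂  : ∀ k → On k w → V₂ k ≡ true → k ≡ b

    record Tail (x : Fin n) : Set where
      field
        b      : Fin n
        w      : Walk A x b
        simple : Simple w
        b∈     : V₂ b ≡ true
        off₁   : ∀ k → On k w → V₁ k ≡ false
        only₂  : ∀ k → On k w → V₂ k ≡ true → k ≡ b

    stop : ∀ x → V₂ x ≡ true → Tail x
    stop x x∈ = record { b = x ; w = nil ; simple = tt ; b∈ = x∈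
      ; off₁ = λ { k refl → ¬true (λ h → disjoint x h x∈) } ; only₂ = λ { k refl _ → refl } }

    -- The walk is read from its far end. A path to `V₂` avoiding `V₁` is maintained, restarted at
    -- every vertex of `V₂`, and completed at the first vertex of `V₁` met in this direction.
    trace : ∀ {x y} → Walk A x y → V₂ y ≡ true → Tail x ⊎ Link
    trace {x} nil y∈ = inj₁ (stop x y∈)
    trace {x} (cons e β c p q u) y∈ with trace u y∈
    ... | inj₂ l = inj₂ l
    ... | inj₁ T with bool-cases (V₂ x) | bool-cases (V₁ x)
    ...   | inj₁ x∈₂ | _ = inj₁ (stop x x∈₂)
    ...   | inj₂ x∉₂ | inj₁ x∈₁ = inj₂ record { a = x ; b = T.b ; w = cons e β c p q T.w
        ; simple = (λ o → true≢false x∈₁ (T.off₁ x o)) , T.simple ; a∈ = x∈₁ ; b∈ = T.b∈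
        ; only₁ = λ { k (inj₁ r) _ → sym r ; k (inj₂ o) h → ⊥-elim (true≢false h (T.off₁ k o)) }
        ; only₂ = λ { k (inj₁ refl) h → ⊥-elim (true≢false h x∉₂) ; k (inj₂ o) h → T.only₂ k o h } }
      where module T = Tail T
    ...   | inj₂ x∉₂ | inj₂ x∉₁ with On? x (Tail.w T)
    ...     | yes o = inj₁ record { b = T.b ; w = suf ; simple = simple-suf T.simple ; b∈ = T.b∈
        ; off₁ = λ k o → T.off₁ k (on-suf k o) ; only₂ = λ k o → T.only₂ k (on-suf k o) }
      where
      module T = Tail T
      open Split (split T.w x o)
    ...     | no x∉ = inj₁ record { b = T.b ; w = cons e β c p q T.w ; simple = x∉ , T.simple ; b∈ = T.b∈
        ; off₁ = λ { k (inj₁ refl) → x∉₁ ; k (inj₂ o) → T.off₁ k o }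
        ; only₂ = λ { k (inj₁ refl) h → ⊥-elim (true≢false h x∉₂) ; k (inj₂ o) h → T.only₂ k o h } }
      where module T = Tail T

    link : ∀ {x y} → Walk A x y → V₁ x ≡ true → V₂ y ≡ true → Link
    link w x∈ y∈ with trace w y∈
    ... | inj₂ l = l
    ... | inj₁ T = ⊥-elim (true≢false x∈ (Tail.off₁ T _ (on-start (Tail.w T))))

  barbell : ∀ Y₁ Y₂ → (∀ v → Y₁ v ≡ true → Y₂ v ≡ true → ⊥) → ¬ Bal Y₁ → ¬ Bal Y₂ →
    (∀ u v → Y₁ u ≡ true → Y₂ v ≡ true → ¬ ¬ Walk (λ _ → ⊤) u v) → ¬ ¬ ContainsLongBarbell G sg
  barbell Y₁ Y₂ disjoint unb₁ unb₂ joined = do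
    O₁ ← unbalanced⇒circuit Y₁ unb₁
    O₂ ← unbalanced⇒circuit Y₂ unb₂
    w ← joined _ _ (OddCircuit.e∈ O₁ (OddCircuit.β O₁)) (OddCircuit.e∈ O₂ (OddCircuit.β O₂))
    return (assemble O₁ O₂ w)
    where
    on-Y : ∀ Y {x y} (w : Walk (Inside Y) x y) → Y x ≡ true → ∀ v → On v w → Y v ≡ true
    on-Y Y nil x∈ v refl = x∈
    on-Y Y (cons e γ i p q w) x∈ v (inj₁ refl) = x∈
    on-Y Y (cons e γ i p refl w) x∈ v (inj₂ o) = on-Y Y w (i (not γ)) v o
    assemble : (O₁ : OddCircuit (Inside Y₁)) (O₂ : OddCircuit (Inside Y₂)) →
      Walk (λ _ → ⊤) (end G (OddCircuit.e O₁) (OddCircuit.β O₁))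
          (end G (OddCircuit.e O₂) (OddCircuit.β O₂)) → ContainsLongBarbell G sg
    assemble O₁ O₂ w₀ = C₁.edges , C₂.edges , len w , vert w , edg w ,
      C₁.is-circuit , C₁.unbalanced , C₂.is-circuit , C₂.unbalanced ,
      (λ v v₁ v₂ → disjoint v (in₁ v (C₁.InV⇒on v v₁)) (in₂ v (C₂.InV⇒on v v₂))) ,
      path , subst (InV G C₁.edges) (sym (vert-zero w)) (to-InV₁ a a∈) , subst (InV G C₂.edges)
          (sym (vert-last w)) (to-InV₂ b b∈) ,
      (λ i h → proj₁ path (trans (only₁ _ (vert-on w i) (onBool-compl O₁.p _ (C₁.InV⇒on _ h)))
          (sym (vert-zero w)))) ,
      (λ i h → proj₁ path (trans (only₂ _ (vert-on w i) (onBool-compl O₂.p _ (C₂.InV⇒on _ h))) (sym (vert-last w))))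
      where
      module O₁ = OddCircuit O₁
      module O₂ = OddCircuit O₂
      module C₁ = Circuit O₁
      module C₂ = Circuit O₂
      in₁ : ∀ v → On v O₁.p → Y₁ v ≡ true
      in₁ = on-Y Y₁ O₁.p (O₁.e∈ (not O₁.β))
      in₂ : ∀ v → On v O₂.p → Y₂ v ≡ true
      in₂ = on-Y Y₂ O₂.p (O₂.e∈ (not O₂.β))
      open Connect (onBool O₁.p) (onBool O₂.p) (λ v h h′ → disjoint v (in₁ v (onBool-sound O₁.p v h)) (in₂ v (onBool-sound O₂.p v h′)))
      open Link (link w₀ (onBool-compl O₁.p _ (on-end O₁.p)) (onBool-compl O₂.p _ (on-end O₂.p)))
      path = simple-path w simple
      to-InV : ∀ {Y} (O : OddCircuit (Inside Y)) → ∀ v → onBool (OddCircuit.p O) v ≡ true → InV G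
          (Circuit.edges O) v
      to-InV O v h = go (OddCircuit.p O) (λ e′ nz → ⇒positive
          (λ z → nz (ℕₚ.m+n≡0⇒n≡0 (δℕ (OddCircuit.e O) e′) z))) (onBool-sound (OddCircuit.p O) v h)
          (OddCircuit.e O , Circuit.e∈edges O , not (OddCircuit.β O) , refl)
        where
        go : ∀ {A x y v} (w : Walk A x y) → (∀ e′ → cnt w e′ ≢ 0 → Circuit.edges O e′ ≡ true) → On v w →
            InV G (Circuit.edges O) x → InV G (Circuit.edges O) v
        go nil sub refl x∈ = x∈
        go (cons e γ i p q w) sub (inj₁ refl) x∈ = x∈
        go (cons e γ i p refl w) sub (inj₂ o) x∈ = go w (λ e′ nz → sub e′
            (λ z → nz (ℕₚ.m+n≡0⇒n≡0 (δℕ e e′) z))) o (e , sub e (first (cnt w e)) , not γ , refl)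
          where
          first : ∀ k → δℕ e e ℕ.+ k ≢ 0
          first k rewrite δℕ-refl e = λ ()
      to-InV₁ = to-InV {Y₁} O₁
      to-InV₂ = to-InV {Y₂} O₂

-- Restriction to a connected component

module Component {n m : ℕ} (S : SG n m) (ρ : Fin n) (reach : SetOf (λ v → Core.Walk S (λ _ → ⊤) ρ v)) where
  open Core S

  mem : Fin n → Bool
  mem = SetOf.mem reach

  step : ∀ e β → mem (head e β) ≡ true → mem (head e (not β)) ≡ true
  step e β h = SetOf.compl reach _ (SetOf.sound reach _ h ++ edge e β tt refl refl)

  both : ∀ e b → mem (head e false) ≡ b → ∀ β → mem (head e β) ≡ b
  both e b     h false = h
  both e true  h true  = step e false h
  both e false h true  = ¬true (λ h′ → true≢false (step e true h′) h)

  ρ∈ : mem ρ ≡ true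
  ρ∈ = SetOf.compl reach ρ nil

  joined : ∀ u v → mem u ≡ true → mem v ≡ true → Walk (λ _ → ⊤) u v
  joined u v u∈ v∈ = rev (SetOf.sound reach u u∈) ++ SetOf.sound reach v v∈

  -- Edges outside the component become positive loops at ρ, which keeps the edge type.
  S′ : SG n m
  S′ = record
    { head = λ e β → if mem (head e false) then head e β else ρ
    ; τ    = λ e β → if mem (head e false) then τ e β else (if β then neg else pos) }

  module C′ = Core S′

  private
    away : ∀ {u v b} → mem u ≡ b → mem v ≡ not b → δ u v ≡ 0ℤ
    away {u} {v} {true}  p q = δ-≢ {i = u} {v} (λ { refl → true≢false p q })
    away {u} {v} {false} p q = δ-≢ {i = u} {v} (λ { refl → true≢false q p })

    zeros : ∀ (a b : ℤ) → 0ℤ * a + 0ℤ * b ≡ 0ℤ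
    zeros = solve-∀

    loop : ∀ (a : ℤ) → a * 1ℤ + a * - 1ℤ ≡ 0ℤ
    loop = solve-∀

  inc-away : ∀ e v b → mem (head e false) ≡ b → mem v ≡ not b → inc e v ≡ 0ℤ
  inc-away e v b p q = trans (cong₂ (λ x y → x * t e false + y * t e true) (away {head e false} p q)
      (away {head e true} (both e b p true) q)) (zeros (t e false) (t e true))

  inc′ : ∀ e v → C′.inc e v ≡ (if mem v then inc e v else 0ℤ)
  inc′ e v with mem (head e false) in p | mem v in q
  ... | true  | true  = refl
  ... | true  | false = inc-away e v true p q
  ... | false | true  = trans (loop (δ ρ v)) (sym (inc-away e v false p q))
  ... | false | false = trans (cong₂ (λ x y → x * 1ℤ + y * - 1ℤ) (away {ρ} ρ∈ q) (away {ρ} ρ∈ q)) refl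

  ∂-in : ∀ f v → mem v ≡ true → C′.∂ f v ≡ ∂ f v
  ∂-in f v h = sum-cong m (λ e → cong (_* f e) (trans (inc′ e v) (cong (λ b → if b then inc e v else 0ℤ) h)))

  ∂-out : ∀ f v → mem v ≡ false → C′.∂ f v ≡ 0ℤ
  ∂-out f v h = sum-zero m (λ e → cong (_* f e) (trans (inc′ e v) (cong (λ b → if b then inc e v else 0ℤ) h)))

  -- The added loops are positive and satisfied by every choice of signs.
  bal′ : ∀ O → Bal (λ v → O v ∧ mem v) → C′.Bal O
  bal′ O (s , b) = s , go
    where
    go : ∀ e → C′.Inside O e → C′.coef (sgn ∘ s) e ≡ 0ℤ
    go e i with mem (head e false) in p
    ... | true  = b e (λ β → ∧-intro (i β) (both e true p β))
    ... | false = loop (sgn (s ρ))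

  instance-of : (∃ λ g → Flow g × (∀ e → g e ≢ 0ℤ)) →
    (∀ Y₁ Y₂ → (∀ v → Y₁ v ≡ true → Y₂ v ≡ true → ⊥) → ¬ Bal Y₁ → ¬ Bal Y₂ →
      (∀ u v → Y₁ u ≡ true → Y₂ v ≡ true → ¬ ¬ Walk (λ _ → ⊤) u v) → ⊥) → Instance n m
  instance-of (g , G , g≢0) no-barbell = record
    { S = S′ ; K = mem
    ; ends = ends′
    ; conn = λ Y p q p∈ q∈ Yp Yq none → true≢false (spread Y none (joined p q p∈ q∈) p∈ Yp) Yq
    ; NB = λ { O (u₁ , u₂) → no-barbell (λ v → O v ∧ mem v) (λ v → not (O v) ∧ mem v)
        (λ v h h′ → true≢false (proj₁ (∧-elim {O v} h)) (not-true⁻ (proj₁ (∧-elim {not (O v)} h′))))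
        (u₁ ∘ bal′ O) (u₂ ∘ bal′ (not ∘ O))
        (λ u v h h′ → return (joined u v (proj₂ (∧-elim {O u} h)) (proj₂ (∧-elim {not (O v)} h′)))) }
    ; adm = g , (λ v → [ (λ h → trans (∂-in g v h) (G v)) , ∂-out g v ]′ (bool-cases (mem v))) , g≢0
    ; root = ρ ; root∈ = ρ∈ }
    where
    ends′ : ∀ e β → mem (C′.head e β) ≡ true
    ends′ e β with mem (head e false) in p
    ... | true  = both e true p β
    ... | false = ρ∈
    head-in : ∀ e β → mem (head e false) ≡ true → C′.head e β ≡ head e β
    head-in e β h = cong (λ b → if b then head e β else ρ) h
    spread : ∀ Y → ¬ (∃ λ e → C′.Crossing Y e) → ∀ {p q} → Walk (λ _ → ⊤) p q → mem p ≡ true → Y p ≡ true →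
        Y q ≡ true
    spread Y none nil p∈ Yp = Yp
    spread Y none (cons e β _ refl refl w) p∈ Yp = spread Y none w (step e β p∈)
      (decidable-stable (_ Boolₚ.≟ true) (λ ne → none (e , β ,
        trans (cong Y (head-in e β here)) Yp , trans (cong Y (head-in e (not β) here)) (¬true ne))))
      where
      here : mem (head e false) ≡ true
      here = go β p∈
        where
        go : ∀ β → mem (head e β) ≡ true → mem (head e false) ≡ true
        go false h = h
        go true  h = step e true h

-- Gluing the components and removing the double negation

module Assembly {n m : ℕ} (S : SG n m)
  (adm : ∃ λ g → Core.Flow S g × (∀ e → g e ≢ 0ℤ))
  (no-barbell : ∀ Y₁ Y₂ → (∀ v → Y₁ v ≡ true → Y₂ v ≡ true → ⊥) → ¬ Core.Bal S Y₁ → ¬ Core.Bal S Y₂ →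
      (∀ u v → Y₁ u ≡ true → Y₂ v ≡ true → ¬ ¬ Core.Walk S (λ _ → ⊤) u v) → ⊥) where
  open Core S

  Bounded : ℤ → Set
  Bounded x = 1 ℕ.≤ ∣ x ∣ × ∣ x ∣ ℕ.≤ 5

  on-component : ∀ ρ (reach : SetOf (λ v → Walk (λ _ → ⊤) ρ v)) →
    ¬ ¬ (∃ λ f → (∀ v → SetOf.mem reach v ≡ true → ∂ f v ≡ 0ℤ) × (∀ e → Bounded (f e)))
  on-component ρ reach = do
    let I = Co.instance-of adm no-barbell
    (F , flow , F∤) ← mod-6-flow I
    let r = λ e → F e ℤDM.%ℕ 6
        q = λ e → F e ℤDM./ℕ 6
        F≡ = λ e → trans (ℤDM.a≡a%ℕn+[a/ℕn]*n (F e) 6) (cong (λ z → + (F e ℤDM.%ℕ 6) + z)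
            (ℤₚ.*-comm (F e ℤDM./ℕ 6) (+ 6)))
        r≥1 = λ e → ℕₚ.n≢0⇒n>0 (λ z → F∤ e (divides (q e) (trans (ℤDM.a≡a%ℕn+[a/ℕn]*n (F e) 6)
                (trans (cong (λ k → + k + q e * + 6) z) (ℤₚ.+-identityˡ (q e * + 6))))))
        r≤5 = λ e → ℕₚ.≤-pred (ℤDM.n%ℕd<d (F e) 6)
    (b , b-flow) ← Rounding.Fractional.round Co.S′ q r r≥1 r≤5
        (λ v → trans (Co.C′.∂-cong (λ e → sym (F≡ e)) v) (flow v)) (Instance.NB I)
    -- Subtracting six times the integral flow leaves `r` or `r - 6`, so the value lies in 1..5 or
    -- in -5..-1.
    let value = λ e → F e + - + 6 * Rounding.val Co.S′ q b e
    return (value ,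
      (λ v v∈ → trans (sym (Co.∂-in value v v∈)) (trans (Co.C′.∂-lin F (- + 6) (Rounding.val Co.S′ q b) v)
        (cong₂ (λ x y → x + - + 6 * y) (flow v) (b-flow v)))) ,
      (λ e → subst Bounded (sym (trans (cong (_+ - + 6 * (q e + + bit (b e))) (F≡ e))
          (simplify (+ r e) (q e) (+ bit (b e)))))
        (bounded (b e) (r e) (r≥1 e) (r≤5 e))))
    where
    module Co = Component S ρ reach
    simplify : ∀ (r q b : ℤ) → r + + 6 * q + - + 6 * (q + b) ≡ r - + 6 * b
    simplify = solve-∀
    bounded : ∀ c k → 1 ℕ.≤ k → k ℕ.≤ 5 → Bounded (+ k - + 6 * + bit c)
    bounded false k lo hi = subst Bounded (sym (ℤₚ.+-identityʳ (+ k))) (lo , hi)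
    bounded true 1 _ _ = s≤s z≤n , s≤s (s≤s (s≤s (s≤s (s≤s z≤n))))
    bounded true 2 _ _ = s≤s z≤n , s≤s (s≤s (s≤s (s≤s z≤n)))
    bounded true 3 _ _ = s≤s z≤n , s≤s (s≤s (s≤s z≤n))
    bounded true 4 _ _ = s≤s z≤n , s≤s (s≤s z≤n)
    bounded true 5 _ _ = s≤s z≤n , s≤s z≤n
    bounded true (suc (suc (suc (suc (suc (suc k)))))) _ (s≤s (s≤s (s≤s (s≤s (s≤s ())))))

  -- Each edge is reached from its own first end, so all edges are bounded once every vertex has
  -- been treated. Overwriting a whole component preserves conservation, since no edge leaves it.
  over-vertices : ∀ k (emb : Fin k → Fin n) →
    ¬ ¬ (∃ λ f → Flow f × (∀ e i → Walk (λ _ → ⊤) (emb i) (head e false) → Bounded (f e)))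
  over-vertices zero emb = return ((λ _ → 0ℤ) , ∂-zero , λ _ ())
  over-vertices (suc k) emb = do
    (f , flow , bound) ← over-vertices k (emb ∘ suc)
    reach ← setOf (λ v → Walk (λ _ → ⊤) (emb zero) v)
    (f₀ , flow₀ , bound₀) ← on-component (emb zero) reach
    return (override reach f f₀ flow flow₀ bound bound₀)
    where
    override : (reach : SetOf (λ v → Walk (λ _ → ⊤) (emb zero) v)) → ∀ f f₀ → Flow f →
        (∀ v → SetOf.mem reach v ≡ true → ∂ f₀ v ≡ 0ℤ) →
      (∀ e i → Walk (λ _ → ⊤) (emb (suc i)) (head e false) → Bounded (f e)) → (∀ e → Bounded (f₀ e)) →
      ∃ λ f → Flow f × (∀ e i → Walk (λ _ → ⊤) (emb i) (head e false) → Bounded (f e))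
    override reach f f₀ flow flow₀ bound bound₀ = g , g-flow , g-bound
      where
      module Co = Component S (emb zero) reach
      g : Fin m → ℤ
      g e = if Co.mem (head e false) then f₀ e else f e
      local : ∀ e v → inc e v * g e ≡ inc e v * (if Co.mem v then f₀ e else f e)
      local e v with Co.mem (head e false) in p | Co.mem v in q
      ... | true  | true  = refl
      ... | false | false = refl
      ... | true  | false = trans (cong (_* f₀ e) (Co.inc-away e v true p q))
          (sym (cong (_* f e) (Co.inc-away e v true p q)))
      ... | false | true  = trans (cong (_* f e) (Co.inc-away e v false p q))
          (sym (cong (_* f₀ e) (Co.inc-away e v false p q)))
      g-flow : Flow g
      g-flow v = trans (sum-cong m (λ e → local e v)) (go (Co.mem v) refl)
        where
        go : ∀ b → Co.mem v ≡ b → sumℤ m (λ e → inc e v * (if b then f₀ e else f e)) ≡ 0ℤ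
        go true  h = flow₀ v h
        go false h = flow v
      g-bound : ∀ e i → Walk (λ _ → ⊤) (emb i) (head e false) → Bounded (g e)
      g-bound e i w with Co.mem (head e false) in p
      ... | true = bound₀ e
      g-bound e zero w | false = ⊥-elim (true≢false (SetOf.compl reach _ w) p)
      g-bound e (suc i) w | false = bound e i w

  bounded-flow : ¬ ¬ (∃ λ f → Flow f × (∀ e → Bounded (f e)))
  bounded-flow = do
    (f , flow , bound) ← over-vertices n id
    return (f , flow , λ e → bound e (head e false) nil)

  private
    search : ∀ k {j} {P : Vec (Fin j) k → Set} → (∀ v → Dec (P v)) → Dec (∃ P)
    search zero P? = map′ (λ p → [] , p) (λ { ([] , p) → p }) (P? [])
    search (suc k) P? = map′ (λ { (i , v , p) → i ∷ v , p }) (λ { (i ∷ v , p) → i , v , p })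
      (Finₚ.any? (λ i → search k (λ v → P? (i ∷ v))))

    -- Differences of two numbers below 6 are precisely the integers from -5 to 5, so the search
    -- runs over two vectors.
    decode : Fin 6 → Fin 6 → ℤ
    decode i j = + toℕ i - + toℕ j

    encode : ∀ x → ∣ x ∣ ℕ.≤ 5 → ∃₂ λ i j → decode i j ≡ x
    encode (+ k) le = Fin.fromℕ< (s≤s le) , zero , trans (ℤₚ.+-identityʳ _) (cong +_ (Finₚ.toℕ-fromℕ< (s≤s le)))
    encode -[1+ k ] le = zero , Fin.fromℕ< (s≤s le) , trans (ℤₚ.+-identityˡ _)
        (cong (λ z → - + z) (Finₚ.toℕ-fromℕ< (s≤s le)))

    Good : Vec (Fin 6) m → Vec (Fin 6) m → Set
    Good a b = Flow f × (∀ e → Bounded (f e))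
      where
      f : Fin m → ℤ
      f e = decode (lookup a e) (lookup b e)

  bounded-flow-exists : ∃ λ f → Flow f × (∀ e → Bounded (f e))
  bounded-flow-exists = let (a , b , good) = found in (λ e → decode (lookup a e) (lookup b e)) , good
    where
    good? : ∀ a b → Dec (Good a b)
    good? a b = Finₚ.all? (λ v → ∂ _ v ℤₚ.≟ 0ℤ) ×-dec Finₚ.all? (λ e → (1 ℕₚ.≤? _) ×-dec (_ ℕₚ.≤? 5))
    found : ∃₂ Good
    found = decidable-stable (search m (λ a → search m (good? a))) (do
      (f , flow , bound) ← bounded-flow
      let code = λ e → encode (f e) (proj₂ (bound e))
          a = tabulate (λ e → proj₁ (code e))
          b = tabulate (λ e → proj₁ (proj₂ (code e)))
          eq = λ e → trans (cong₂ decode (lookup∘tabulate (λ e → proj₁ (code e)) e)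
              (lookup∘tabulate (λ e → proj₁ (proj₂ (code e))) e)) (proj₂ (proj₂ (code e)))
      return (a , b , (λ v → trans (∂-cong eq v) (flow v)) , λ e → subst Bounded (sym (eq e)) (bound e)))

-- Passage between arbitrary orientations and the reference orientation

module FromGraph (G : Graph) (sg : Signature G) where
  open Core (toSG G sg)

  private
    if-* : ∀ b x y → (if b then x * y else 0ℤ) ≡ (if b then 1ℤ else 0ℤ) * x * y
    if-* true  x y = cong (_* y) (sym (ℤₚ.*-identityˡ x))
    if-* false x y = sym (trans (cong (_* y) (ℤₚ.*-zeroˡ x)) (ℤₚ.*-zeroˡ y))

  reference : Fin (nE G) → Bool → ℤ
  reference e b = t e b

  reference-orientation : IsOrientation G sg reference
  reference-orientation = (λ e b → sgn-unit (SG.τ (toSG G sg) e b)) , λ e → trans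
      (ℤₚ.*-identityˡ (sgn (opp (sg e)))) (sgn-opp (sg e))

  boundary-∂ : ∀ f v → boundary G reference f v ≡ ∂ f v
  boundary-∂ f v = sum-cong (nE G) (λ e → trans (cong₂ _+_ (if-* (does (end G e false ≟ v)) (t e false)
      (f e)) (if-* (does (end G e true ≟ v)) (t e true) (f e)))
    (sym (ℤₚ.*-distribʳ-+ (f e) (δ (end G e false) v * t e false) (δ (end G e true) v * t e true))))

  -- The sign of the first half-edge is absorbed into the value; the second half-edge then matches
  -- because the product of both signs is prescribed.
  reorient : ∀ τ f → IsOrientation G sg τ → ∀ v → ∂ (λ e → τ e false * f e) v ≡ boundary G τ f v
  reorient τ f (units , signs) v = sum-cong (nE G) (λ e → sym (trans
      (cong₂ _+_ (if-* (does (end G e false ≟ v)) (τ e false) (f e))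
          (if-* (does (end G e true ≟ v)) (τ e true) (f e)))
      (trans (cong (λ z → δ (end G e false) v * τ e false * f e + δ (end G e true) v * z * f e) (other e))
        (calc (δ (end G e false) v) (δ (end G e true) v) (τ e false) (f e) (sgn (opp (sg e)))))))
    where
    calc : ∀ (a b x f s : ℤ) → a * x * f + b * (s * x) * f ≡ (a * 1ℤ + b * s) * (x * f)
    calc = solve-∀
    square : ∀ {x} → IsUnit x → x * x ≡ 1ℤ
    square (inj₁ refl) = refl
    square (inj₂ refl) = refl
    other : ∀ e → τ e true ≡ sgn (opp (sg e)) * τ e false
    other e = sym (trans (cong (_* τ e false) (trans (sgn-opp (sg e)) (sym (signs e))))
        (trans (re (τ e false) (τ e true))
      (trans (cong (_* τ e true) (square (units e false))) (ℤₚ.*-identityˡ (τ e true)))))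
      where
      re : ∀ (x y : ℤ) → (x * y) * x ≡ (x * x) * y
      re = solve-∀

  admissible : FlowAdmissible G sg → ∃ λ g → Flow g × (∀ e → g e ≢ 0ℤ)
  admissible (k , _ , τ , f , orient@(units , _) , flow , bound) =
    (λ e → τ e false * f e) , (λ v → trans (reorient τ f orient v) (flow v)) , λ e z → nonzero e (cancel e z)
    where
    nonzero : ∀ e → f e ≢ 0ℤ
    nonzero e z = ℕₚ.<-irrefl refl (subst (λ x → 1 ℕ.≤ ∣ x ∣) z (proj₁ (bound e)))
    cancel : ∀ e → τ e false * f e ≡ 0ℤ → f e ≡ 0ℤ
    cancel e z with ℤₚ.i*j≡0⇒i≡0∨j≡0 (τ e false) z | units e false
    ... | inj₂ p | _ = p
    ... | inj₁ p | inj₁ q = contradiction (trans (sym q) p) (λ ())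
    ... | inj₁ p | inj₂ q = contradiction (trans (sym q) p) (λ ())

theorem3p3 : (G : Graph) (σ : Signature G) →
    FlowAdmissible G σ → ¬ ContainsLongBarbell G σ → HasNZFlow G σ 6
theorem3p3 G σ adm no-barbell =
  reference , f , reference-orientation , (λ v → trans (boundary-∂ f v) (flow v)) , bound
  where
  open FromGraph G σ
  found : ∃ λ f → Core.Flow (toSG G σ) f × (∀ e → 1 ℕ.≤ ∣ f e ∣ × ∣ f e ∣ ℕ.≤ 5)
  found = Assembly.bounded-flow-exists (toSG G σ) (admissible adm)
    (λ Y₁ Y₂ disjoint unb₁ unb₂ joined → Barbell.barbell G σ Y₁ Y₂ disjoint unb₁ unb₂ joined no-barbell)
  f = proj₁ found
  flow = proj₁ (proj₂ found)
  bound = proj₂ (proj₂ found)
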